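{- For each pair $(b,k)$ listed below, $R_{(b,k)}$ is at most the listed number: $(5,5)$: $0.16894$; $(6,5)$: $0.34512$; $(6,6)$: $0.08475$; $(7,6)$: $0.19897$; $(8,6)$: $0.31799$; $(9,6)$: $0.43237$; $(10,6)$: $0.53909$; $(11,6)$: $0.63766$; $(12,6)$: $0.72848$; $(13,6)$: $0.81227$; $(14,6)$: $0.88978$; $(7,7)$: $0.04090$; $(8,7)$: $0.10865$; $(9,7)$: $0.19054$; $(10,7)$: $0.27741$; $(11,7)$: $0.36424$; $(12,7)$: $0.44850$; $(13,7)$: $0.52902$; $(14,7)$: $0.60538$; $(8,8)$: $0.01889$; $(9,8)$: $0.05616$; $(10,8)$: $0.10791$; $(11,8)$: $0.16878$; $(12,8)$: $0.23451$; $(13,8)$: $0.30214$; $(14,8)$: $0.36974$; $(10,9)$: $0.02773$; $(11,9)$: $0.05796$; $(12,9)$: $0.09730$; $(13,9)$: $0.14332$; $(14,9)$: $0.19382$; $(11,10)$: $0.01321$; $(12,10)$: $0.02978$; $(13,10)$: $0.05342$; $(14,10)$: $0.08332$; $(13,11)$: $0.01476$; $(14,11)$: $0.02815$; $(14,12)$: $0.00712$; $(15,13)$: $0.00335$.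
   Context: For integers $b\ge k\ge 2$ and $n\ge1$, a $(b,k)$-hash code of length $n$ is a subset $C\subseteq\{1,\dots,b\}^n$ such that for any $k$ distinct elements of $C$ there is a coordinate $i$ in which their $i$-th entries are pairwise distinct. $A(b,k,n)$ denotes the largest size of a $(b,k)$-hash code of length $n$, and $R_{(b,k)}=\limsup_{n\to\infty}\frac1n\log_2 A(b,k,n)$. All logarithms are to base 2. -}

module Defs where

open import Data.Nat using (ℕ; _*_; _+_; _^_; _≤_)
open import Data.Fin using (Fin)
open import Data.Vec using (Vec; lookup)
open import Data.Product using (_×_; _,_; ∃)
open import Data.List using (List; []; _∷_)
open import Function.Definitions using (Injective)
open import Relation.Binary.PropositionalEquality using (_≡_)

IsHashCode : (b k n M : ℕ) → (Fin M → Vec (Fin b) n) → Set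
IsHashCode b k n M c =
  Injective _≡_ _≡_ c ×
  ((f : Fin k → Fin M) → Injective _≡_ _≡_ f →
     ∃ λ (i : Fin n) → Injective _≡_ _≡_ (λ j → lookup (c (f j)) i))

-- R_(b,k) ≤ p/q, i.e. limsup (1/n) log2 A(b,k,n) ≤ p/q, unfolded:
-- for every ε = 1/m (m ≥ 1) there is N such that for all n ≥ N and every
-- (b,k)-hash code of length n of size M:  log2 M ≤ (p/q + 1/m) n,
-- i.e.  M^(q m) ≤ 2^((p m + q) n).
RateAtMost : (b k p q : ℕ) → Set
RateAtMost b k p q =
  (m : ℕ) → 1 ≤ m → ∃ λ (N : ℕ) → (n : ℕ) → N ≤ n →
    (M : ℕ) (c : Fin M → Vec (Fin b) n) → IsHashCode b k n M c →
    M ^ (q * m) ≤ 2 ^ ((p * m + q) * n)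

-- Table of (b, k, bound × 10^5).
table : List (ℕ × ℕ × ℕ)
table =
  (5 , 5 , 16894) ∷ (6 , 5 , 34512) ∷ (6 , 6 , 8475) ∷ (7 , 6 , 19897) ∷
  (8 , 6 , 31799) ∷ (9 , 6 , 43237) ∷ (10 , 6 , 53909) ∷ (11 , 6 , 63766) ∷
  (12 , 6 , 72848) ∷ (13 , 6 , 81227) ∷ (14 , 6 , 88978) ∷ (7 , 7 , 4090) ∷
  (8 , 7 , 10865) ∷ (9 , 7 , 19054) ∷ (10 , 7 , 27741) ∷ (11 , 7 , 36424) ∷
  (12 , 7 , 44850) ∷ (13 , 7 , 52902) ∷ (14 , 7 , 60538) ∷ (8 , 8 , 1889) ∷
  (9 , 8 , 5616) ∷ (10 , 8 , 10791) ∷ (11 , 8 , 16878) ∷ (12 , 8 , 23451) ∷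
  (13 , 8 , 30214) ∷ (14 , 8 , 36974) ∷ (10 , 9 , 2773) ∷ (11 , 9 , 5796) ∷
  (12 , 9 , 9730) ∷ (13 , 9 , 14332) ∷ (14 , 9 , 19382) ∷ (11 , 10 , 1321) ∷
  (12 , 10 , 2978) ∷ (13 , 10 , 5342) ∷ (14 , 10 , 8332) ∷ (13 , 11 , 1476) ∷
  (14 , 11 , 2815) ∷ (14 , 12 , 712) ∷ (15 , 13 , 335) ∷ []

{-# OPTIONS --safe #-}
module Submission where

-- Let t = k - 2. Discarding the rarest letters in each of the first ℓ coordinates, one splits the code, up to a
-- negligible rest, into chunks of fixed size whose words use at most t - 1 letters in each of these coordinates.
-- For t words of one chunk, Hansel's lemma bounds the logarithm of the size of the code by log (b - t) times the
-- average number of coordinates in which a further word extends them to t + 1 distinct letters; the first ℓ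
-- coordinates contribute nothing. Averaging over the chunks, another coordinate contributes t! 𝔼 Σᵢ qᵢ eₜ(p without i),
-- where p is the letter distribution of a random chunk and q = 𝔼 p.
--
-- This is largest when p is uniform: as 𝔼 Σᵢ qᵢ (pᵢ - qᵢ) = 0, a multiple of this sum may be added, after which one
-- completes the square in qᵢ - qⱼ for every pair of letters. The deficit of eₜ(p) from its value at the uniform point is
-- a sum of terms (pᵢ - pⱼ)² κ(p without i, j), so what remains is an inequality for each pair, which follows from
-- the weak Maclaurin inequalities n (m + 1) eₘ₊₁ ≤ (n - m) e₁ eₘ and a numerical condition on b and t.
--
-- Optimising ℓ gives the rate 1 / (1 / log (b / (t - 1)) + bᵗ⁺¹ / (b (b - 1) ⋯ (b - t) log (b - t))), which is at
-- most the listed number in every row.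

open import Defs
open import Data.Nat using (ℕ)
open import Data.Product using (_,_)
open import Data.List.Membership.Propositional using (_∈_)

open import Data.Bool using (if_then_else_; true; false)
open import Data.Empty using (⊥; ⊥-elim)
open import Data.Fin as Fin using (Fin; zero; suc)
import Data.Fin.Properties as Fin
import Data.Integer as ℤ
import Data.Integer.Properties as ℤ
import Data.Integer.Tactic.RingSolver as ℤ
open import Data.List as List using (List; []; _∷_; _++_; length; concat; allFin; take; drop)
import Data.List.Properties as List
open import Data.List.Membership.Propositional using (_∉_; lose; find)
open import Data.List.Membership.Propositional.Properties using (∈-allFin; ∈-++⁺ˡ; ∈-++⁺ʳ)
open import Data.List.Relation.Binary.Permutation.Propositional as ↭ using (_↭_; ↭-refl; ↭-trans; ↭-sym; ↭-prep; ↭-reflexive; ↭⇒↭ₛ)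
open import Data.List.Relation.Binary.Permutation.Propositional.Properties using (shift; shifts; ++⁺ˡ; ++⁺ʳ; ↭-length)
import Data.List.Relation.Binary.Permutation.Setoid.Properties as ↭ₛ
open import Data.List.Relation.Unary.All as All using (All; []; _∷_)
open import Data.List.Relation.Unary.AllPairs as AllPairs using (AllPairs; []; _∷_)
import Data.List.Relation.Unary.AllPairs.Properties as AllPairs
open import Data.List.Relation.Unary.Any using (here; there; any?)
open import Data.List.Relation.Unary.Unique.Propositional using (Unique)
open import Data.List.Relation.Unary.Unique.Propositional.Properties using (allFin⁺)
open import Data.Nat using (zero; suc)
open import Data.Product using (_×_; ∃; ∃₂; proj₁; proj₂)
open import Data.Sum using (_⊎_; inj₁; inj₂)
open import Data.Vec as Vec using (Vec; []; _∷_)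
import Data.Vec.Properties as Vec
import Data.Vec.Relation.Unary.All as VecAll
import Data.Vec.Relation.Unary.All.Properties as VecAll
import Data.Vec.Relation.Unary.AllPairs as VecAllPairs
import Data.Vec.Relation.Unary.Unique.Propositional as VecUnique
import Data.Vec.Relation.Unary.Unique.Propositional.Properties as VecUnique
open import Function using (_∘_; id)
open import Relation.Binary.PropositionalEquality hiding (J)
open import Relation.Nullary using (Dec; yes; no; does; ¬_; ¬?; _×-dec_; _⊎-dec_)
open import Relation.Nullary.Decidable using (map′; True; toWitness)

-- The relation `𝔼 p = q` is what makes the uniform distribution optimal: for unrelated `p` and `q`
-- the sum can be larger, for instance when `q` sits on one letter and `p` is uniform on the others.
-- Therefore all chunks have the same size, and `q` is taken over the union of all chunks, the one
-- containing the `t` words included. Hansel's lemma is applied only to the words of the other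
-- chunks; counting the whole union instead merely weakens its bound. A chunk that is poor in
-- letters on `ℓ` coordinates costs a factor `(b / (t - 1))^ℓ` of the words, so `ℓ` is taken where
-- the size of the code just suffices. That the size does not suffice for `ℓ + 1` bounds it in terms
-- of `ℓ`, Hansel's lemma bounds it in terms of `n - ℓ`, and a weighted combination of both
-- eliminates `ℓ`. No real number occurs: probabilities are counts with cleared denominators,
-- inequalities between logarithms are inequalities between powers, and averaging them means
-- multiplying these.

data Pick {A : Set} : List A → A → List A → Set where
  here  : ∀ {a l} → Pick (a ∷ l) a l
  there : ∀ {a c l r} → Pick l a r → Pick (c ∷ l) a (c ∷ r)

Pick-length : ∀ {A : Set} {l r : List A} {a} → Pick l a r → length l ≡ suc (length r)
Pick-length here      = refl
Pick-length (there p) = cong suc (Pick-length p)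

-- The polynomial inequality

module Polynomial where

  open import Data.Nat as ℕ using (zero; suc; z≤n; s≤s; _!)
  import Data.Nat.Properties as ℕ
  open import Data.Integer hiding (suc)
  open import Data.Integer.Properties
  open import Data.Integer.Tactic.RingSolver using (solve-∀)

  -- Sums over the positions of a list

  ∑ : {A : Set} → List A → (A → ℤ) → ℤ
  ∑ []      f = 0ℤ
  ∑ (a ∷ l) f = f a + ∑ l f

  -- The summand also receives the list without the current position, since the sums to be bounded
  -- contain elementary symmetric polynomials of the other letters.
  ∑ᵖ : {A : Set} → List A → (A → List A → ℤ) → ℤ
  ∑ᵖ []      f = 0ℤ
  ∑ᵖ (a ∷ l) f = f a l + ∑ᵖ l (λ c r → f c (a ∷ r))

  ∑ᵖᵖ : {A : Set} → List A → (A → A → List A → ℤ) → ℤ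
  ∑ᵖᵖ l f = ∑ᵖ l (λ a r → ∑ᵖ r (f a))

  private
    +-congʳ : ∀ i {j k} → j ≡ k → i + j ≡ i + k
    +-congʳ i = cong (λ j → i + j)

    interchange : ∀ a b c d → (a + b) + (c + d) ≡ (a + c) + (b + d)
    interchange = solve-∀

  module _ {A : Set} where

    ∑ᵖ-cong : ∀ (l : List A) {f g} → (∀ {a r} → Pick l a r → f a r ≡ g a r) → ∑ᵖ l f ≡ ∑ᵖ l g
    ∑ᵖ-cong []      h = refl
    ∑ᵖ-cong (a ∷ l) h = cong₂ _+_ (h here) (∑ᵖ-cong l (λ p → h (there p)))

    ∑ᵖ-mono : ∀ (l : List A) {f g} → (∀ {a r} → Pick l a r → f a r ≤ g a r) → ∑ᵖ l f ≤ ∑ᵖ l g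
    ∑ᵖ-mono []      h = ≤-refl
    ∑ᵖ-mono (a ∷ l) h = +-mono-≤ (h here) (∑ᵖ-mono l (λ p → h (there p)))

    ∑ᵖ-0 : ∀ (l : List A) → ∑ᵖ l (λ _ _ → 0ℤ) ≡ 0ℤ
    ∑ᵖ-0 []      = refl
    ∑ᵖ-0 (a ∷ l) = trans (+-identityˡ _) (∑ᵖ-0 l)

    ∑ᵖ-+ : ∀ (l : List A) f g → ∑ᵖ l (λ a r → f a r + g a r) ≡ ∑ᵖ l f + ∑ᵖ l g
    ∑ᵖ-+ []      f g = refl
    ∑ᵖ-+ (a ∷ l) f g = trans (+-congʳ (f a l + g a l) (∑ᵖ-+ l f′ g′)) (interchange (f a l) (g a l) (∑ᵖ l f′) (∑ᵖ l g′))
      where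
      f′ = λ c r → f c (a ∷ r)
      g′ = λ c r → g c (a ∷ r)

    ∑ᵖ-* : ∀ (l : List A) c f → ∑ᵖ l (λ a r → c * f a r) ≡ c * ∑ᵖ l f
    ∑ᵖ-* []      c f = sym (*-zeroʳ c)
    ∑ᵖ-* (a ∷ l) c f = trans (+-congʳ (c * f a l) (∑ᵖ-* l c f′)) (sym (*-distribˡ-+ c (f a l) (∑ᵖ l f′)))
      where
      f′ = λ d r → f d (a ∷ r)

    ∑ᵖ-const : ∀ (l : List A) c → ∑ᵖ l (λ _ _ → c) ≡ + length l * c
    ∑ᵖ-const []      c = refl
    ∑ᵖ-const (a ∷ l) c = trans (+-congʳ c (∑ᵖ-const l c)) (sym (suc-* (+ length l) c))

    ∑ᵖ-∑ : ∀ (l : List A) f → ∑ᵖ l (λ a _ → f a) ≡ ∑ l f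
    ∑ᵖ-∑ []      f = refl
    ∑ᵖ-∑ (a ∷ l) f = +-congʳ (f a) (∑ᵖ-∑ l f)

    -- Remainders keep the order of `l`, so striking out two positions in either order leaves
    -- literally the same list.
    ∑ᵖᵖ-swap : ∀ (l : List A) f → ∑ᵖᵖ l f ≡ ∑ᵖᵖ l (λ a c → f c a)
    ∑ᵖᵖ-swap []      f = refl
    ∑ᵖᵖ-swap (a ∷ l) f = begin
      ∑ᵖ l (f a) + ∑ᵖ l (λ c r → f c a r + ∑ᵖ r (λ d q → f c d (a ∷ q)))
        ≡⟨ +-congʳ (∑ᵖ l (f a)) (∑ᵖ-+ l _ _) ⟩
      ∑ᵖ l (f a) + (∑ᵖ l (λ c r → f c a r) + ∑ᵖᵖ l (λ c d q → f c d (a ∷ q)))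
        ≡⟨ cong (λ z → ∑ᵖ l (f a) + (∑ᵖ l (λ c r → f c a r) + z)) (∑ᵖᵖ-swap l _) ⟩
      ∑ᵖ l (f a) + (∑ᵖ l (λ c r → f c a r) + ∑ᵖᵖ l (λ c d q → f d c (a ∷ q)))
        ≡⟨ flip+ (∑ᵖ l (f a)) (∑ᵖ l (λ c r → f c a r)) (∑ᵖᵖ l (λ c d q → f d c (a ∷ q))) ⟩
      ∑ᵖ l (λ c r → f c a r) + (∑ᵖ l (f a) + ∑ᵖᵖ l (λ c d q → f d c (a ∷ q)))
        ≡⟨ +-congʳ (∑ᵖ l (λ c r → f c a r)) (∑ᵖ-+ l _ _) ⟨
      ∑ᵖ l (λ c r → f c a r) + ∑ᵖ l (λ c r → f a c r + ∑ᵖ r (λ d q → f d c (a ∷ q))) ∎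
      where
      open ≡-Reasoning
      flip+ : ∀ u v w → u + (v + w) ≡ v + (u + w)
      flip+ = solve-∀

    ∑ᵖᵖ-cong : ∀ (l : List A) {f g} →
      (∀ {a c r q} → Pick l a r → Pick r c q → f a c q ≡ g a c q) → ∑ᵖᵖ l f ≡ ∑ᵖᵖ l g
    ∑ᵖᵖ-cong l h = ∑ᵖ-cong l (λ p → ∑ᵖ-cong _ (h p))

    ∑ᵖᵖ-mono : ∀ (l : List A) {f g} →
      (∀ {a c r q} → Pick l a r → Pick r c q → f a c q ≤ g a c q) → ∑ᵖᵖ l f ≤ ∑ᵖᵖ l g
    ∑ᵖᵖ-mono l h = ∑ᵖ-mono l (λ p → ∑ᵖ-mono _ (h p))

    ∑ᵖᵖ-0 : ∀ (l : List A) → ∑ᵖᵖ l (λ _ _ _ → 0ℤ) ≡ 0ℤ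
    ∑ᵖᵖ-0 l = trans (∑ᵖ-cong l (λ {_} {r} _ → ∑ᵖ-0 r)) (∑ᵖ-0 l)

    ∑ᵖᵖ-+ : ∀ (l : List A) f g → ∑ᵖᵖ l (λ a c r → f a c r + g a c r) ≡ ∑ᵖᵖ l f + ∑ᵖᵖ l g
    ∑ᵖᵖ-+ l f g = trans (∑ᵖ-cong l (λ {a} {r} _ → ∑ᵖ-+ r (f a) (g a))) (∑ᵖ-+ l _ _)

    ∑ᵖᵖ-* : ∀ (l : List A) c f → ∑ᵖᵖ l (λ a d r → c * f a d r) ≡ c * ∑ᵖᵖ l f
    ∑ᵖᵖ-* l c f = trans (∑ᵖ-cong l (λ {a} {r} _ → ∑ᵖ-* r c (f a))) (∑ᵖ-* l c _)

  -- powfact b m = bᵐ m!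
  powfact : ℤ → ℕ → ℤ
  powfact b zero    = 1ℤ
  powfact b (suc m) = b * + suc m * powfact b m

  fall : ℤ → ℕ → ℤ
  fall b zero    = 1ℤ
  fall b (suc m) = (b - + m) * fall b m

  -- Elementary symmetric polynomials and their deficit from the uniform value

  module Elementary {A : Set} (x : A → ℤ) where

    e : ℕ → List A → ℤ
    e zero    l       = 1ℤ
    e (suc m) []      = 0ℤ
    e (suc m) (a ∷ l) = x a * e m l + e (suc m) l

    e-pick : ∀ m {l a r} → Pick l a r → e (suc m) l ≡ x a * e m r + e (suc m) r
    e-pick m       here                    = refl
    e-pick zero    (there {a} {c} {l} {r} p) rewrite e-pick zero p = lem (x c) (x a) (e 1 r)
      where
      lem : ∀ c a e → c * 1ℤ + (a * 1ℤ + e) ≡ a * 1ℤ + (c * 1ℤ + e)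
      lem = solve-∀
    e-pick (suc m) (there {a} {c} {l} {r} p) rewrite e-pick (suc m) p | e-pick m p =
      lem (x c) (x a) (e m r) (e (suc m) r) (e (suc (suc m)) r)
      where
      lem : ∀ c a e₀ e₁ e₂ → c * (a * e₀ + e₁) + (a * e₁ + e₂) ≡ a * (c * e₀ + e₁) + (c * e₁ + e₂)
      lem = solve-∀

    -- Every set of `m` positions avoids `length l - m` positions. If `m` exceeds the length, the
    -- difference is negative, but `e m l` vanishes.
    ∑ᵖ-e : ∀ m l → ∑ᵖ l (λ _ r → e m r) ≡ (+ length l - + m) * e m l
    ∑ᵖ-e zero    l       = trans (∑ᵖ-const l 1ℤ) (cong (_* 1ℤ) (sym (+-identityʳ (+ length l))))
    ∑ᵖ-e (suc m) []      = sym (*-zeroʳ (0ℤ - + suc m))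
    ∑ᵖ-e (suc m) (a ∷ l) = begin
      e (suc m) l + ∑ᵖ l (λ _ r → x a * e m r + e (suc m) r)
        ≡⟨ +-congʳ (e (suc m) l) (trans (∑ᵖ-+ l _ _)
             (cong₂ _+_ (trans (∑ᵖ-* l (x a) _) (cong (x a *_) (∑ᵖ-e m l))) (∑ᵖ-e (suc m) l))) ⟩
      e (suc m) l + (x a * ((+ length l - + m) * e m l) + (+ length l - + suc m) * e (suc m) l)
        ≡⟨ lem (+ length l) (+ m) (x a) (e m l) (e (suc m) l) ⟩
      (+ suc (length l) - + suc m) * (x a * e m l + e (suc m) l) ∎
      where
      open ≡-Reasoning
      lem : ∀ L M c e₀ e₁ → e₁ + (c * ((L - M) * e₀) + (L - (1ℤ + M)) * e₁) ≡ ((1ℤ + L) - (1ℤ + M)) * (c * e₀ + e₁)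
      lem = solve-∀

    module _ (y : A → ℤ) where

      ∑ᵖ-y*x*e : ∀ m l → ∑ᵖ l (λ a r → y a * (x a * e m r)) ≡ e (suc m) l * ∑ l y - ∑ᵖ l (λ a r → y a * e (suc m) r)
      ∑ᵖ-y*x*e m l = begin
        ∑ᵖ l (λ a r → y a * (x a * e m r))
          ≡⟨ ∑ᵖ-cong l (λ {a} {r} p → trans (lem (y a) (x a * e m r) (e (suc m) r))
               (cong (λ z → z * y a + -1ℤ * (y a * e (suc m) r)) (sym (e-pick m p)))) ⟩
        ∑ᵖ l (λ a r → e (suc m) l * y a + -1ℤ * (y a * e (suc m) r))
          ≡⟨ trans (∑ᵖ-+ l _ _) (cong₂ _+_ (trans (∑ᵖ-* l (e (suc m) l) (λ a _ → y a)) (cong (e (suc m) l *_) (∑ᵖ-∑ l y))) (∑ᵖ-* l -1ℤ _)) ⟩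
        e (suc m) l * ∑ l y + -1ℤ * ∑ᵖ l (λ a r → y a * e (suc m) r)
          ≡⟨ +-congʳ (e (suc m) l * ∑ l y) (-1*i≡-i _) ⟩
        e (suc m) l * ∑ l y - ∑ᵖ l (λ a r → y a * e (suc m) r) ∎
        where
        open ≡-Reasoning
        lem : ∀ y u v → y * u ≡ (u + v) * y + -1ℤ * (y * v)
        lem = solve-∀

    ∑ᵖ-x*e : ∀ m l → ∑ᵖ l (λ a r → x a * e m r) ≡ + suc m * e (suc m) l
    ∑ᵖ-x*e m l = begin
      ∑ᵖ l (λ a r → x a * e m r)
        ≡⟨ ∑ᵖ-cong l (λ {a} {r} p → trans (lem (x a * e m r) (e (suc m) r))
             (cong (λ z → z + -1ℤ * e (suc m) r) (sym (e-pick m p)))) ⟩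
      ∑ᵖ l (λ a r → e (suc m) l + -1ℤ * e (suc m) r)
        ≡⟨ trans (∑ᵖ-+ l _ _) (cong₂ _+_ (∑ᵖ-const l _) (trans (∑ᵖ-* l -1ℤ _) (cong (-1ℤ *_) (∑ᵖ-e (suc m) l)))) ⟩
      + length l * e (suc m) l + -1ℤ * ((+ length l - + suc m) * e (suc m) l)
        ≡⟨ lem₂ (+ length l) (+ suc m) (e (suc m) l) ⟩
      + suc m * e (suc m) l ∎
      where
      open ≡-Reasoning
      lem : ∀ u v → u ≡ (u + v) + -1ℤ * v
      lem = solve-∀
      lem₂ : ∀ L M E → L * E + -1ℤ * ((L - M) * E) ≡ M * E
      lem₂ = solve-∀

    module _ (y : A → ℤ) where

      -- For `m = 0` this is the usual expression of a covariance as a sum over pairs. In general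
      -- the terms with `x a` are collected by `∑ᵖ-e` and those with `x c` by `∑ᵖ-x*e`. The case
      -- `y = x` is the exact gap in the weak Maclaurin inequality.
      covariance : ∀ m l →
        ∑ᵖᵖ l (λ a c r → (y a - y c) * (x a - x c) * e m r) ≡
        + 2 * ((+ length l - + suc m) * (∑ l y * e (suc m) l) - + length l * ∑ᵖ l (λ a r → y a * e (suc m) r))
      covariance m l = begin
        ∑ᵖᵖ l (λ a c r → (y a - y c) * (x a - x c) * e m r)
          ≡⟨ ∑ᵖᵖ-cong l (λ {a} {c} {_} {q} _ _ → expand (y a) (y c) (x a) (x c) (e m q)) ⟩
        ∑ᵖᵖ l (λ a c r → F a c r + F c a r)
          ≡⟨ ∑ᵖᵖ-+ l F (λ a c → F c a) ⟩
        ∑ᵖᵖ l F + ∑ᵖᵖ l (λ a c → F c a)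
          ≡⟨ +-congʳ (∑ᵖᵖ l F) (sym (∑ᵖᵖ-swap l F)) ⟩
        ∑ᵖᵖ l F + ∑ᵖᵖ l F
          ≡⟨ cong (λ z → z + z) F-sum ⟩
        (n-1-m * G + - + suc m * H) + (n-1-m * G + - + suc m * H)
          ≡⟨ cong (λ z → (n-1-m * z + - + suc m * H) + (n-1-m * z + - + suc m * H)) (∑ᵖ-y*x*e y m l) ⟩
        (n-1-m * (e (suc m) l * ∑ l y - H) + - + suc m * H) + (n-1-m * (e (suc m) l * ∑ l y - H) + - + suc m * H)
          ≡⟨ final (+ length l) (+ suc m) (e (suc m) l) (∑ l y) H ⟩
        + 2 * (n-1-m * (∑ l y * e (suc m) l) - + length l * H) ∎
        where
        open ≡-Reasoning
        n-1-m = + length l - + suc m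
        F : A → A → List A → ℤ
        -- Half of the expanded product; the other half is its mirror image `F c a`, which has the
        -- same sum over ordered pairs.
        F a c r = y a * (x a * e m r) + -1ℤ * (y a * (x c * e m r))
        G = ∑ᵖ l (λ a r → y a * (x a * e m r))
        H = ∑ᵖ l (λ a r → y a * e (suc m) r)
        expand : ∀ y y′ x x′ e → (y - y′) * (x - x′) * e ≡
          (y * (x * e) + -1ℤ * (y * (x′ * e))) + (y′ * (x′ * e) + -1ℤ * (y′ * (x * e)))
        expand = solve-∀
        final : ∀ L M E Y H → ((L - M) * (E * Y - H) + - M * H) + ((L - M) * (E * Y - H) + - M * H)
          ≡ + 2 * ((L - M) * (Y * E) - L * H)
        final = solve-∀
        inner : ∀ {a r} → Pick l a r → ∑ᵖ r (F a) ≡ n-1-m * (y a * (x a * e m r)) + - + suc m * (y a * e (suc m) r)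
        inner {a} {r} p = begin
          ∑ᵖ r (F a)
            ≡⟨ ∑ᵖ-cong r (λ {c} {q} _ → regroup (y a) (x a) (e m q) (x c * e m q)) ⟩
          ∑ᵖ r (λ c q → (y a * x a) * e m q + (-1ℤ * y a) * (x c * e m q))
            ≡⟨ ∑ᵖ-+ r _ _ ⟩
          ∑ᵖ r (λ c q → (y a * x a) * e m q) + ∑ᵖ r (λ c q → (-1ℤ * y a) * (x c * e m q))
            ≡⟨ cong₂ _+_ (trans (∑ᵖ-* r (y a * x a) (λ _ q → e m q)) (cong (y a * x a *_) (∑ᵖ-e m r)))
                         (trans (∑ᵖ-* r (-1ℤ * y a) (λ c q → x c * e m q)) (cong (-1ℤ * y a *_) (∑ᵖ-x*e m r))) ⟩
          (y a * x a) * ((+ length r - + m) * e m r) + (-1ℤ * y a) * (+ suc m * e (suc m) r)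
            ≡⟨ tidy (+ length r) (+ m) (y a) (x a) (e m r) (e (suc m) r) ⟩
          (+ suc (length r) - + suc m) * (y a * (x a * e m r)) + - + suc m * (y a * e (suc m) r)
            ≡⟨ cong (λ z → (+ z - + suc m) * (y a * (x a * e m r)) + - + suc m * (y a * e (suc m) r)) (sym (Pick-length p)) ⟩
          n-1-m * (y a * (x a * e m r)) + - + suc m * (y a * e (suc m) r) ∎
          where
          regroup : ∀ y x e f → y * (x * e) + -1ℤ * (y * f) ≡ (y * x) * e + (-1ℤ * y) * f
          regroup = solve-∀
          tidy : ∀ L M y x e f → (y * x) * ((L - M) * e) + (-1ℤ * y) * ((1ℤ + M) * f) ≡
            ((1ℤ + L) - (1ℤ + M)) * (y * (x * e)) + - (1ℤ + M) * (y * f)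
          tidy = solve-∀
        F-sum : ∑ᵖᵖ l F ≡ n-1-m * G + - + suc m * H
        F-sum = trans (∑ᵖ-cong l inner) (trans
          (∑ᵖ-+ l (λ a r → n-1-m * (y a * (x a * e m r))) (λ a r → - + suc m * (y a * e (suc m) r)))
          (cong₂ _+_ (∑ᵖ-* l n-1-m (λ a r → y a * (x a * e m r))) (∑ᵖ-* l (- + suc m) (λ a r → y a * e (suc m) r))))

    e₁≡∑ : ∀ l → e 1 l ≡ ∑ l x
    e₁≡∑ []      = refl
    e₁≡∑ (a ∷ l) = cong₂ _+_ (*-identityʳ (x a)) (e₁≡∑ l)

    variance : ∀ m l → ∑ᵖᵖ l (λ a c r → (x a - x c) * (x a - x c) * e m r) ≡
      + 2 * ((+ length l - + suc m) * (∑ l x * e (suc m) l) - + length l * (+ suc (suc m) * e (suc (suc m)) l))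
    variance m l = trans (covariance x m l)
      (cong (λ z → + 2 * ((+ length l - + suc m) * (∑ l x * e (suc m) l) - + length l * z)) (∑ᵖ-x*e (suc m) l))

    module _ (b s : ℤ) where

      -- The weight of a pair in `telescope`, read off from its induction: a step multiplies the
      -- previous deficit by `(b - + suc m) * s` and adds the pair sum of `variance`.
      κ : ℕ → List A → ℤ
      κ zero    r = 0ℤ
      κ (suc m) r = (b - + suc m) * s * κ m r + powfact b (suc m) * e m r

    -- If all `x a` are equal, the left side equals the first term on the right, so the pair sum is
    -- the deficit from the uniform value. The induction multiplies by `(b - + suc m) * s` and
    -- trades `s * e (suc m) l` for `e (suc (suc m)) l` by means of `variance`.
    telescope : ∀ m l → + 2 * (fall (+ length l) (suc m) * ∑ l x ^ suc m) ≡
      + 2 * (powfact (+ length l) (suc m) * e (suc m) l) +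
      ∑ᵖᵖ l (λ a c r → (x a - x c) * (x a - x c) * κ (+ length l) (∑ l x) m r)
    telescope zero    l = begin
      + 2 * ((b - 0ℤ) * 1ℤ * (s * 1ℤ))
        ≡⟨ base b s ⟩
      + 2 * (b * 1ℤ * 1ℤ * s) + 0ℤ
        ≡⟨ cong₂ (λ u v → + 2 * (b * 1ℤ * 1ℤ * u) + v) (e₁≡∑ l) zero-sum ⟨
      + 2 * (b * 1ℤ * 1ℤ * e 1 l) + ∑ᵖᵖ l (λ a c r → (x a - x c) * (x a - x c) * 0ℤ) ∎
      where
      open ≡-Reasoning
      b = + length l
      s = ∑ l x
      base : ∀ b s → + 2 * ((b - 0ℤ) * 1ℤ * (s * 1ℤ)) ≡ + 2 * (b * 1ℤ * 1ℤ * s) + 0ℤ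
      base = solve-∀
      zero-sum : ∑ᵖᵖ l (λ a c r → (x a - x c) * (x a - x c) * 0ℤ) ≡ 0ℤ
      zero-sum = trans (∑ᵖᵖ-cong l (λ {a} {c} _ _ → *-zeroʳ ((x a - x c) * (x a - x c)))) (∑ᵖᵖ-0 l)
    telescope (suc m) l = begin
      + 2 * (d * f * (s * s^))
        ≡⟨ pull d f s s^ ⟩
      d * s * (+ 2 * (f * s^))
        ≡⟨ cong (d * s *_) (telescope m l) ⟩
      d * s * (+ 2 * (β * e₁) + K)
        ≡⟨ rearrange d s β e₁ K b (+ suc (suc m)) e₂ ⟩
      + 2 * (b * + suc (suc m) * β * e₂) + (d * s * K + β * (+ 2 * (d * (s * e₁) - b * (+ suc (suc m) * e₂))))
        ≡⟨ cong (λ z → + 2 * (b * + suc (suc m) * β * e₂) + (d * s * K + β * z)) (variance m l) ⟨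
      + 2 * (b * + suc (suc m) * β * e₂) + (d * s * K + β * ∑ᵖᵖ l (λ a c r → (x a - x c) * (x a - x c) * e m r))
        ≡⟨ +-congʳ (+ 2 * (b * + suc (suc m) * β * e₂)) sum-κ ⟨
      + 2 * (b * + suc (suc m) * β * e₂) + ∑ᵖᵖ l (λ a c r → (x a - x c) * (x a - x c) * κ b s (suc m) r) ∎
      where
      open ≡-Reasoning
      b = + length l
      s = ∑ l x
      d = b - + suc m
      f = fall b (suc m)
      s^ = s ^ suc m
      β = powfact b (suc m)
      e₁ = e (suc m) l
      e₂ = e (suc (suc m)) l
      K = ∑ᵖᵖ l (λ a c r → (x a - x c) * (x a - x c) * κ b s m r)
      pull : ∀ d f s t → + 2 * (d * f * (s * t)) ≡ d * s * (+ 2 * (f * t))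
      pull = solve-∀
      rearrange : ∀ d s β e₁ K b m e₂ → d * s * (+ 2 * (β * e₁) + K) ≡
        + 2 * (b * m * β * e₂) + (d * s * K + β * (+ 2 * (d * (s * e₁) - b * (m * e₂))))
      rearrange = solve-∀
      split : ∀ D u v k ε → D * (u * k + v * ε) ≡ u * (D * k) + v * (D * ε)
      split = solve-∀
      sum-κ : ∑ᵖᵖ l (λ a c r → (x a - x c) * (x a - x c) * κ b s (suc m) r) ≡
        d * s * K + β * ∑ᵖᵖ l (λ a c r → (x a - x c) * (x a - x c) * e m r)
      sum-κ = trans
        (∑ᵖᵖ-cong l (λ {a} {c} {_} {q} _ _ → split ((x a - x c) * (x a - x c)) (d * s) β (κ b s m q) (e m q)))
        (trans
          (∑ᵖᵖ-+ l (λ a c r → d * s * ((x a - x c) * (x a - x c) * κ b s m r))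
                   (λ a c r → β * ((x a - x c) * (x a - x c) * e m r)))
          (cong₂ _+_ (∑ᵖᵖ-* l (d * s) (λ a c r → (x a - x c) * (x a - x c) * κ b s m r))
                     (∑ᵖᵖ-* l β (λ a c r → (x a - x c) * (x a - x c) * e m r))))

  -- Weak Maclaurin inequalities and the bound for one pair of letters

  0≤* : ∀ {i j} → 0ℤ ≤ i → 0ℤ ≤ j → 0ℤ ≤ i * j
  0≤* {+ m} {+ n} _ _ = subst (0ℤ ≤_) (pos-* m n) (+≤+ z≤n)

  0≤+ : ∀ {i j} → 0ℤ ≤ i → 0ℤ ≤ j → 0ℤ ≤ i + j
  0≤+ = +-mono-≤

  0≤i*i : ∀ i → 0ℤ ≤ i * i
  0≤i*i (+ n)    = 0≤* {+ n} {+ n} (+≤+ z≤n) (+≤+ z≤n)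
  0≤i*i -[1+ n ] = +≤+ z≤n

  *-monoʳ-≤ : ∀ {k} → 0ℤ ≤ k → ∀ {i j} → i ≤ j → k * i ≤ k * j
  *-monoʳ-≤ {+ n} _ = *-monoˡ-≤-nonNeg (+ n)

  *-cancelʳ-≤ : ∀ {k} → 0ℤ < k → ∀ {i j} → k * i ≤ k * j → i ≤ j
  *-cancelʳ-≤ {+[1+ n ]} _ {i} {j} = *-cancelˡ-≤-pos i j +[1+ n ]
  *-cancelʳ-≤ {+0} (+<+ ())

  0<* : ∀ {i j} → 0ℤ < i → 0ℤ < j → 0ℤ < i * j
  0<* {+[1+ m ]} {+[1+ n ]} _ _ = +<+ (s≤s z≤n)
  0<* {+0} (+<+ ())
  0<* {+[1+ m ]} {+0} _ (+<+ ())

  ≤-by : ∀ {i j d} → 0ℤ ≤ d → j ≡ i + d → i ≤ j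
  ≤-by {i} {j} {d} 0≤d eq = subst₂ _≤_ (+-identityʳ i) (sym eq) (+-monoʳ-≤ i 0≤d)

  0≤-from : ∀ {m n} → m ℕ.≤ n → 0ℤ ≤ + n - + m
  0≤-from m≤n = i≤j⇒0≤j-i (+≤+ m≤n)

  0≤powfact : ∀ n m → 0ℤ ≤ powfact (+ n) m
  0≤powfact n zero    = +≤+ z≤n
  0≤powfact n (suc m) = 0≤* (0≤* {+ n} {+ suc m} (+≤+ z≤n) (+≤+ z≤n)) (0≤powfact n m)

  0≤fall : ∀ n m → m ℕ.≤ suc n → 0ℤ ≤ fall (+ n) m
  0≤fall n zero    _         = +≤+ z≤n
  0≤fall n (suc m) (s≤s m≤n) = 0≤* (0≤-from m≤n) (0≤fall n m (ℕ.m≤n⇒m≤1+n m≤n))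

  0<fall : ∀ n m → m ℕ.≤ n → 0ℤ < fall (+ n) m
  0<fall n zero    _   = +<+ (s≤s z≤n)
  0<fall n (suc m) m<n = 0<* (i<j⇒0<j-i m<n) (0<fall n m (ℕ.<⇒≤ m<n))
    where
    i<j⇒0<j-i : ∀ {m n} → m ℕ.< n → 0ℤ < + n - + m
    i<j⇒0<j-i {m} {n} m<n = subst (_< + n - + m) (+-inverseʳ (+ m)) (+-monoˡ-< (- + m) (+<+ m<n))

  0≤^ : ∀ {s} → 0ℤ ≤ s → ∀ m → 0ℤ ≤ s ^ m
  0≤^ 0≤s zero    = +≤+ z≤n
  0≤^ 0≤s (suc m) = 0≤* 0≤s (0≤^ 0≤s m)

  0<^ : ∀ {s} → 0ℤ < s → ∀ m → 0ℤ < s ^ m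
  0<^ 0<s zero    = +<+ (s≤s z≤n)
  0<^ 0<s (suc m) = 0<* 0<s (0<^ 0<s m)

  -- The coefficient of `e j r` in `κ-bound`, where `a = b - 2` letters are left beside a pair. The
  -- weak Maclaurin inequality turns `(a - j) s eⱼ` into at least `a (j + 1) eⱼ₊₁`, whence the
  -- factor `+ suc j * a`; the other summand is the new term of `κ`.
  rho : ℤ → ℕ → ℤ
  rho a zero    = 0ℤ
  rho a (suc j) = rho a j * (+ suc j * a) + powfact (+ 2 + a) (suc (suc j))

  0≤rho : ∀ n j → 0ℤ ≤ rho (+ n) j
  0≤rho n zero    = +≤+ z≤n
  0≤rho n (suc j) = 0≤+ (0≤* (0≤rho n j) (0≤* {+ suc j} {+ n} (+≤+ z≤n) (+≤+ z≤n))) (0≤powfact (2 ℕ.+ n) (suc (suc j)))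

  -- `b * delta b u` is `powfact b (suc u)`; for `u = t - 1` this is the coefficient of `eₜ` in
  -- `telescope`.
  delta : ℤ → ℕ → ℤ
  delta b u = + suc u * powfact b u

  -- The bound pair-bound is convex in e (suc j) r and an equality at 0, so it has to be checked only at the largest
  -- value of e (suc j) r, where it becomes this condition.
  Balanced : (n j : ℕ) → Set
  Balanced n j = b * (δ * δ) ≤ + 4 * powfact (+ n) (suc j) * (+ 2 * b * δ + + 4 * rho (+ n) j * (+ suc j * + n))
    where
    b = + 2 + + n
    δ = delta b (suc j)

  module ElementaryNonNeg {A : Set} (x : A → ℤ) (0≤x : ∀ a → 0ℤ ≤ x a) where

    open Elementary x

    0≤e : ∀ m l → 0ℤ ≤ e m l
    0≤e zero    l       = +≤+ z≤n
    0≤e (suc m) []      = +≤+ z≤n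
    0≤e (suc m) (a ∷ l) = 0≤+ (0≤* (0≤x a) (0≤e m l)) (0≤e (suc m) l)

    -- Beyond `m = 0`, where equality holds, the gap is half the pair sum in `variance`, whose terms
    -- are squares times nonnegative factors.
    maclaurin : ∀ m l → + length l * (+ suc m * e (suc m) l) ≤ (+ length l - + m) * (∑ l x * e m l)
    maclaurin zero    l = ≤-reflexive (trans (cong (λ z → + length l * (1ℤ * z)) (e₁≡∑ l)) (lem (+ length l) (∑ l x)))
      where
      lem : ∀ a s → a * (1ℤ * s) ≡ (a - 0ℤ) * (s * 1ℤ)
      lem = solve-∀
    maclaurin (suc m) l = 0≤i-j⇒j≤i (*-cancelʳ-≤ {+ 2} (+<+ (s≤s z≤n))
      (subst (0ℤ ≤_) (variance m l)
        (subst (_≤ ∑ᵖᵖ l (λ a c r → (x a - x c) * (x a - x c) * e m r)) (∑ᵖᵖ-0 l)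
          (∑ᵖᵖ-mono l (λ {a} {c} {_} {q} _ _ → 0≤* (0≤i*i (x a - x c)) (0≤e m q))))))

    module _ {s : ℤ} (r : List A) (∑r≤s : ∑ r x ≤ s) where

      private
        n = length r
        a = + n
        b = + 2 + a
        0≤s : 0ℤ ≤ s
        0≤s = ≤-trans (subst (0ℤ ≤_) (e₁≡∑ r) (0≤e 1 r)) ∑r≤s

      -- The list `r` lacks a pair of letters; replacing its sum by the full total `s` gives
      -- estimates with coefficients common to all pairs.
      maclaurin′ : ∀ j → j ℕ.≤ n → a * (+ suc j * e (suc j) r) ≤ (a - + j) * (s * e j r)
      maclaurin′ j j≤n = ≤-trans (maclaurin j r) (*-monoʳ-≤ (0≤-from j≤n)
        (subst₂ _≤_ (*-comm (e j r) (∑ r x)) (*-comm (e j r) s) (*-monoʳ-≤ (0≤e j r) ∑r≤s)))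

      e-bound : ∀ u → u ℕ.≤ suc n → powfact a u * e u r ≤ fall a u * s ^ u
      e-bound zero    _         = ≤-refl
      e-bound (suc u) (s≤s u≤n) = begin
        a * + suc u * powfact a u * e (suc u) r        ≡⟨ pull a (+ suc u) (powfact a u) (e (suc u) r) ⟩
        powfact a u * (a * (+ suc u * e (suc u) r))    ≤⟨ *-monoʳ-≤ (0≤powfact n u) (maclaurin′ u u≤n) ⟩
        powfact a u * ((a - + u) * (s * e u r))        ≡⟨ push (powfact a u) (a - + u) s (e u r) ⟩
        (a - + u) * s * (powfact a u * e u r)          ≤⟨ *-monoʳ-≤ (0≤* (0≤-from u≤n) 0≤s) (e-bound u (ℕ.m≤n⇒m≤1+n u≤n)) ⟩
        (a - + u) * s * (fall a u * s ^ u)           ≡⟨ mid (a - + u) s (fall a u) (s ^ u) ⟩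
        (a - + u) * fall a u * (s * s ^ u)           ∎
        where
        open ≤-Reasoning
        pull : ∀ a u β e → a * u * β * e ≡ β * (a * (u * e))
        pull = solve-∀
        push : ∀ β d s e → β * (d * (s * e)) ≡ d * s * (β * e)
        push = solve-∀
        mid : ∀ d s f t → d * s * (f * t) ≡ d * f * (s * t)
        mid = solve-∀

      κ-bound : ∀ j → j ℕ.≤ n → b * (fall a j * s ^ j) + rho a j * e j r ≤ κ b s (suc j) r
      κ-bound zero    _   = ≤-reflexive (base b s)
        where
        base : ∀ b s → b * 1ℤ + 0ℤ * 1ℤ ≡ (b - 1ℤ) * s * 0ℤ + b * 1ℤ * 1ℤ * 1ℤ
        base = solve-∀
      κ-bound (suc j) j<n = begin
        b * ((a - + j) * fall a j * (s * s ^ j)) + (rho a j * (+ suc j * a) + β) * e (suc j) r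
          ≡⟨ expand b (a - + j) (fall a j) s (s ^ j) (rho a j) (+ suc j) a β (e (suc j) r) ⟩
        (a - + j) * s * (b * (fall a j * s ^ j)) + rho a j * (a * (+ suc j * e (suc j) r)) + β * e (suc j) r
          ≤⟨ +-monoˡ-≤ (β * e (suc j) r) (+-monoʳ-≤ ((a - + j) * s * (b * (fall a j * s ^ j)))
               (*-monoʳ-≤ (0≤rho n j) (maclaurin′ j (ℕ.<⇒≤ j<n)))) ⟩
        (a - + j) * s * (b * (fall a j * s ^ j)) + rho a j * ((a - + j) * (s * e j r)) + β * e (suc j) r
          ≡⟨ collect (a - + j) s (b * (fall a j * s ^ j)) (rho a j) (e j r) (β * e (suc j) r) ⟩
        (a - + j) * s * (b * (fall a j * s ^ j) + rho a j * e j r) + β * e (suc j) r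
          ≤⟨ +-monoˡ-≤ (β * e (suc j) r) (*-monoʳ-≤ (0≤* (0≤-from (ℕ.<⇒≤ j<n)) 0≤s) (κ-bound j (ℕ.<⇒≤ j<n))) ⟩
        (a - + j) * s * κ b s (suc j) r + β * e (suc j) r
          ≡⟨ cong (λ z → z * s * κ b s (suc j) r + β * e (suc j) r) (cancel₂ a (+ j)) ⟩
        (b - + suc (suc j)) * s * κ b s (suc j) r + β * e (suc j) r ∎
        where
        open ≤-Reasoning
        β = powfact b (suc (suc j))
        expand : ∀ b d f s t ρ j a β e → b * (d * f * (s * t)) + (ρ * (j * a) + β) * e ≡
          d * s * (b * (f * t)) + ρ * (a * (j * e)) + β * e
        expand = solve-∀
        collect : ∀ d s F ρ e z → d * s * F + ρ * (d * (s * e)) + z ≡ d * s * (F + ρ * e) + z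
        collect = solve-∀
        cancel₂ : ∀ a j → a - j ≡ (+ 2 + a) - (+ 2 + j)
        cancel₂ = solve-∀

      -- The discriminant condition for `complete-square`. If `e (suc j) r` vanishes and `κ` is
      -- replaced by the first term of `κ-bound`, the two sides agree exactly for this value of `C`.
      pair-bound : ∀ j → j ℕ.≤ n → Balanced n j →
        let C = + 4 * (fall a (suc j) * s ^ suc j)
            D = C - delta b (suc j) * e (suc j) r
        in b * (D * D) ≤ + 4 * C * (s * (b - + suc (suc j)) * κ b s (suc j) r)
      pair-bound j j≤n bal = begin
        b * ((C - δ * ε) * (C - δ * ε))
          ≡⟨ square b C δ ε ⟩
        b * (C * C) + - + 2 * b * C * δ * ε + ε * (b * (δ * δ) * ε)
          ≤⟨ +-monoʳ-≤ (b * (C * C) + - + 2 * b * C * δ * ε) (*-monoʳ-≤ (0≤e (suc j) r) key) ⟩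
        b * (C * C) + - + 2 * b * C * δ * ε + ε * (G * C)
          ≡⟨ simplify b F δ ε ϱ (+ suc j) a ⟩
        + 4 * C * (b * F + ϱ * (a * (+ suc j * ε)))
          ≤⟨ *-monoʳ-≤ 0≤4C (+-monoʳ-≤ (b * F) (*-monoʳ-≤ (0≤rho n j) (maclaurin′ j j≤n))) ⟩
        + 4 * C * (b * F + ϱ * ((a - + j) * (s * e j r)))
          ≡⟨ cong (+ 4 * C *_) (regroup b a (+ j) (fall a j) s (s ^ j) ϱ (e j r)) ⟩
        + 4 * C * (s * (b - + suc (suc j)) * (b * (fall a j * s ^ j) + ϱ * e j r))
          ≤⟨ *-monoʳ-≤ 0≤4C (*-monoʳ-≤ (0≤* 0≤s (subst (0ℤ ≤_) (cancel₂ a (+ j)) (0≤-from j≤n))) (κ-bound j j≤n)) ⟩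
        + 4 * C * (s * (b - + suc (suc j)) * κ b s (suc j) r) ∎
        where
        open ≤-Reasoning
        F = fall a (suc j) * s ^ suc j
        C = + 4 * F
        δ = delta b (suc j)
        ε = e (suc j) r
        ϱ = rho a j
        -- Through `key`, `G * C` replaces one factor `ε` of the quadratic term by its largest
        -- value. The first summand of `G` cancels the cross term of the square, and the second is
        -- what the `rho` part of `κ-bound` can pay for.
        G = + 2 * b * δ + + 4 * ϱ * (+ suc j * a)
        0≤F : 0ℤ ≤ F
        0≤F = 0≤* (0≤fall n (suc j) (s≤s j≤n)) (0≤^ 0≤s (suc j))
        0≤4C : 0ℤ ≤ + 4 * C
        0≤4C = 0≤* {+ 4} (+≤+ z≤n) (0≤* {+ 4} (+≤+ z≤n) 0≤F)
        0≤G : 0ℤ ≤ G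
        0≤G = 0≤+ (0≤* (0≤* {+ 2} {b} (+≤+ z≤n) (+≤+ z≤n)) (0≤* {+ suc (suc j)} (+≤+ z≤n) (0≤powfact (2 ℕ.+ n) (suc j))))
          (0≤* (0≤* {+ 4} (+≤+ z≤n) (0≤rho n j)) (0≤* {+ suc j} {a} (+≤+ z≤n) (+≤+ z≤n)))
        key : b * (δ * δ) * ε ≤ G * C
        key = begin
          b * (δ * δ) * ε                      ≡⟨ *-comm (b * (δ * δ)) ε ⟩
          ε * (b * (δ * δ))                    ≤⟨ *-monoʳ-≤ (0≤e (suc j) r) bal ⟩
          ε * (+ 4 * powfact a (suc j) * G)      ≡⟨ turn ε (powfact a (suc j)) G ⟩
          G * + 4 * (powfact a (suc j) * ε)      ≤⟨ *-monoʳ-≤ (0≤* 0≤G (+≤+ z≤n)) (e-bound (suc j) (s≤s j≤n)) ⟩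
          G * + 4 * F                          ≡⟨ *-assoc G (+ 4) F ⟩
          G * C                                ∎
          where
          turn : ∀ ε β G → ε * (+ 4 * β * G) ≡ G * + 4 * (β * ε)
          turn = solve-∀
        square : ∀ b C δ ε → b * ((C - δ * ε) * (C - δ * ε)) ≡
          b * (C * C) + - + 2 * b * C * δ * ε + ε * (b * (δ * δ) * ε)
        square = solve-∀
        simplify : ∀ b F δ ε ϱ j a →
          b * (+ 4 * F * (+ 4 * F)) + - + 2 * b * (+ 4 * F) * δ * ε + ε * ((+ 2 * b * δ + + 4 * ϱ * (j * a)) * (+ 4 * F)) ≡
          + 4 * (+ 4 * F) * (b * F + ϱ * (a * (j * ε)))
        simplify = solve-∀
        regroup : ∀ b a j f s t ϱ e → b * ((a - j) * f * (s * t)) + ϱ * ((a - j) * (s * e)) ≡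
          s * ((+ 2 + a) - (+ 2 + j)) * (b * (f * t) + ϱ * e)
        regroup = solve-∀
        cancel₂ : ∀ a j → a - j ≡ (+ 2 + a) - (+ 2 + j)
        cancel₂ = solve-∀

  -- Averaging over a family of letter distributions

  module _ {A : Set} where

    ∑-mono : ∀ (l : List A) {f g} → (∀ {a} → a ∈ l → f a ≤ g a) → ∑ l f ≤ ∑ l g
    ∑-mono []      h = ≤-refl
    ∑-mono (a ∷ l) h = +-mono-≤ (h (here refl)) (∑-mono l (λ a∈l → h (there a∈l)))

    ∑-cong : ∀ (l : List A) {f g} → (∀ {a} → a ∈ l → f a ≡ g a) → ∑ l f ≡ ∑ l g
    ∑-cong []      h = refl
    ∑-cong (a ∷ l) h = cong₂ _+_ (h (here refl)) (∑-cong l (λ a∈l → h (there a∈l)))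

    ∑-const : ∀ (l : List A) c → ∑ l (λ _ → c) ≡ + length l * c
    ∑-const l c = trans (sym (∑ᵖ-∑ l (λ _ → c))) (∑ᵖ-const l c)

    ∑-* : ∀ (l : List A) c f → ∑ l (λ a → c * f a) ≡ c * ∑ l f
    ∑-* l c f = trans (sym (∑ᵖ-∑ l (λ a → c * f a))) (trans (∑ᵖ-* l c (λ a _ → f a)) (cong (c *_) (∑ᵖ-∑ l f)))

    ∑-+ : ∀ (l : List A) f g → ∑ l (λ a → f a + g a) ≡ ∑ l f + ∑ l g
    ∑-+ l f g = trans (sym (∑ᵖ-∑ l (λ a → f a + g a)))
      (trans (∑ᵖ-+ l (λ a _ → f a) (λ a _ → g a)) (cong₂ _+_ (∑ᵖ-∑ l f) (∑ᵖ-∑ l g)))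

    ∑-pick : ∀ {l : List A} {a r} f → Pick l a r → ∑ l f ≡ f a + ∑ r f
    ∑-pick f here = refl
    ∑-pick {a = a} f (there {c = c} {r = r} p) = trans (+-congʳ (f c) (∑-pick f p)) (flip+ (f c) (f a) (∑ r f))
      where
      flip+ : ∀ u v w → u + (v + w) ≡ v + (u + w)
      flip+ = solve-∀

  module _ {A B : Set} where

    ∑-swap : ∀ (k : List B) (l : List A) (f : B → A → ℤ) → ∑ k (λ T → ∑ l (f T)) ≡ ∑ l (λ a → ∑ k (λ T → f T a))
    ∑-swap []      l f = sym (trans (∑-const l 0ℤ) (*-zeroʳ (+ length l)))
    ∑-swap (T ∷ k) l f = trans (+-congʳ (∑ l (f T)) (∑-swap k l f)) (sym (∑-+ l (f T) (λ a → ∑ k (λ U → f U a))))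

    ∑-∑ᵖᵖ : ∀ (k : List B) (l : List A) (f : B → A → A → List A → ℤ) →
      ∑ k (λ T → ∑ᵖᵖ l (f T)) ≡ ∑ᵖᵖ l (λ a c r → ∑ k (λ T → f T a c r))
    ∑-∑ᵖᵖ []      l f = sym (∑ᵖᵖ-0 l)
    ∑-∑ᵖᵖ (T ∷ k) l f = trans (+-congʳ (∑ᵖᵖ l (f T)) (∑-∑ᵖᵖ k l f))
      (sym (∑ᵖᵖ-+ l (f T) (λ a c r → ∑ k (λ U → f U a c r))))

  -- The claim says that a quadratic polynomial in `Y` with leading coefficient `b * C` is
  -- nonnegative, and the last hypothesis that its discriminant is not positive. Multiplying by
  -- `4 * C` completes the square over the integers.
  complete-square : ∀ {b C δ e N W} X Y → 0ℤ ≤ b → 0ℤ < C →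
    b * ((C - δ * e) * (C - δ * e)) ≤ + 4 * C * W →
    b * C * (N * (Y * X) + -1ℤ * (Y * Y)) ≤ N * N * ((X * X) * W) + b * δ * N * (Y * X * e)
  complete-square {b} {C} {δ} {e} {N} {W} X Y 0≤b 0<C bound = *-cancelʳ-≤ (0<* {+ 4} (+<+ (s≤s z≤n)) 0<C) (begin
    + 4 * C * (b * C * (N * (Y * X) + -1ℤ * (Y * Y)))
      ≤⟨ ≤-by (0≤* 0≤b (0≤i*i (+ 2 * C * Y - N * X * (C - δ * e)))) (expand b C δ e N X Y) ⟩
    N * X * (N * X) * (b * ((C - δ * e) * (C - δ * e))) + + 4 * C * (b * δ * N * (Y * X * e))
      ≤⟨ +-monoˡ-≤ (+ 4 * C * (b * δ * N * (Y * X * e))) (*-monoʳ-≤ (0≤i*i (N * X)) bound) ⟩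
    N * X * (N * X) * (+ 4 * C * W) + + 4 * C * (b * δ * N * (Y * X * e))
      ≡⟨ collect b C δ e N X Y W ⟩
    + 4 * C * (N * N * ((X * X) * W) + b * δ * N * (Y * X * e)) ∎)
    where
    open ≤-Reasoning
    expand : ∀ b C δ e N X Y →
      N * X * (N * X) * (b * ((C - δ * e) * (C - δ * e))) + + 4 * C * (b * δ * N * (Y * X * e)) ≡
      + 4 * C * (b * C * (N * (Y * X) + -1ℤ * (Y * Y))) +
      b * ((+ 2 * C * Y - N * X * (C - δ * e)) * (+ 2 * C * Y - N * X * (C - δ * e)))
    expand = solve-∀
    collect : ∀ b C δ e N X Y W →
      N * X * (N * X) * (+ 4 * C * W) + + 4 * C * (b * δ * N * (Y * X * e)) ≡
      + 4 * C * (N * N * ((X * X) * W) + b * δ * N * (Y * X * e))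
    collect = solve-∀

  powfact-factorial : ∀ b t → powfact b t ≡ b ^ t * + (t !)
  powfact-factorial b zero    = refl
  powfact-factorial b (suc t) = begin
    b * + suc t * powfact b t              ≡⟨ cong (b * + suc t *_) (powfact-factorial b t) ⟩
    b * + suc t * (b ^ t * + (t !))      ≡⟨ lem b (+ suc t) (b ^ t) (+ (t !)) ⟩
    b * b ^ t * (+ suc t * + (t !))      ≡⟨ cong (b * b ^ t *_) (pos-* (suc t) (t !)) ⟨
    b * b ^ t * + (suc t ℕ.* t !)        ∎
    where
    open ≡-Reasoning
    lem : ∀ b t u v → b * t * (u * v) ≡ b * u * (t * v)
    lem = solve-∀

  module _ {A : Set} (x y : A → ℤ) where

    open Elementary x

    -- The sum of x a₁ ⋯ x aₜ y aₜ₊₁ over the tuples of distinct positions of l.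
    rainbow : ℕ → List A → ℤ
    rainbow zero    l = ∑ l y
    rainbow (suc t) l = ∑ᵖ l (λ a r → x a * rainbow t r)

    -- `∑ᵖᵖ-swap` brings the position that carries `y` from the end of the tuple to the front; the
    -- other `t` positions then form a set, counted once for each of its orders.
    rainbow-e : ∀ t l → rainbow t l ≡ + (t !) * ∑ᵖ l (λ a r → y a * e t r)
    rainbow-e zero    l = begin
      ∑ l y                                ≡⟨ ∑ᵖ-∑ l y ⟨
      ∑ᵖ l (λ a r → y a)                   ≡⟨ ∑ᵖ-cong l (λ {a} _ → *-identityʳ (y a)) ⟨
      ∑ᵖ l (λ a r → y a * 1ℤ)              ≡⟨ *-identityˡ _ ⟨
      1ℤ * ∑ᵖ l (λ a r → y a * 1ℤ)         ∎
      where open ≡-Reasoning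
    rainbow-e (suc t) l = begin
      ∑ᵖ l (λ a r → x a * rainbow t r)
        ≡⟨ ∑ᵖ-cong l (λ {a} {r} _ → step a r) ⟩
      ∑ᵖ l (λ a r → + (t !) * ∑ᵖ r (λ c q → x a * (y c * e t q)))
        ≡⟨ ∑ᵖ-* l (+ (t !)) (λ a r → ∑ᵖ r (λ c q → x a * (y c * e t q))) ⟩
      + (t !) * ∑ᵖᵖ l (λ a c q → x a * (y c * e t q))
        ≡⟨ cong (+ (t !) *_) (∑ᵖᵖ-swap l (λ a c q → x a * (y c * e t q))) ⟩
      + (t !) * ∑ᵖᵖ l (λ a c q → x c * (y a * e t q))
        ≡⟨ cong (+ (t !) *_) (∑ᵖ-cong l (λ {a} {r} _ → step₂ a r)) ⟩
      + (t !) * ∑ᵖ l (λ a r → + suc t * (y a * e (suc t) r))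
        ≡⟨ cong (+ (t !) *_) (∑ᵖ-* l (+ suc t) (λ a r → y a * e (suc t) r)) ⟩
      + (t !) * (+ suc t * ∑ᵖ l (λ a r → y a * e (suc t) r))
        ≡⟨ assoc (+ (t !)) (+ suc t) (∑ᵖ l (λ a r → y a * e (suc t) r)) ⟩
      + suc t * + (t !) * ∑ᵖ l (λ a r → y a * e (suc t) r)
        ≡⟨ cong (_* ∑ᵖ l (λ a r → y a * e (suc t) r)) (pos-* (suc t) (t !)) ⟨
      + (suc t ℕ.* t !) * ∑ᵖ l (λ a r → y a * e (suc t) r) ∎
      where
      open ≡-Reasoning
      assoc : ∀ u v w → u * (v * w) ≡ v * u * w
      assoc = solve-∀
      left-comm : ∀ u v w → u * (v * w) ≡ v * (u * w)
      left-comm = solve-∀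
      step : ∀ a r → x a * rainbow t r ≡ + (t !) * ∑ᵖ r (λ c q → x a * (y c * e t q))
      step a r = begin
        x a * rainbow t r                                          ≡⟨ cong (x a *_) (rainbow-e t r) ⟩
        x a * (+ (t !) * ∑ᵖ r (λ c q → y c * e t q))               ≡⟨ left-comm (x a) (+ (t !)) (∑ᵖ r (λ c q → y c * e t q)) ⟩
        + (t !) * (x a * ∑ᵖ r (λ c q → y c * e t q))               ≡⟨ cong (+ (t !) *_) (∑ᵖ-* r (x a) (λ c q → y c * e t q)) ⟨
        + (t !) * ∑ᵖ r (λ c q → x a * (y c * e t q))               ∎
      step₂ : ∀ a r → ∑ᵖ r (λ c q → x c * (y a * e t q)) ≡ + suc t * (y a * e (suc t) r)
      step₂ a r = begin
        ∑ᵖ r (λ c q → x c * (y a * e t q))     ≡⟨ ∑ᵖ-cong r (λ {c} {q} _ → left-comm (x c) (y a) (e t q)) ⟩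
        ∑ᵖ r (λ c q → y a * (x c * e t q))     ≡⟨ ∑ᵖ-* r (y a) (λ c q → x c * e t q) ⟩
        y a * ∑ᵖ r (λ c q → x c * e t q)       ≡⟨ cong (y a *_) (∑ᵖ-x*e t r) ⟩
        y a * (+ suc t * e (suc t) r)          ≡⟨ left-comm (y a) (+ suc t) (e (suc t) r) ⟩
        + suc t * (y a * e (suc t) r)          ∎

  module Family {A B : Set} (x : B → A → ℤ) (0≤x : ∀ T a → 0ℤ ≤ x T a) (Ts : List B) (l : List A) (s : ℤ)
    (0<s : 0ℤ < s) (total : ∀ {T} → T ∈ Ts → ∑ l (x T) ≡ s) where

    open Elementary using (e; κ; covariance; telescope)
    open ElementaryNonNeg using (pair-bound)

    -- Not normalised: `x T` is `s p` for the chunk `T`, and `y` is `N s q`.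
    y : A → ℤ
    y a = ∑ Ts (λ T → x T a)

    private
      N b : ℤ
      N = + length Ts
      b = + length l

    ∑y : ∑ l y ≡ N * s
    ∑y = begin
      ∑ l (λ a → ∑ Ts (λ T → x T a))  ≡⟨ ∑-swap Ts l x ⟨
      ∑ Ts (λ T → ∑ l (x T))          ≡⟨ ∑-cong Ts total ⟩
      ∑ Ts (λ _ → s)                  ≡⟨ ∑-const Ts s ⟩
      N * s                           ∎
      where open ≡-Reasoning

    module _ (n j : ℕ) (len : length l ≡ suc (suc n)) (j<n : j ℕ.< n) (bal : Balanced n j) where

      private
        t : ℕ
        t = suc (suc j)

        C δ : ℤ
        C = + 4 * (fall (+ n) (suc j) * s ^ suc j)
        δ = delta b (suc j)

        Φ : B → ℤ
        Φ T = ∑ᵖ l (λ a r → y a * e (x T) t r)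

        YX : B → A → A → ℤ
        YX T a c = (y a - y c) * (x T a - x T c)

        YY : A → A → ℤ
        YY a c = (y a - y c) * (y a - y c)

        0<C : 0ℤ < C
        0<C = 0<* {+ 4} (+<+ (s≤s z≤n)) (0<* (0<fall n (suc j) j<n) (0<^ 0<s (suc j)))

        pair : ∀ {T a c r q} → T ∈ Ts → Pick l a r → Pick r c q →
          b * C * (N * YX T a c + -1ℤ * YY a c) ≤
          N * N * ((x T a - x T c) * (x T a - x T c) * (s * (b - + t) * κ (x T) b s (suc j) q)) +
          b * δ * N * (YX T a c * e (x T) (suc j) q)
        pair {T} {a} {c} {r} {q} T∈ p p′ = complete-square
          {δ = δ} {e = e (x T) (suc j) q} {N = N} (x T a - x T c) (y a - y c) 0≤b 0<C bound
          where
          0≤b : 0ℤ ≤ b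
          0≤b = +≤+ z≤n
          ∑q≤s : ∑ q (x T) ≤ s
          ∑q≤s = subst (∑ q (x T) ≤_) (total T∈) (begin
            ∑ q (x T)                       ≤⟨ ≤-by (0≤+ (0≤x T a) (0≤x T c)) (flip+ (x T a) (x T c) (∑ q (x T))) ⟩
            x T a + (x T c + ∑ q (x T))     ≡⟨ +-congʳ (x T a) (∑-pick (x T) p′) ⟨
            x T a + ∑ r (x T)               ≡⟨ ∑-pick (x T) p ⟨
            ∑ l (x T)                       ∎)
            where
            open ≤-Reasoning
            flip+ : ∀ u v w → u + (v + w) ≡ w + (u + v)
            flip+ = solve-∀
          -- `pair-bound` is about `length q` and `2 + length q`; with variables in their place, the
          -- equations with `n` and `length l` can be matched against `refl`.
          general : ∀ n′ L → n′ ≡ length q → L ≡ suc (suc n′) → j ℕ.≤ n′ → Balanced n′ j →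
            let C = + 4 * (fall (+ n′) (suc j) * s ^ suc j)
                D = C - delta (+ L) (suc j) * e (x T) (suc j) q
            in + L * (D * D) ≤ + 4 * C * (s * (+ L - + t) * κ (x T) (+ L) s (suc j) q)
          general _ _ refl refl j≤n = pair-bound (x T) (0≤x T) q ∑q≤s j j≤n
          bound = general n (length l)
            (ℕ.suc-injective (ℕ.suc-injective (trans (sym len) (trans (Pick-length p) (cong suc (Pick-length p′))))))
            len (ℕ.<⇒≤ j<n) bal

        -- The term with `b * C` is the added multiple of `Σᵢ qᵢ (pᵢ - qᵢ)`, written as a sum over
        -- pairs; it vanishes only after summation over `T`. With it every pair falls under
        -- `complete-square`. Then `covariance` cancels `Φ T`, and what is left is the right side of
        -- `telescope`.
        family-member : ∀ {T} → T ∈ Ts →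
          b * C * (N * ∑ᵖᵖ l (λ a c _ → YX T a c) + -1ℤ * ∑ᵖᵖ l (λ a c _ → YY a c)) + + 2 * N * (b * powfact b t * Φ T) ≤
          + 2 * N * (N * (fall b (suc t) * s ^ suc t))
        family-member {T} T∈ = begin
          b * C * (N * P + -1ℤ * Q) + Z
            ≡⟨ cong (_+ Z) linear₁ ⟨
          ∑ᵖᵖ l (λ a c _ → b * C * (N * YX T a c + -1ℤ * YY a c)) + Z
            ≤⟨ +-monoˡ-≤ Z (∑ᵖᵖ-mono l (pair T∈)) ⟩
          ∑ᵖᵖ l (λ a c r → N * N * (XX a c * (g * k r)) + b * δ * N * (YX T a c * ε r)) + Z
            ≡⟨ cong (_+ Z) linear₂ ⟩
          N * N * (g * ∑ᵖᵖ l (λ a c r → XX a c * k r)) + b * δ * N * ∑ᵖᵖ l (λ a c r → YX T a c * ε r) + Z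
            ≡⟨ cong (λ z → N * N * (g * ∑ᵖᵖ l (λ a c r → XX a c * k r)) + b * δ * N * z + Z)
                 (trans (covariance (x T) y (suc j) l)
                   (cong (λ z → + 2 * ((b - + t) * (z * e (x T) t l) - b * Φ T)) ∑y)) ⟩
          N * N * (g * ∑ᵖᵖ l (λ a c r → XX a c * k r)) +
          b * δ * N * (+ 2 * ((b - + t) * (N * s * e (x T) t l) - b * Φ T)) + Z
            ≡⟨ cancel b (b - + t) (+ t) (powfact b (suc j)) N s (e (x T) t l) (Φ T) (∑ᵖᵖ l (λ a c r → XX a c * k r)) ⟩
          N * N * (s * (b - + t)) * (+ 2 * (powfact b t * e (x T) t l) + ∑ᵖᵖ l (λ a c r → XX a c * k r))
            ≡⟨ cong (N * N * (s * (b - + t)) *_) telescope′ ⟨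
          N * N * (s * (b - + t)) * (+ 2 * (fall b t * s ^ t))
            ≡⟨ tidy N s (b - + t) (fall b t) (s ^ t) ⟩
          + 2 * N * (N * (fall b (suc t) * s ^ suc t)) ∎
          where
          open ≤-Reasoning
          P = ∑ᵖᵖ l (λ a c _ → YX T a c)
          Q = ∑ᵖᵖ l (λ a c _ → YY a c)
          Z = + 2 * N * (b * powfact b t * Φ T)
          g = s * (b - + t)
          XX : A → A → ℤ
          XX a c = (x T a - x T c) * (x T a - x T c)
          k ε : List A → ℤ
          k r = κ (x T) b s (suc j) r
          ε r = e (x T) (suc j) r
          linear₁ : ∑ᵖᵖ l (λ a c _ → b * C * (N * YX T a c + -1ℤ * YY a c)) ≡ b * C * (N * P + -1ℤ * Q)
          linear₁ = trans (∑ᵖᵖ-* l (b * C) (λ a c _ → N * YX T a c + -1ℤ * YY a c))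
            (cong (b * C *_) (trans (∑ᵖᵖ-+ l (λ a c _ → N * YX T a c) (λ a c _ → -1ℤ * YY a c))
              (cong₂ _+_ (∑ᵖᵖ-* l N (λ a c _ → YX T a c)) (∑ᵖᵖ-* l -1ℤ (λ a c _ → YY a c)))))
          linear₂ : ∑ᵖᵖ l (λ a c r → N * N * (XX a c * (g * k r)) + b * δ * N * (YX T a c * ε r)) ≡
            N * N * (g * ∑ᵖᵖ l (λ a c r → XX a c * k r)) + b * δ * N * ∑ᵖᵖ l (λ a c r → YX T a c * ε r)
          linear₂ = trans (∑ᵖᵖ-+ l (λ a c r → N * N * (XX a c * (g * k r))) (λ a c r → b * δ * N * (YX T a c * ε r)))
            (cong₂ _+_
              (trans (∑ᵖᵖ-* l (N * N) (λ a c r → XX a c * (g * k r)))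
                (cong (N * N *_) (trans (∑ᵖᵖ-cong l (λ {a} {c} {_} {q} _ _ → left-comm (XX a c) g (k q)))
                  (∑ᵖᵖ-* l g (λ a c r → XX a c * k r)))))
              (∑ᵖᵖ-* l (b * δ * N) (λ a c r → YX T a c * ε r)))
            where
            left-comm : ∀ u v w → u * (v * w) ≡ v * (u * w)
            left-comm = solve-∀
          telescope′ : + 2 * (fall b t * s ^ t) ≡ + 2 * (powfact b t * e (x T) t l) + ∑ᵖᵖ l (λ a c r → XX a c * k r)
          telescope′ = subst (λ z → + 2 * (fall b t * z ^ t) ≡ + 2 * (powfact b t * e (x T) t l) +
            ∑ᵖᵖ l (λ a c r → XX a c * κ (x T) b z (suc j) r)) (total T∈) (telescope (x T) (suc j) l)
          cancel : ∀ b d t β N s e Φ K →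
            N * N * (s * d * K) + b * (t * β) * N * (+ 2 * (d * (N * s * e) - b * Φ)) + + 2 * N * (b * (b * t * β) * Φ) ≡
            N * N * (s * d) * (+ 2 * (b * t * β * e) + K)
          cancel = solve-∀
          tidy : ∀ N s d f u → N * N * (s * d) * (+ 2 * (f * u)) ≡ + 2 * N * (N * (d * f * (s * u)))
          tidy = solve-∀

      module _ (0<N : 0ℤ < N) where

        private
          sum-Φ : b * powfact b t * ∑ Ts Φ ≤ N * (N * (fall b (suc t) * s ^ suc t))
          sum-Φ = *-cancelʳ-≤ (0<* {+ 2} (+<+ (s≤s z≤n)) 0<N) (begin
            + 2 * N * (b * powfact b t * ∑ Ts Φ)
              ≡⟨ vanish (b * C) N (∑ᵖᵖ l (λ a c _ → YY a c)) (+ 2 * N * (b * powfact b t * ∑ Ts Φ)) ⟩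
            b * C * (N * ∑ᵖᵖ l (λ a c _ → YY a c) + -1ℤ * (N * ∑ᵖᵖ l (λ a c _ → YY a c))) + + 2 * N * (b * powfact b t * ∑ Ts Φ)
              ≡⟨ cong₂ (λ u v → b * C * (N * u + -1ℤ * v) + + 2 * N * (b * powfact b t * ∑ Ts Φ)) ∑P ∑Q ⟨
            b * C * (N * ∑ Ts P + -1ℤ * ∑ Ts (λ _ → Q)) + + 2 * N * (b * powfact b t * ∑ Ts Φ)
              ≡⟨ linear ⟨
            ∑ Ts (λ T → b * C * (N * P T + -1ℤ * Q) + + 2 * N * (b * powfact b t * Φ T))
              ≤⟨ ∑-mono Ts family-member ⟩
            ∑ Ts (λ _ → + 2 * N * (N * (fall b (suc t) * s ^ suc t)))
              ≡⟨ ∑-const Ts (+ 2 * N * (N * (fall b (suc t) * s ^ suc t))) ⟩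
            N * (+ 2 * N * (N * (fall b (suc t) * s ^ suc t)))
              ≡⟨ tidy N (fall b (suc t) * s ^ suc t) ⟩
            + 2 * N * (N * (N * (fall b (suc t) * s ^ suc t))) ∎)
            where
            open ≤-Reasoning
            P : B → ℤ
            P T = ∑ᵖᵖ l (λ a c _ → YX T a c)
            Q = ∑ᵖᵖ l (λ a c _ → YY a c)
            vanish : ∀ u N q z → z ≡ u * (N * q + -1ℤ * (N * q)) + z
            vanish = solve-∀
            tidy : ∀ N f → N * (+ 2 * N * (N * f)) ≡ + 2 * N * (N * (N * f))
            tidy = solve-∀
            ∑Q : ∑ Ts (λ _ → Q) ≡ N * Q
            ∑Q = ∑-const Ts Q
            ∑diff : ∀ a c → ∑ Ts (λ T → x T a - x T c) ≡ y a - y c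
            ∑diff a c = trans (∑-cong Ts (λ {T} _ → +-congʳ (x T a) (sym (-1*i≡-i (x T c)))))
              (trans (∑-+ Ts (λ T → x T a) (λ T → -1ℤ * x T c))
                (+-congʳ (y a) (trans (∑-* Ts -1ℤ (λ T → x T c)) (-1*i≡-i (y c)))))
            ∑P : ∑ Ts P ≡ Q
            ∑P = trans (∑-∑ᵖᵖ Ts l (λ T a c _ → YX T a c))
              (∑ᵖᵖ-cong l (λ {a} {c} _ _ → trans (∑-* Ts (y a - y c) (λ T → x T a - x T c)) (cong ((y a - y c) *_) (∑diff a c))))
            linear : ∑ Ts (λ T → b * C * (N * P T + -1ℤ * Q) + + 2 * N * (b * powfact b t * Φ T)) ≡
              b * C * (N * ∑ Ts P + -1ℤ * ∑ Ts (λ _ → Q)) + + 2 * N * (b * powfact b t * ∑ Ts Φ)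
            linear = trans (∑-+ Ts (λ T → b * C * (N * P T + -1ℤ * Q)) (λ T → + 2 * N * (b * powfact b t * Φ T)))
              (cong₂ _+_
                (trans (∑-* Ts (b * C) (λ T → N * P T + -1ℤ * Q))
                  (cong (b * C *_) (trans (∑-+ Ts (λ T → N * P T) (λ _ → -1ℤ * Q))
                    (cong₂ _+_ (∑-* Ts N P) (∑-* Ts -1ℤ (λ _ → Q))))))
                (trans (∑-* Ts (+ 2 * N) (λ T → b * powfact b t * Φ T))
                  (cong (+ 2 * N *_) (∑-* Ts (b * powfact b t) Φ))))

        -- Divided by `N * N * b ^ suc t * s ^ suc t`, the right side becomes the probability that
        -- `t + 1` independent uniform letters are distinct.
        rainbow-bound : b ^ suc t * ∑ Ts (λ T → rainbow (x T) y t l) ≤ N * (N * (fall b (suc t) * s ^ suc t))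
        rainbow-bound = ≤-trans (≤-reflexive (begin
          b * b ^ t * ∑ Ts (λ T → rainbow (x T) y t l)   ≡⟨ cong (b * b ^ t *_) (∑-cong Ts (λ {T} _ → rainbow-e (x T) y t l)) ⟩
          b * b ^ t * ∑ Ts (λ T → + (t !) * Φ T)         ≡⟨ cong (b * b ^ t *_) (∑-* Ts (+ (t !)) Φ) ⟩
          b * b ^ t * (+ (t !) * ∑ Ts Φ)                 ≡⟨ assoc b (b ^ t) (+ (t !)) (∑ Ts Φ) ⟩
          b * (b ^ t * + (t !)) * ∑ Ts Φ                 ≡⟨ cong (λ z → b * z * ∑ Ts Φ) (powfact-factorial b t) ⟨
          b * powfact b t * ∑ Ts Φ                         ∎)) sum-Φ
          where
          open ≡-Reasoning
          assoc : ∀ b u v w → b * u * (v * w) ≡ b * (u * v) * w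
          assoc = solve-∀

open import Data.Nat
open import Data.Nat.Properties
open import Data.Nat.Tactic.RingSolver using (solve-∀)
open Polynomial using (∑; ∑ᵖ; ∑ᵖ-cong; ∑-cong; fall; Balanced; rainbow; module Family)

-- Hansel's lemma

⟦_⟧ : ∀ {P : Set} → Dec P → ℕ
⟦ d ⟧ = if does d then 1 else 0

1≤⟦_⟧ : ∀ {P : Set} (d : Dec P) → P → 1 ≤ ⟦ d ⟧
1≤⟦ yes _ ⟧ p = ≤-refl
1≤⟦ no ¬p ⟧ p = ⊥-elim (¬p p)

∑ⁿ ∏ⁿ : {A : Set} → List A → (A → ℕ) → ℕ
∑ⁿ []      f = 0
∑ⁿ (a ∷ l) f = f a + ∑ⁿ l f
∏ⁿ []      f = 1
∏ⁿ (a ∷ l) f = f a * ∏ⁿ l f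

private
  interchange : ∀ a b c d → (a + b) + (c + d) ≡ (a + c) + (b + d)
  interchange = solve-∀

module _ {A : Set} where

  ∑ⁿ-mono : ∀ (l : List A) {f g} → (∀ {a} → a ∈ l → f a ≤ g a) → ∑ⁿ l f ≤ ∑ⁿ l g
  ∑ⁿ-mono []      h = z≤n
  ∑ⁿ-mono (a ∷ l) h = +-mono-≤ (h (here refl)) (∑ⁿ-mono l (λ a∈l → h (there a∈l)))

  ∑ⁿ-cong : ∀ (l : List A) {f g} → (∀ a → f a ≡ g a) → ∑ⁿ l f ≡ ∑ⁿ l g
  ∑ⁿ-cong []      h = refl
  ∑ⁿ-cong (a ∷ l) h = cong₂ _+_ (h a) (∑ⁿ-cong l h)

  ∑ⁿ-+ : ∀ (l : List A) f g → ∑ⁿ l (λ a → f a + g a) ≡ ∑ⁿ l f + ∑ⁿ l g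
  ∑ⁿ-+ []      f g = refl
  ∑ⁿ-+ (a ∷ l) f g = trans (cong (f a + g a +_) (∑ⁿ-+ l f g)) (interchange (f a) (g a) (∑ⁿ l f) (∑ⁿ l g))

  ∑ⁿ-* : ∀ (l : List A) c f → ∑ⁿ l (λ a → c * f a) ≡ c * ∑ⁿ l f
  ∑ⁿ-* []      c f = sym (*-zeroʳ c)
  ∑ⁿ-* (a ∷ l) c f = trans (cong (c * f a +_) (∑ⁿ-* l c f)) (sym (*-distribˡ-+ c (f a) (∑ⁿ l f)))

  ∑ⁿ-*ʳ : ∀ (l : List A) c f → ∑ⁿ l (λ a → f a * c) ≡ ∑ⁿ l f * c
  ∑ⁿ-*ʳ []      c f = refl
  ∑ⁿ-*ʳ (a ∷ l) c f = trans (cong (f a * c +_) (∑ⁿ-*ʳ l c f)) (sym (*-distribʳ-+ c (f a) (∑ⁿ l f)))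

  ∑ⁿ-const : ∀ (l : List A) c → ∑ⁿ l (λ _ → c) ≡ length l * c
  ∑ⁿ-const []      c = refl
  ∑ⁿ-const (a ∷ l) c = cong (c +_) (∑ⁿ-const l c)

  ∑ⁿ-0 : ∀ (l : List A) → ∑ⁿ l (λ _ → 0) ≡ 0
  ∑ⁿ-0 l = trans (∑ⁿ-const l 0) (*-zeroʳ (length l))

  ∈⇒≤∑ⁿ : ∀ {l : List A} {a} f → a ∈ l → f a ≤ ∑ⁿ l f
  ∈⇒≤∑ⁿ {l = a ∷ l} f (here refl) = m≤m+n (f a) (∑ⁿ l f)
  ∈⇒≤∑ⁿ {l = c ∷ l} f (there a∈l) = m≤n⇒m≤o+n (f c) (∈⇒≤∑ⁿ f a∈l)

∑ⁿ-swap : ∀ {A B : Set} (k : List B) (l : List A) (f : B → A → ℕ) →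
  ∑ⁿ k (λ c → ∑ⁿ l (f c)) ≡ ∑ⁿ l (λ a → ∑ⁿ k (λ c → f c a))
∑ⁿ-swap []      l f = sym (∑ⁿ-0 l)
∑ⁿ-swap (c ∷ k) l f = trans (cong (∑ⁿ l (f c) +_) (∑ⁿ-swap k l f)) (sym (∑ⁿ-+ l (f c) (λ a → ∑ⁿ k (λ d → f d a))))

^-distribʳ-* : ∀ n x y → (x * y) ^ n ≡ x ^ n * y ^ n
^-distribʳ-* zero    x y = refl
^-distribʳ-* (suc n) x y = trans (cong (x * y *_) (^-distribʳ-* n x y)) ([m*n]*[o*p]≡[m*o]*[n*p] x y (x ^ n) (y ^ n))

2xy≤x²+y² : ∀ x y → 2 * (x * y) ≤ x * x + y * y
2xy≤x²+y² x y with ≤-total x y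
... | inj₁ x≤y = subst (λ z → 2 * (x * z) ≤ x * x + z * z) (m+[n∸m]≡n x≤y)
        (subst (2 * (x * (x + d)) ≤_) (sym (expand x d)) (m≤m+n (2 * (x * (x + d))) (d * d)))
  where
  d = y ∸ x
  expand : ∀ x d → x * x + (x + d) * (x + d) ≡ 2 * (x * (x + d)) + d * d
  expand = solve-∀
... | inj₂ y≤x = subst (λ z → 2 * (z * y) ≤ z * z + y * y) (m+[n∸m]≡n y≤x)
        (subst (2 * ((y + d) * y) ≤_) (sym (expand y d)) (m≤m+n (2 * ((y + d) * y)) (d * d)))
  where
  d = x ∸ y
  expand : ∀ y d → (y + d) * (y + d) + y * y ≡ 2 * ((y + d) * y) + d * d
  expand = solve-∀

-- The arithmetic-geometric mean inequality for `u` and `k` copies of `y`. The term added to both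
-- sides in the induction makes `2 * (u * y)` appear, which is at most `u * u + y * y`.
bernoulli : ∀ k u y → suc k * (u * y ^ k) ≤ u ^ suc k + k * y ^ suc k
bernoulli zero    u y = ≤-reflexive (base u)
  where
  base : ∀ u → 1 * (u * 1) ≡ u * 1 + 0
  base = solve-∀
bernoulli (suc k) u y = +-cancelʳ-≤ (k * (u * (y * t))) _ _ (begin
  suc (suc k) * (u * (y * t)) + k * (u * (y * t))
    ≡⟨ e₁ k u y t ⟩
  suc k * t * (2 * (u * y))
    ≤⟨ *-monoʳ-≤ (suc k * t) (2xy≤x²+y² u y) ⟩
  suc k * t * (u * u + y * y)
    ≡⟨ e₂ k u y t ⟩
  u * (suc k * (u * t)) + suc k * (y * (y * t))
    ≤⟨ +-monoˡ-≤ (suc k * (y * (y * t))) (*-monoʳ-≤ u (bernoulli k u y)) ⟩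
  u * (u ^ suc k + k * (y * t)) + suc k * (y * (y * t))
    ≡⟨ e₃ k u y t (u ^ suc k) ⟩
  u * u ^ suc k + suc k * (y * (y * t)) + k * (u * (y * t)) ∎)
  where
  open ≤-Reasoning
  t = y ^ k
  e₁ : ∀ k u y t → (2 + k) * (u * (y * t)) + k * (u * (y * t)) ≡ (1 + k) * t * (2 * (u * y))
  e₁ = solve-∀
  e₂ : ∀ k u y t → (1 + k) * t * (u * u + y * y) ≡ u * ((1 + k) * (u * t)) + (1 + k) * (y * (y * t))
  e₂ = solve-∀
  e₃ : ∀ k u y t v → u * (v + k * (y * t)) + (1 + k) * (y * (y * t)) ≡ u * v + (1 + k) * (y * (y * t)) + k * (u * (y * t))
  e₃ = solve-∀

-- The step of `am-gm` in which a term `w` joins `k` terms with sum `S`. It is `bernoulli` for `U`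
-- and `Y`, which coincide exactly in the case of equality `S = k * w`.
weighted-am-gm : ∀ k w S → w * S ^ k * suc k ^ suc k ≤ k ^ k * (S + w) ^ suc k
weighted-am-gm zero      w S = subst₂ _≤_ (sym (e₁ w)) (sym (e₂ w S)) (m≤n+m w S)
  where
  e₁ : ∀ w → w * 1 * 1 ≡ w
  e₁ = solve-∀
  e₂ : ∀ w S → 1 * ((S + w) * 1) ≡ S + w
  e₂ = solve-∀
weighted-am-gm k@(suc _) w S = *-cancelˡ-≤ k (+-cancelʳ-≤ (k * (Y * Y ^ k)) _ _ (begin
  k * (w * S ^ k * (suc k * suc k ^ k)) + k * (Y * Y ^ k)
    ≡⟨ cong (λ z → k * (w * S ^ k * (suc k * suc k ^ k)) + k * (Y * z)) Y^k ⟩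
  k * (w * S ^ k * (suc k * suc k ^ k)) + k * (Y * (suc k ^ k * S ^ k))
    ≡⟨ e₁ k w S (S ^ k) (suc k ^ k) ⟩
  suc k * (U * (suc k ^ k * S ^ k))
    ≡⟨ cong (λ z → suc k * (U * z)) Y^k ⟨
  suc k * (U * Y ^ k)
    ≤⟨ bernoulli k U Y ⟩
  U ^ suc k + k * Y ^ suc k
    ≡⟨ cong (_+ k * Y ^ suc k) (^-distribʳ-* (suc k) k (S + w)) ⟩
  k * k ^ k * (S + w) ^ suc k + k * Y ^ suc k
    ≡⟨ cong (_+ k * Y ^ suc k) (*-assoc k (k ^ k) _) ⟩
  k * (k ^ k * (S + w) ^ suc k) + k * (Y * Y ^ k) ∎))
  where
  open ≤-Reasoning
  U = k * (S + w)
  Y = suc k * S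
  Y^k = ^-distribʳ-* k (suc k) S
  e₁ : ∀ k w S s c → k * (w * s * ((1 + k) * c)) + k * ((1 + k) * S * (c * s)) ≡ (1 + k) * (k * (S + w) * (c * s))
  e₁ = solve-∀

am-gm : ∀ {A : Set} (l : List A) f → ∏ⁿ l f * length l ^ length l ≤ ∑ⁿ l f ^ length l
am-gm []      f = ≤-refl
am-gm (a ∷ l) f = *-cancelˡ-≤ (k ^ k) ⦃ k^k≢0 k ⦄ (begin
  k ^ k * (w * P * suc k ^ suc k)    ≡⟨ e₁ (k ^ k) w P (suc k ^ suc k) ⟩
  w * (P * k ^ k) * suc k ^ suc k    ≤⟨ *-monoˡ-≤ (suc k ^ suc k) (*-monoʳ-≤ w (am-gm l f)) ⟩
  w * S ^ k * suc k ^ suc k          ≤⟨ weighted-am-gm k w S ⟩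
  k ^ k * (S + w) ^ suc k            ≡⟨ cong (λ z → k ^ k * z ^ suc k) (+-comm S w) ⟩
  k ^ k * (w + S) ^ suc k            ∎)
  where
  open ≤-Reasoning
  k = length l
  w = f a
  P = ∏ⁿ l f
  S = ∑ⁿ l f
  k^k≢0 : ∀ k → NonZero (k ^ k)
  k^k≢0 zero    = _
  k^k≢0 (suc k) = m^n≢0 (suc k) (suc k)
  e₁ : ∀ t w P c → t * (w * P * c) ≡ w * (P * t) * c
  e₁ = solve-∀

module _ {b : ℕ} where

  open import Data.List.Membership.DecPropositional (Fin._≟_ {b}) using (_∈?_)

  Separated : ∀ {n} → Vec (List (Fin b)) n → (v w : Vec (Fin b) n) → Set
  Separated []       []      []      = ⊥
  Separated (R ∷ Rs) (c ∷ v) (d ∷ w) = (c ∈ R × d ∈ R × c ≢ d) ⊎ Separated Rs v w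

  degree : ∀ {n} → Vec (List (Fin b)) n → Vec (Fin b) n → ℕ
  degree []       []      = 0
  degree (R ∷ Rs) (c ∷ v) = ⟦ c ∈? R ⟧ + degree Rs v

  module _ (r : ℕ) where

    -- Draw one letter from each nonempty `R` and discard the words that show another letter of that
    -- `R`. If these `R` have `r` letters, the weight is `r ^ n` times the probability that the word
    -- survives.
    weight : ∀ {n} → Vec (List (Fin b)) n → Vec (Fin b) n → ℕ
    weight []       []      = 1
    weight (R ∷ Rs) (c ∷ v) = (if does (c ∈? R) then 1 else r) * weight Rs v

    weight*r^degree : ∀ {n} (Rs : Vec (List (Fin b)) n) v → weight Rs v * r ^ degree Rs v ≡ r ^ n
    weight*r^degree []       []      = refl
    weight*r^degree (R ∷ Rs) (c ∷ v) with does (c ∈? R)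
    ... | true  = trans (lem (weight Rs v) r (r ^ degree Rs v)) (cong (r *_) (weight*r^degree Rs v))
      where
      lem : ∀ w r d → (1 * w) * (r * d) ≡ r * (w * d)
      lem = solve-∀
    ... | false = trans (*-assoc r (weight Rs v) _) (cong (r *_) (weight*r^degree Rs v))

    Keep : List (Fin b) → Fin b → Fin b → Set
    Keep R a c = c ∉ R ⊎ c ≡ a

    keep? : ∀ R a c → Dec (Keep R a c)
    keep? R a c = ¬? (c ∈? R) ⊎-dec (c Fin.≟ a)

    consIf : ∀ {A P : Set} → Dec P → A → List A → List A
    consIf (yes _) v V = v ∷ V
    consIf (no _)  v V = V

    ∑-consIf : ∀ {A P : Set} (d : Dec P) (v : A) V w → ∑ⁿ (consIf d v V) w ≡ ⟦ d ⟧ * w v + ∑ⁿ V w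
    ∑-consIf (yes _) v V w = cong (_+ ∑ⁿ V w) (sym (+-identityʳ (w v)))
    ∑-consIf (no _)  v V w = refl

    restrict : ∀ {n} → List (Fin b) → Fin b → List (Vec (Fin b) (suc n)) → List (Vec (Fin b) n)
    restrict R a []            = []
    restrict R a ((c ∷ v) ∷ V) = consIf (keep? R a c) v (restrict R a V)

    restrict-All : ∀ {n} R a (Rs : Vec _ n) {c v} → Keep R a c → ∀ {V} →
      All (Separated (R ∷ Rs) (c ∷ v)) V → All (Separated Rs v) (restrict R a V)
    restrict-All R a Rs kc {[]}          []       = []
    restrict-All R a Rs kc {(d ∷ w) ∷ V} (s ∷ ss) with keep? R a d
    ... | no _   = restrict-All R a Rs kc ss
    ... | yes kd = separated kc kd s ∷ restrict-All R a Rs kc ss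
      where
      separated : ∀ {c v d w} → Keep R a c → Keep R a d → Separated (R ∷ Rs) (c ∷ v) (d ∷ w) → Separated Rs v w
      separated _           _           (inj₂ s)               = s
      separated (inj₁ c∉R)  _           (inj₁ (c∈R , _ , _))   = ⊥-elim (c∉R c∈R)
      separated (inj₂ _)    (inj₁ d∉R)  (inj₁ (_ , d∈R , _))   = ⊥-elim (d∉R d∈R)
      separated (inj₂ refl) (inj₂ refl) (inj₁ (_ , _ , c≢c))   = ⊥-elim (c≢c refl)

    restrict-AllPairs : ∀ {n} R a (Rs : Vec _ n) {V} →
      AllPairs (Separated (R ∷ Rs)) V → AllPairs (Separated Rs) (restrict R a V)
    restrict-AllPairs R a Rs {[]}          []       = []
    restrict-AllPairs R a Rs {(c ∷ v) ∷ V} (s ∷ ss) with keep? R a c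
    ... | yes kc = restrict-All R a Rs kc s ∷ restrict-AllPairs R a Rs ss
    ... | no _   = restrict-AllPairs R a Rs ss

    -- Each word of V survives in restrict R a V for every a ∈ R if its first letter is outside R, else for one a.
    ∑-restrict : ∀ {n} R (Rs : Vec _ n) → length R ≡ r → ∀ V →
      ∑ⁿ V (weight (R ∷ Rs)) ≤ ∑ⁿ R (λ a → ∑ⁿ (restrict R a V) (weight Rs))
    ∑-restrict R Rs len []            = z≤n
    ∑-restrict R Rs len ((c ∷ v) ∷ V) = begin
      (if does (c ∈? R) then 1 else r) * weight Rs v + ∑ⁿ V (weight (R ∷ Rs))
        ≤⟨ +-mono-≤ (*-monoˡ-≤ (weight Rs v) (survivors (c ∈? R))) (∑-restrict R Rs len V) ⟩
      ∑ⁿ R (λ a → ⟦ keep? R a c ⟧) * weight Rs v + ∑ⁿ R (λ a → ∑ⁿ (restrict R a V) (weight Rs))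
        ≡⟨ cong (_+ _) (∑ⁿ-*ʳ R (weight Rs v) _) ⟨
      ∑ⁿ R (λ a → ⟦ keep? R a c ⟧ * weight Rs v) + ∑ⁿ R (λ a → ∑ⁿ (restrict R a V) (weight Rs))
        ≡⟨ ∑ⁿ-+ R _ _ ⟨
      ∑ⁿ R (λ a → ⟦ keep? R a c ⟧ * weight Rs v + ∑ⁿ (restrict R a V) (weight Rs))
        ≡⟨ ∑ⁿ-cong R (λ a → ∑-consIf (keep? R a c) v (restrict R a V) (weight Rs)) ⟨
      ∑ⁿ R (λ a → ∑ⁿ (restrict R a ((c ∷ v) ∷ V)) (weight Rs)) ∎
      where
      open ≤-Reasoning
      survivors : (d : Dec (c ∈ R)) → (if does d then 1 else r) ≤ ∑ⁿ R (λ a → ⟦ keep? R a c ⟧)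
      survivors (yes c∈R) = ≤-trans (1≤⟦ keep? R c c ⟧ (inj₂ refl)) (∈⇒≤∑ⁿ (λ a → ⟦ keep? R a c ⟧) c∈R)
      survivors (no c∉R)  = ≤-trans (≤-reflexive (trans (sym len) (trans (sym (*-identityʳ (length R))) (sym (∑ⁿ-const R 1)))))
                        (∑ⁿ-mono R (λ {a} _ → 1≤⟦ keep? R a c ⟧ (inj₁ c∉R)))

    -- Two survivors of such a drawing would both show the drawn letter at the coordinate that
    -- separates them, so at most one word survives and the probabilities sum to at most 1. The
    -- induction draws one coordinate at a time; an empty `R` separates nothing, and its coordinate
    -- is simply deleted.
    kraft : ∀ {n} (Rs : Vec (List (Fin b)) n) → VecAll.All (λ R → R ≡ [] ⊎ length R ≡ r) Rs →
      ∀ V → AllPairs (Separated Rs) V → ∑ⁿ V (weight Rs) ≤ r ^ n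
    kraft [] _ []            _             = z≤n
    kraft [] _ ([] ∷ [])     _             = ≤-refl
    kraft [] _ ([] ∷ [] ∷ _) ((() ∷ _) ∷ _)
    kraft {suc n} ([] ∷ Rs) (inj₁ refl VecAll.∷ hs) V sep = begin
      ∑ⁿ V (weight ([] ∷ Rs))             ≡⟨ tails V ⟩
      r * ∑ⁿ (List.map Vec.tail V) (weight Rs) ≤⟨ *-monoʳ-≤ r (kraft Rs hs _ (tails-sep sep)) ⟩
      r * r ^ n                           ∎
      where
      open ≤-Reasoning
      tails : ∀ V → ∑ⁿ V (weight ([] ∷ Rs)) ≡ r * ∑ⁿ (List.map Vec.tail V) (weight Rs)
      tails []            = sym (*-zeroʳ r)
      tails ((c ∷ v) ∷ V) = trans (cong (r * weight Rs v +_) (tails V)) (sym (*-distribˡ-+ r (weight Rs v) _))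
      tails-All : ∀ {c v V} → All (Separated ([] ∷ Rs) (c ∷ v)) V → All (Separated Rs v) (List.map Vec.tail V)
      tails-All {V = []}          []            = []
      tails-All {V = (d ∷ w) ∷ V} (inj₂ s ∷ ss) = s ∷ tails-All ss
      tails-sep : ∀ {V} → AllPairs (Separated ([] ∷ Rs)) V → AllPairs (Separated Rs) (List.map Vec.tail V)
      tails-sep {[]}          []       = []
      tails-sep {(c ∷ v) ∷ V} (s ∷ ss) = tails-All s ∷ tails-sep ss
    kraft {suc n} (R ∷ Rs) (inj₂ len VecAll.∷ hs) V sep = begin
      ∑ⁿ V (weight (R ∷ Rs))                              ≤⟨ ∑-restrict R Rs len V ⟩
      ∑ⁿ R (λ a → ∑ⁿ (restrict R a V) (weight Rs))        ≤⟨ ∑ⁿ-mono R (λ {a} _ → kraft Rs hs _ (restrict-AllPairs R a Rs sep)) ⟩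
      ∑ⁿ R (λ _ → r ^ n)                                  ≡⟨ ∑ⁿ-const R (r ^ n) ⟩
      length R * r ^ n                                    ≡⟨ cong (_* r ^ n) len ⟩
      r * r ^ n                                           ∎
      where open ≤-Reasoning

  -- In logarithms: `log |V|` is at most `log r` times the average degree. The product of the
  -- weights times `r` to the sum of the degrees is `(r ^ n) ^ length V`, while `am-gm` and `kraft`
  -- bound the same product times `length V ^ length V` by this power.
  hansel : ∀ {n} r .⦃ _ : NonZero r ⦄ (Rs : Vec (List (Fin b)) n) → VecAll.All (λ R → R ≡ [] ⊎ length R ≡ r) Rs →
    ∀ V → AllPairs (Separated Rs) V → length V ^ length V ≤ r ^ ∑ⁿ V (degree Rs)
  hansel {n} r Rs hs V sep = *-cancelˡ-≤ P ⦃ P≢0 V ⦄ (begin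
    P * length V ^ length V       ≤⟨ am-gm V (weight r Rs) ⟩
    ∑ⁿ V (weight r Rs) ^ length V ≤⟨ ^-monoˡ-≤ (length V) (kraft r Rs hs V sep) ⟩
    (r ^ n) ^ length V            ≡⟨ product V ⟨
    P * r ^ ∑ⁿ V (degree Rs)      ∎)
    where
    open ≤-Reasoning
    P = ∏ⁿ V (weight r Rs)
    product : ∀ V → ∏ⁿ V (weight r Rs) * r ^ ∑ⁿ V (degree Rs) ≡ (r ^ n) ^ length V
    product []      = refl
    product (v ∷ V) = begin-equality
      weight r Rs v * ∏ⁿ V (weight r Rs) * r ^ (degree Rs v + ∑ⁿ V (degree Rs))
        ≡⟨ cong (weight r Rs v * ∏ⁿ V (weight r Rs) *_) (^-distribˡ-+-* r (degree Rs v) _) ⟩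
      weight r Rs v * ∏ⁿ V (weight r Rs) * (r ^ degree Rs v * r ^ ∑ⁿ V (degree Rs))
        ≡⟨ [m*n]*[o*p]≡[m*o]*[n*p] (weight r Rs v) _ _ _ ⟩
      weight r Rs v * r ^ degree Rs v * (∏ⁿ V (weight r Rs) * r ^ ∑ⁿ V (degree Rs))
        ≡⟨ cong₂ _*_ (weight*r^degree r Rs v) (product V) ⟩
      r ^ n * (r ^ n) ^ length V ∎
    P≢0 : ∀ V → NonZero (∏ⁿ V (weight r Rs))
    P≢0 V = m*n≢0⇒m≢0 (∏ⁿ V (weight r Rs)) ⦃ subst NonZero (sym (product V)) (m^n≢0 (r ^ n) (length V) ⦃ m^n≢0 r n ⦄) ⦄

-- Counting rainbow tuples

∑ⁿᵖ : {A : Set} → List A → (A → List A → ℕ) → ℕ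
∑ⁿᵖ []      f = 0
∑ⁿᵖ (a ∷ l) f = f a l + ∑ⁿᵖ l (λ c r → f c (a ∷ r))

module _ {A : Set} where

  ∑ⁿᵖ-mono : ∀ (l : List A) {f g} → (∀ {a r} → Pick l a r → f a r ≤ g a r) → ∑ⁿᵖ l f ≤ ∑ⁿᵖ l g
  ∑ⁿᵖ-mono []      h = z≤n
  ∑ⁿᵖ-mono (a ∷ l) h = +-mono-≤ (h here) (∑ⁿᵖ-mono l (λ p → h (there p)))

  ∑ⁿᵖ-cong : ∀ (l : List A) {f g} → (∀ {a r} → Pick l a r → f a r ≡ g a r) → ∑ⁿᵖ l f ≡ ∑ⁿᵖ l g
  ∑ⁿᵖ-cong []      h = refl
  ∑ⁿᵖ-cong (a ∷ l) h = cong₂ _+_ (h here) (∑ⁿᵖ-cong l (λ p → h (there p)))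

  ∑ⁿᵖ-∑ⁿ : ∀ (l : List A) f → ∑ⁿᵖ l (λ a _ → f a) ≡ ∑ⁿ l f
  ∑ⁿᵖ-∑ⁿ []      f = refl
  ∑ⁿᵖ-∑ⁿ (a ∷ l) f = cong (f a +_) (∑ⁿᵖ-∑ⁿ l f)

  ∑ⁿᵖ-+ : ∀ (l : List A) f g → ∑ⁿᵖ l (λ a r → f a r + g a r) ≡ ∑ⁿᵖ l f + ∑ⁿᵖ l g
  ∑ⁿᵖ-+ []      f g = refl
  ∑ⁿᵖ-+ (a ∷ l) f g = trans (cong (f a l + g a l +_) (∑ⁿᵖ-+ l _ _)) (lem (f a l) (g a l) _ _)
    where
    lem : ∀ a b c d → (a + b) + (c + d) ≡ (a + c) + (b + d)
    lem = solve-∀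

  ∑ⁿᵖ-0 : ∀ (l : List A) → ∑ⁿᵖ l (λ _ _ → 0) ≡ 0
  ∑ⁿᵖ-0 []      = refl
  ∑ⁿᵖ-0 (a ∷ l) = ∑ⁿᵖ-0 l

  Pick⇒≤∑ⁿᵖ : ∀ {l : List A} {a r} f → Pick l a r → f a r ≤ ∑ⁿᵖ l f
  Pick⇒≤∑ⁿᵖ f here              = m≤m+n _ _
  Pick⇒≤∑ⁿᵖ f (there {c = c} p) = m≤n⇒m≤o+n _ (Pick⇒≤∑ⁿᵖ (λ a r → f a (c ∷ r)) p)

  -- The multiplicative form of adding up the inequalities `f log X ≤ g log R`.
  ^-∑ⁿᵖ : ∀ (l : List A) {X R f g} → (∀ {a r} → Pick l a r → X ^ f a r ≤ R ^ g a r) → X ^ ∑ⁿᵖ l f ≤ R ^ ∑ⁿᵖ l g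
  ^-∑ⁿᵖ []      h = ≤-refl
  ^-∑ⁿᵖ (a ∷ l) {X} {R} {f} {g} h = subst₂ _≤_
    (sym (^-distribˡ-+-* X (f a l) _)) (sym (^-distribˡ-+-* R (g a l) _))
    (*-mono-≤ (h here) (^-∑ⁿᵖ l (λ p → h (there p))))

∑ⁿ-∑ⁿᵖ : ∀ {A B : Set} (k : List B) (l : List A) (f : B → A → List A → ℕ) →
  ∑ⁿ k (λ c → ∑ⁿᵖ l (f c)) ≡ ∑ⁿᵖ l (λ a r → ∑ⁿ k (λ c → f c a r))
∑ⁿ-∑ⁿᵖ []      l f = sym (∑ⁿᵖ-0 l)
∑ⁿ-∑ⁿᵖ (c ∷ k) l f = trans (cong (∑ⁿᵖ l (f c) +_) (∑ⁿ-∑ⁿᵖ k l f)) (sym (∑ⁿᵖ-+ l (f c) (λ a r → ∑ⁿ k (λ d → f d a r))))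

rainbowⁿ : {A : Set} (x y : A → ℕ) → ℕ → List A → ℕ
rainbowⁿ x y zero    l = ∑ⁿ l y
rainbowⁿ x y (suc t) l = ∑ⁿᵖ l (λ a r → x a * rainbowⁿ x y t r)

pos-∑ : ∀ {A : Set} (l : List A) f → ℤ.+ ∑ⁿ l f ≡ ∑ l (λ a → ℤ.+ f a)
pos-∑ []      f = refl
pos-∑ (a ∷ l) f = trans (ℤ.pos-+ (f a) (∑ⁿ l f)) (cong (λ z → (ℤ.+ f a) ℤ.+ z) (pos-∑ l f))

pos-∑ᵖ : ∀ {A : Set} (l : List A) f → ℤ.+ ∑ⁿᵖ l f ≡ ∑ᵖ l (λ a r → ℤ.+ f a r)
pos-∑ᵖ []      f = refl
pos-∑ᵖ (a ∷ l) f = trans (ℤ.pos-+ (f a l) _) (cong (λ z → (ℤ.+ f a l) ℤ.+ z) (pos-∑ᵖ l (λ c r → f c (a ∷ r))))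

pos-rainbow : ∀ {A : Set} (x y : A → ℕ) t l →
  ℤ.+ rainbowⁿ x y t l ≡ rainbow (λ a → ℤ.+ x a) (λ a → ℤ.+ y a) t l
pos-rainbow x y zero    l = pos-∑ l y
pos-rainbow x y (suc t) l = trans (pos-∑ᵖ l _)
  (∑ᵖ-cong l (λ {a} {r} _ → trans (ℤ.pos-* (x a) (rainbowⁿ x y t r)) (cong ((ℤ.+ x a) ℤ.*_) (pos-rainbow x y t r))))

-- In contrast to `fall`, the largest factor is split off, as happens when one element is picked
-- from a list; `pos-fall` reconciles the two.
fallⁿ : ℕ → ℕ → ℕ
fallⁿ s       zero    = 1
fallⁿ zero    (suc t) = 0
fallⁿ (suc s) (suc t) = suc s * fallⁿ s t

pos-fall : ∀ b m → ℤ.+ fallⁿ b m ≡ fall (ℤ.+ b) m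
pos-fall b       zero    = refl
pos-fall zero    (suc m) = sym (vanish m)
  where
  vanish : ∀ m → fall (ℤ.+ 0) (suc m) ≡ ℤ.+ 0
  vanish zero    = refl
  vanish (suc m) = trans (cong ((ℤ.+ 0 ℤ.- ℤ.+ suc m) ℤ.*_) (vanish m)) (ℤ.*-zeroʳ (ℤ.+ 0 ℤ.- ℤ.+ suc m))
pos-fall (suc b) (suc m) = trans (ℤ.pos-* (suc b) (fallⁿ b m))
  (trans (cong ((ℤ.+ suc b) ℤ.*_) (pos-fall b m)) (sym (fall-suc (ℤ.+ b) m)))
  where
  fall-suc : ∀ b m → fall (ℤ.1ℤ ℤ.+ b) (suc m) ≡ (ℤ.1ℤ ℤ.+ b) ℤ.* fall b m
  fall-suc b zero    = lem b
    where
    lem : ∀ b → (ℤ.1ℤ ℤ.+ b ℤ.- ℤ.0ℤ) ℤ.* ℤ.1ℤ ≡ (ℤ.1ℤ ℤ.+ b) ℤ.* ℤ.1ℤ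
    lem = ℤ.solve-∀
  fall-suc b (suc m) = trans (cong ((ℤ.1ℤ ℤ.+ b ℤ.- ℤ.+ suc m) ℤ.*_) (fall-suc b m)) (lem b (ℤ.+ m) (fall b m))
    where
    lem : ∀ b m f → (ℤ.1ℤ ℤ.+ b ℤ.- (ℤ.1ℤ ℤ.+ m)) ℤ.* ((ℤ.1ℤ ℤ.+ b) ℤ.* f) ≡ (ℤ.1ℤ ℤ.+ b) ℤ.* ((b ℤ.- m) ℤ.* f)
    lem = ℤ.solve-∀

pos-^ : ∀ b m → ℤ.+ (b ^ m) ≡ (ℤ.+ b) ℤ.^ m
pos-^ b zero    = refl
pos-^ b (suc m) = trans (ℤ.pos-* b (b ^ m)) (cong ((ℤ.+ b) ℤ.*_) (pos-^ b m))

rainbowⁿ-bound : ∀ {A B : Set} (x : B → A → ℕ) (Ts : List B) (l : List A) s n j → 1 ≤ s → 1 ≤ length Ts →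
  (∀ {T} → T ∈ Ts → ∑ⁿ l (x T) ≡ s) → length l ≡ suc (suc n) → j < n → Balanced n j →
  let t = suc (suc j); N = length Ts; b = length l; y = λ a → ∑ⁿ Ts (λ T → x T a) in
  b ^ suc t * ∑ⁿ Ts (λ T → rainbowⁿ (x T) y t l) ≤ N * (N * (fallⁿ b (suc t) * s ^ suc t))
rainbowⁿ-bound x Ts l s n j 1≤s 1≤N total len j<n bal = ℤ.drop‿+≤+ (subst₂ ℤ._≤_ (sym left) (sym right)
  (F.rainbow-bound n j len j<n bal (ℤ.+<+ 1≤N)))
  where
  t = suc (suc j)
  N = length Ts
  b = length l
  y = λ a → ∑ⁿ Ts (λ T → x T a)
  module F = Family (λ T a → ℤ.+ x T a) (λ _ _ → ℤ.+≤+ z≤n) Ts l (ℤ.+ s) (ℤ.+<+ 1≤s)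
    (λ {T} T∈ → trans (sym (pos-∑ l (x T))) (cong ℤ.+_ (total T∈)))
  rainbow-cong : ∀ x {y y′ : _ → ℤ.ℤ} → (∀ a → y a ≡ y′ a) → ∀ t l → rainbow x y t l ≡ rainbow x y′ t l
  rainbow-cong x eq zero    l = ∑-cong l (λ {a} _ → eq a)
  rainbow-cong x eq (suc t) l = ∑ᵖ-cong l (λ {a} {r} _ → cong (x a ℤ.*_) (rainbow-cong x eq t r))
  left : ℤ.+ (b ^ suc t * ∑ⁿ Ts (λ T → rainbowⁿ (x T) y t l)) ≡
    (ℤ.+ b) ℤ.^ suc t ℤ.* ∑ Ts (λ T → rainbow (λ a → ℤ.+ x T a) F.y t l)
  left = trans (ℤ.pos-* (b ^ suc t) _) (cong₂ ℤ._*_ (pos-^ b (suc t))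
    (trans (pos-∑ Ts _) (∑-cong Ts (λ {T} _ → trans (pos-rainbow (x T) y t l)
      (rainbow-cong (λ a → ℤ.+ x T a) (λ a → pos-∑ Ts (λ U → x U a)) t l)))))
  right : ℤ.+ (N * (N * (fallⁿ b (suc t) * s ^ suc t))) ≡
    (ℤ.+ N) ℤ.* ((ℤ.+ N) ℤ.* (fall (ℤ.+ b) (suc t) ℤ.* (ℤ.+ s) ℤ.^ suc t))
  right = trans (ℤ.pos-* N _) (cong ((ℤ.+ N) ℤ.*_) (trans (ℤ.pos-* N _) (cong ((ℤ.+ N) ℤ.*_)
    (trans (ℤ.pos-* (fallⁿ b (suc t)) _) (cong₂ ℤ._*_ (pos-fall b (suc t)) (pos-^ s (suc t)))))))

-- Ordered tuples of words and the letters that they leave free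

∑ᵃ : {I : Set} → ∀ t → List I → (Vec I t → ℕ) → ℕ
∑ᵃ zero    T F = F []
∑ᵃ (suc t) T F = ∑ⁿᵖ T (λ i S → ∑ᵃ t S (λ is → F (i ∷ is)))

data Arrangement {I : Set} : ∀ {t} → List I → Vec I t → Set where
  []  : ∀ {T} → Arrangement T []
  _∷_ : ∀ {t T S i} {is : Vec I t} → Pick T i S → Arrangement S is → Arrangement T (i ∷ is)

module _ {I : Set} where

  ∑ᵃ-const : ∀ t (T : List I) α → ∑ᵃ t T (λ _ → α) ≡ fallⁿ (length T) t * α
  ∑ᵃ-const zero    T       α = sym (+-identityʳ α)
  ∑ᵃ-const (suc t) []      α = refl
  ∑ᵃ-const (suc t) (i ∷ T) α = begin
    ∑ⁿᵖ (i ∷ T) (λ _ S → ∑ᵃ t S (λ _ → α))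
      ≡⟨ ∑ⁿᵖ-cong (i ∷ T) (λ {_} {S} p → trans (∑ᵃ-const t S α) (cong (λ z → fallⁿ z t * α) (suc-injective (sym (Pick-length p))))) ⟩
    ∑ⁿᵖ (i ∷ T) (λ _ _ → fallⁿ (length T) t * α)
      ≡⟨ trans (∑ⁿᵖ-∑ⁿ (i ∷ T) _) (∑ⁿ-const (i ∷ T) _) ⟩
    suc (length T) * (fallⁿ (length T) t * α)
      ≡⟨ *-assoc (suc (length T)) (fallⁿ (length T) t) α ⟨
    suc (length T) * fallⁿ (length T) t * α ∎
    where open ≡-Reasoning

  ∑ᵃ-0 : ∀ t (T : List I) → ∑ᵃ t T (λ _ → 0) ≡ 0
  ∑ᵃ-0 t T = trans (∑ᵃ-const t T 0) (*-zeroʳ (fallⁿ (length T) t))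

  ^-∑ᵃ : ∀ t (T : List I) {X R α F} → (∀ {is} → Arrangement T is → X ^ α ≤ R ^ F is) →
    X ^ ∑ᵃ t T (λ _ → α) ≤ R ^ ∑ᵃ t T F
  ^-∑ᵃ zero    T h = h []
  ^-∑ᵃ (suc t) T h = ^-∑ⁿᵖ T (λ {i} {S} p → ^-∑ᵃ t S (λ arr → h (p ∷ arr)))

  ∑ⁿ-∑ᵃ : ∀ {B : Set} (k : List B) t (T : List I) (F : B → Vec I t → ℕ) →
    ∑ᵃ t T (λ is → ∑ⁿ k (λ c → F c is)) ≡ ∑ⁿ k (λ c → ∑ᵃ t T (F c))
  ∑ⁿ-∑ᵃ k zero    T F = refl
  ∑ⁿ-∑ᵃ k (suc t) T F = trans (∑ⁿᵖ-cong T (λ {i} {S} _ → ∑ⁿ-∑ᵃ k t S (λ c is → F c (i ∷ is))))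
    (sym (∑ⁿ-∑ⁿᵖ k T (λ c i S → ∑ᵃ t S (λ is → F c (i ∷ is)))))

module _ {b : ℕ} where

  pick? : ∀ (a : Fin b) l → Dec (∃ λ r → Pick l a r)
  pick? a []      = no λ ()
  pick? a (c ∷ l) with a Fin.≟ c
  ... | yes refl = yes (l , here)
  ... | no a≢c   = map′ (λ { (r , p) → c ∷ r , there p })
    (λ { (_ , here) → ⊥-elim (a≢c refl) ; (_ , there p) → _ , p }) (pick? a l)

  -- The letters of l that are left after striking out as; [] if some letter of as is no longer there.
  remaining : ∀ {t} → List (Fin b) → Vec (Fin b) t → List (Fin b)
  remaining′ : ∀ {t l a} → Dec (∃ λ r → Pick l a r) → Vec (Fin b) t → List (Fin b)
  remaining l []       = l
  remaining l (a ∷ as) = remaining′ (pick? a l) as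
  remaining′ (yes (r , _)) as = remaining r as
  remaining′ (no _)        as = []

  remaining-length : ∀ {t} l (as : Vec (Fin b) t) → remaining l as ≡ [] ⊎ length (remaining l as) + t ≡ length l
  remaining-length l []       = inj₂ (+-identityʳ (length l))
  remaining-length l (a ∷ as) with pick? a l
  ... | no _ = inj₁ refl
  ... | yes (r , p) with remaining-length r as
  ...   | inj₁ eq = inj₁ eq
  ...   | inj₂ eq = inj₂ (trans (+-suc _ _) (trans (cong suc eq) (sym (Pick-length p))))

  Pick-∈ : ∀ {l r} {a c : Fin b} → Pick l a r → c ∈ l → c ≢ a → c ∈ r
  Pick-∈ here      (here refl) c≢a = ⊥-elim (c≢a refl)
  Pick-∈ here      (there c∈l) c≢a = c∈l
  Pick-∈ (there p) (here refl) c≢a = here refl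
  Pick-∈ (there p) (there c∈l) c≢a = there (Pick-∈ p c∈l c≢a)

  ∈⇒Pick : ∀ {l} {a : Fin b} → a ∈ l → ∃ λ r → Pick l a r
  ∈⇒Pick (here refl) = _ , here
  ∈⇒Pick (there a∈l) with ∈⇒Pick a∈l
  ... | r , p = _ , there p

  ∈-remaining : ∀ {t} l (as : Vec (Fin b) t) {c} → (∀ i → Vec.lookup as i ∈ l) →
    (∀ {i j} → Vec.lookup as i ≡ Vec.lookup as j → i ≡ j) → c ∈ l → (∀ i → c ≢ Vec.lookup as i) → c ∈ remaining l as
  ∈-remaining l []       as∈ inj c∈l c≢ = c∈l
  ∈-remaining l (a ∷ as) as∈ inj c∈l c≢ with pick? a l
  ... | no ¬p       = ⊥-elim (¬p (∈⇒Pick (as∈ zero)))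
  ... | yes (r , p) = ∈-remaining r as
    (λ i → Pick-∈ p (as∈ (suc i)) (λ eq → 0≢suc (inj {suc i} {zero} eq)))
    (λ {i} {j} eq → Fin.suc-injective (inj {suc i} {suc j} eq))
    (Pick-∈ p c∈l (c≢ zero)) (λ i → c≢ (suc i))
    where
    0≢suc : ∀ {n} {i : Fin n} → suc i ≢ zero
    0≢suc ()

  module _ {I : Set} where

    count : (I → Fin b) → List I → Fin b → ℕ
    count h T a = ∑ⁿ T (λ i → ⟦ a Fin.≟ h i ⟧)

    module _ (h : I → Fin b) (T V : List I) where

      -- Grouping the choices for the next word by its letter `a` gives `count h S a` of them. The
      -- pool `S` shrinks along the tuple whereas `rainbowⁿ` keeps the counts of `T`, hence the
      -- hypothesis. A tuple that repeats a letter of a duplicate-free `l` leaves `remaining` empty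
      -- and adds nothing.
      arrangements-bound : ∀ t (S : List I) l → (∀ a → count h S a ≤ count h T a) →
        ∑ᵃ t S (λ is → ∑ⁿ (remaining l (Vec.map h is)) (count h V)) ≤ rainbowⁿ (count h T) (count h V) t l
      arrangements-bound zero    S l S≤T = ≤-refl
      arrangements-bound (suc t) S l S≤T = begin
        ∑ⁿᵖ S (λ i S′ → ∑ᵃ t S′ (λ is → ∑ⁿ (remaining′ (pick? (h i) l) (Vec.map h is)) (count h V)))
          ≤⟨ ∑ⁿᵖ-mono S (λ {i} {S′} p → step i S′ p (pick? (h i) l)) ⟩
        ∑ⁿᵖ S (λ i _ → ∑ⁿᵖ l (λ a r → ⟦ a Fin.≟ h i ⟧ * rb r))
          ≡⟨ ∑ⁿᵖ-∑ⁿ S _ ⟩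
        ∑ⁿ S (λ i → ∑ⁿᵖ l (λ a r → ⟦ a Fin.≟ h i ⟧ * rb r))
          ≡⟨ ∑ⁿ-∑ⁿᵖ S l _ ⟩
        ∑ⁿᵖ l (λ a r → ∑ⁿ S (λ i → ⟦ a Fin.≟ h i ⟧ * rb r))
          ≡⟨ ∑ⁿᵖ-cong l (λ {a} {r} _ → ∑ⁿ-*ʳ S (rb r) _) ⟩
        ∑ⁿᵖ l (λ a r → count h S a * rb r)
          ≤⟨ ∑ⁿᵖ-mono l (λ {a} {r} _ → *-monoˡ-≤ (rb r) (S≤T a)) ⟩
        ∑ⁿᵖ l (λ a r → count h T a * rb r) ∎
        where
        open ≤-Reasoning
        rb : List (Fin b) → ℕ
        rb = rainbowⁿ (count h T) (count h V) t
        shrink : ∀ {S i S′} → Pick S i S′ → ∀ a → count h S′ a ≤ count h S a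
        shrink here      a = m≤n+m _ _
        shrink (there p) a = +-monoʳ-≤ _ (shrink p a)
        step : ∀ i S′ → Pick S i S′ → (d : Dec (∃ λ r → Pick l (h i) r)) →
          ∑ᵃ t S′ (λ is → ∑ⁿ (remaining′ d (Vec.map h is)) (count h V)) ≤ ∑ⁿᵖ l (λ a r → ⟦ a Fin.≟ h i ⟧ * rb r)
        step i S′ p (no _)        = ≤-trans (≤-reflexive (∑ᵃ-0 t S′)) z≤n
        step i S′ p (yes (r , q)) = begin
          ∑ᵃ t S′ (λ is → ∑ⁿ (remaining r (Vec.map h is)) (count h V))
            ≤⟨ arrangements-bound t S′ r (λ a → ≤-trans (shrink p a) (S≤T a)) ⟩
          rb r
            ≡⟨ *-identityˡ (rb r) ⟨
          1 * rb r
            ≤⟨ *-monoˡ-≤ (rb r) (1≤⟦ h i Fin.≟ h i ⟧ refl) ⟩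
          ⟦ h i Fin.≟ h i ⟧ * rb r
            ≤⟨ Pick⇒≤∑ⁿᵖ (λ a r → ⟦ a Fin.≟ h i ⟧ * rb r) q ⟩
          ∑ⁿᵖ l (λ a r → ⟦ a Fin.≟ h i ⟧ * rb r) ∎

    count-++ : ∀ h (S T : List I) a → count h (S ++ T) a ≡ count h S a + count h T a
    count-++ h []      T a = refl
    count-++ h (i ∷ S) T a = trans (cong (⟦ a Fin.≟ h i ⟧ +_) (count-++ h S T a)) (sym (+-assoc ⟦ a Fin.≟ h i ⟧ _ _))

    count-concat : ∀ h (Ts : List (List I)) a → count h (concat Ts) a ≡ ∑ⁿ Ts (λ T → count h T a)
    count-concat h []       a = refl
    count-concat h (T ∷ Ts) a = trans (count-++ h T (concat Ts) a) (cong (count h T a +_) (count-concat h Ts a))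

∑ⁿ-tabulate : ∀ {A B : Set} {n} (g : Fin n → A) (k : A → B) f → ∑ⁿ (List.tabulate (k ∘ g)) f ≡ ∑ⁿ (List.tabulate g) (f ∘ k)
∑ⁿ-tabulate {n = zero}  g k f = refl
∑ⁿ-tabulate {n = suc n} g k f = cong (f (k (g zero)) +_) (∑ⁿ-tabulate (g ∘ suc) k f)

∑⟦≟⟧ : ∀ {b} (c : Fin b) → ∑ⁿ (allFin b) (λ a → ⟦ a Fin.≟ c ⟧) ≡ 1
∑⟦≟⟧ {suc b} zero    = cong suc (trans (∑ⁿ-tabulate {A = Fin b} id Fin.suc (λ a → ⟦ a Fin.≟ zero ⟧)) (∑ⁿ-0 (allFin b)))
∑⟦≟⟧ {suc b} (suc c) = trans (∑ⁿ-tabulate {A = Fin b} id Fin.suc (λ a → ⟦ a Fin.≟ suc c ⟧)) (∑⟦≟⟧ c)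

∑-count : ∀ {b} {I : Set} (h : I → Fin b) T → ∑ⁿ (allFin b) (count h T) ≡ length T
∑-count {b} h T = begin
  ∑ⁿ (allFin b) (λ a → ∑ⁿ T (λ i → ⟦ a Fin.≟ h i ⟧))  ≡⟨ ∑ⁿ-swap (allFin b) T _ ⟩
  ∑ⁿ T (λ i → ∑ⁿ (allFin b) (λ a → ⟦ a Fin.≟ h i ⟧))  ≡⟨ ∑ⁿ-cong T (λ i → ∑⟦≟⟧ (h i)) ⟩
  ∑ⁿ T (λ _ → 1)                                      ≡⟨ ∑ⁿ-const T 1 ⟩
  length T * 1                                        ≡⟨ *-identityʳ (length T) ⟩
  length T                                            ∎
  where open ≡-Reasoning

-- From the hash property to a bound averaged over the chunks

module _ {A : Set} where

  Unique-resp-↭ : {xs ys : List A} → xs ↭ ys → Unique xs → Unique ys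
  Unique-resp-↭ p = ↭ₛ.Unique-resp-↭ (setoid A) (↭⇒↭ₛ p)

  Unique-++⁻ : ∀ (xs : List A) {ys} → Unique (xs ++ ys) →
    Unique xs × Unique ys × (∀ {x y} → x ∈ xs → y ∈ ys → x ≢ y)
  Unique-++⁻ []       u        = [] , u , λ ()
  Unique-++⁻ (x ∷ xs) (px ∷ u) with Unique-++⁻ xs u
  ... | uxs , uys , disjoint = All.tabulate (λ y∈ → All.lookup px (∈-++⁺ˡ y∈)) ∷ uxs , uys ,
    λ { (here refl) y∈ → All.lookup px (∈-++⁺ʳ xs y∈) ; (there x∈) y∈ → disjoint x∈ y∈ }

  concat-Pick : ∀ {Ts rest} {T : List A} → Pick Ts T rest → concat Ts ↭ T ++ concat rest
  concat-Pick here                                = ↭-refl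
  concat-Pick {T = T} (there {c = S} {r = rest} p) = ↭-trans (++⁺ˡ S (concat-Pick p)) (shifts S T)

  Pick-Unique : ∀ {l r} {a : A} → Pick l a r → Unique l → Unique r × All (a ≢_) r
  Pick-Unique here      (pa ∷ u) = u , pa
  Pick-Unique (there p) (pc ∷ u) with Pick-Unique p u | Pick-All p pc
    where
    Pick-All : ∀ {P : A → Set} {l r a} → Pick l a r → All P l → P a × All P r
    Pick-All here      (pa ∷ ps) = pa , ps
    Pick-All (there p) (pc ∷ ps) with Pick-All p ps
    ... | pa , pr = pa , pc ∷ pr
  ... | ur , pa | c≢a , pr = pr ∷ ur , (c≢a ∘ sym) ∷ pa

  Pick⇒∈ : ∀ {l r} {a : A} → Pick l a r → a ∈ l × (∀ {c} → c ∈ r → c ∈ l)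
  Pick⇒∈ here      = here refl , there
  Pick⇒∈ (there p) = there (proj₁ (Pick⇒∈ p)) , λ { (here refl) → here refl ; (there c∈) → there (proj₂ (Pick⇒∈ p) c∈) }

  Arrangement-∈ : ∀ {t T} {is : Vec A t} → Arrangement T is → ∀ k → Vec.lookup is k ∈ T
  Arrangement-∈ (p ∷ arr) zero    = proj₁ (Pick⇒∈ p)
  Arrangement-∈ (p ∷ arr) (suc k) = proj₂ (Pick⇒∈ p) (Arrangement-∈ arr k)

  Arrangement-Unique : ∀ {t T} {is : Vec A t} → Arrangement T is → Unique T → VecUnique.Unique is
  Arrangement-Unique []        u = VecAllPairs.[]
  Arrangement-Unique (p ∷ arr) u with Pick-Unique p u
  ... | ur , pa = VecAll.lookup⁻ (λ k → All.lookup pa (Arrangement-∈ arr k)) VecAllPairs.∷ Arrangement-Unique arr ur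

module _ {b : ℕ} where

  open import Data.List.Membership.DecPropositional (Fin._≟_ {b}) using (_∈?_)

  separated : ∀ {n} (R : Fin n → List (Fin b)) {v w : Vec (Fin b) n} i →
    Vec.lookup v i ∈ R i → Vec.lookup w i ∈ R i → Vec.lookup v i ≢ Vec.lookup w i → Separated (Vec.tabulate R) v w
  separated R {_ ∷ _} {_ ∷ _} zero    v∈ w∈ v≢w = inj₁ (v∈ , w∈ , v≢w)
  separated R {_ ∷ _} {_ ∷ _} (suc i) v∈ w∈ v≢w = inj₂ (separated (R ∘ suc) i v∈ w∈ v≢w)

  degree-tabulate : ∀ {n} (R : Fin n → List (Fin b)) v →
    degree (Vec.tabulate R) v ≡ ∑ⁿ (allFin n) (λ i → ⟦ Vec.lookup v i ∈? R i ⟧)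
  degree-tabulate R []      = refl
  degree-tabulate {suc n} R (c ∷ v) = cong (⟦ c ∈? R zero ⟧ +_) (trans (degree-tabulate (R ∘ suc) v)
    (sym (∑ⁿ-tabulate {A = Fin n} id Fin.suc (λ i → ⟦ Vec.lookup (c ∷ v) i ∈? R i ⟧))))

  ⟦∈?⟧≤ : ∀ {c} {R : List (Fin b)} (d : Dec (c ∈ R)) → ⟦ d ⟧ ≤ ∑ⁿ R (λ a → ⟦ a Fin.≟ c ⟧)
  ⟦∈?⟧≤ {c} (yes c∈R) = ≤-trans (1≤⟦ c Fin.≟ c ⟧ refl) (∈⇒≤∑ⁿ (λ a → ⟦ a Fin.≟ c ⟧) c∈R)
  ⟦∈?⟧≤     (no _)    = z≤n

∑ⁿ-map : ∀ {A B : Set} (g : A → B) l f → ∑ⁿ (List.map g l) f ≡ ∑ⁿ l (f ∘ g)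
∑ⁿ-map g []      f = refl
∑ⁿ-map g (a ∷ l) f = cong (f (g a) +_) (∑ⁿ-map g l f)

length-concat : ∀ {A : Set} {s} (Ts : List (List A)) → (∀ {T} → T ∈ Ts → length T ≡ s) → length (concat Ts) ≡ length Ts * s
length-concat []       h = refl
length-concat (T ∷ Ts) h = trans (List.length-++ T) (cong₂ _+_ (h (here refl)) (length-concat Ts (h ∘ there)))

letter : ∀ {b n M} → (Fin M → Vec (Fin b) n) → Fin n → Fin M → Fin b
letter c i x = Vec.lookup (c x) i

module _ {b t n M r : ℕ} .⦃ _ : NonZero r ⦄ (r+t≡b : r + t ≡ b)
  (c : Fin M → Vec (Fin b) n) (code : IsHashCode b (2 + t) n M c) where

  private
    R : Vec (Fin M) t → Fin n → List (Fin b)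
    R is i = remaining (allFin b) (Vec.map (letter c i) is)

  R-length : ∀ is → VecAll.All (λ R → R ≡ [] ⊎ length R ≡ r) (Vec.tabulate (R is))
  R-length is = VecAll.tabulate⁺ (λ i → size (remaining-length (allFin b) (Vec.map (letter c i) is)))
    where
    size : ∀ {l : List (Fin b)} → l ≡ [] ⊎ length l + t ≡ length (allFin b) → l ≡ [] ⊎ length l ≡ r
    size (inj₁ eq) = inj₁ eq
    size (inj₂ eq) = inj₂ (+-cancelʳ-≡ t _ r (trans eq (trans (List.length-tabulate (id {A = Fin b})) (sym r+t≡b))))

  -- Two words of `V` and the tuple `is` are `t + 2` distinct words. At the coordinate given by the
  -- hash property, the two letters differ from each other and from those of the tuple, so both lie
  -- in `R is i`.
  R-separated : ∀ {T V is} → Arrangement T is → Unique T → Unique V → (∀ {x v} → x ∈ T → v ∈ V → x ≢ v) →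
    AllPairs (Separated (Vec.tabulate (R is))) (List.map c V)
  R-separated {T} {V} {is} arr uT uV T≢V = AllPairs.map⁺ (pairs V uV id)
    where
    sep : ∀ {v w} → v ∈ V → w ∈ V → v ≢ w → Separated (Vec.tabulate (R is)) (c v) (c w)
    sep {v} {w} v∈ w∈ v≢w with proj₂ code (Vec.lookup (v ∷ w ∷ is)) (λ {i} {j} → VecUnique.lookup-injective unique i j)
      where
      unique : VecUnique.Unique (v ∷ w ∷ is)
      unique = (v≢w VecAll.∷ avoid v∈) VecAllPairs.∷ (avoid w∈ VecAllPairs.∷ Arrangement-Unique arr uT)
        where
        avoid : ∀ {v} → v ∈ V → VecAll.All (v ≢_) is
        avoid v∈ = VecAll.lookup⁻ (λ k eq → T≢V (Arrangement-∈ arr k) v∈ (sym eq))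
    ... | i , inj = separated (R is) i (in-R zero (λ ())) (in-R (suc zero) (λ ())) (λ eq → Fin.0≢1+n (inj {zero} {suc zero} eq))
      where
      lookup-letter : ∀ k → Vec.lookup (Vec.map (letter c i) is) k ≡ letter c i (Vec.lookup is k)
      lookup-letter k = Vec.lookup-map k (letter c i) is
      in-R : ∀ p → (∀ {k} → p ≢ suc (suc k)) → letter c i (Vec.lookup (v ∷ w ∷ is) p) ∈ R is i
      in-R p p≢ = ∈-remaining (allFin b) (Vec.map (letter c i) is)
        (λ k → ∈-allFin _)
        (λ {k} {k′} eq → Fin.suc-injective (Fin.suc-injective
          (inj {suc (suc k)} {suc (suc k′)} (trans (sym (lookup-letter k)) (trans eq (lookup-letter k′))))))
        (∈-allFin _)
        (λ k eq → p≢ (inj {p} {suc (suc k)} (trans eq (lookup-letter k))))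
    pairs : ∀ U → Unique U → (∀ {x} → x ∈ U → x ∈ V) → AllPairs (λ v w → Separated (Vec.tabulate (R is)) (c v) (c w)) U
    pairs []      []       U⊆V = []
    pairs (v ∷ U) (pv ∷ u) U⊆V =
      All.tabulate (λ w∈ → sep (U⊆V (here refl)) (U⊆V (there w∈)) (All.lookup pv w∈)) ∷ pairs U u (U⊆V ∘ there)

  module _ (Ts : List (List (Fin M))) (s : ℕ) (lengths : ∀ {T} → T ∈ Ts → length T ≡ s) (unique : Unique (concat Ts)) where

    private
      N = length Ts
      C = concat Ts
      -- The number of words outside one chunk.
      X = pred N * s

      -- Counts over all chunks, although only the words of the others extend the tuple: the second
      -- weight in `rainbowⁿ-bound` has to be the sum over the whole family.
      F : Vec (Fin M) t → ℕ
      F is = ∑ⁿ (allFin n) (λ i → ∑ⁿ (R is i) (count (letter c i) C))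

    Ψ : Fin n → List (Fin M) → ℕ
    Ψ i T = rainbowⁿ (count (letter c i) T) (count (letter c i) C) t (allFin b)

    private
      degree-F : ∀ {T rest} → Pick Ts T rest → ∀ is → ∑ⁿ (List.map c (concat rest)) (degree (Vec.tabulate (R is))) ≤ F is
      degree-F {T} {rest} p is = begin
        ∑ⁿ (List.map c V) (degree (Vec.tabulate (R is)))
          ≡⟨ ∑ⁿ-map c V _ ⟩
        ∑ⁿ V (λ v → degree (Vec.tabulate (R is)) (c v))
          ≤⟨ ∑ⁿ-mono V (λ {v} _ → ≤-trans (≤-reflexive (degree-tabulate (R is) (c v)))
               (∑ⁿ-mono (allFin n) (λ {i} _ → ⟦∈?⟧≤ (letter c i v ∈? R is i)))) ⟩
        ∑ⁿ V (λ v → ∑ⁿ (allFin n) (λ i → ∑ⁿ (R is i) (λ a → ⟦ a Fin.≟ letter c i v ⟧)))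
          ≡⟨ ∑ⁿ-swap V (allFin n) _ ⟩
        ∑ⁿ (allFin n) (λ i → ∑ⁿ V (λ v → ∑ⁿ (R is i) (λ a → ⟦ a Fin.≟ letter c i v ⟧)))
          ≡⟨ ∑ⁿ-cong (allFin n) (λ i → ∑ⁿ-swap V (R is i) _) ⟩
        ∑ⁿ (allFin n) (λ i → ∑ⁿ (R is i) (count (letter c i) V))
          ≤⟨ ∑ⁿ-mono (allFin n) (λ {i} _ → ∑ⁿ-mono (R is i) (λ {a} _ → count-rest i a)) ⟩
        F is ∎
        where
        open ≤-Reasoning
        open import Data.List.Membership.DecPropositional (Fin._≟_ {b}) using (_∈?_)
        V = concat rest
        ∑-Pick : ∀ {Ts rest} {T : List (Fin M)} (f : List (Fin M) → ℕ) → Pick Ts T rest → ∑ⁿ rest f ≤ ∑ⁿ Ts f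
        ∑-Pick f here      = m≤n+m _ _
        ∑-Pick f (there p) = +-monoʳ-≤ _ (∑-Pick f p)
        count-rest : ∀ i a → count (letter c i) V a ≤ count (letter c i) C a
        count-rest i a = subst₂ _≤_ (sym (count-concat (letter c i) rest a)) (sym (count-concat (letter c i) Ts a)) (∑-Pick _ p)

      arrangement-bound : ∀ {T rest} → Pick Ts T rest → ∀ {is} → Arrangement T is → X ^ X ≤ r ^ F is
      arrangement-bound {T} {rest} p {is} arr with Unique-++⁻ T (Unique-resp-↭ (concat-Pick p) unique)
      ... | uT , uV , T≢V = begin
        X ^ X                                        ≡⟨ cong (λ z → z ^ z) V-length ⟨
        length V ^ length V                          ≤⟨ hansel r (Vec.tabulate (R is)) (R-length is) V (R-separated arr uT uV T≢V) ⟩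
        r ^ ∑ⁿ V (degree (Vec.tabulate (R is)))      ≤⟨ ^-monoʳ-≤ r (degree-F p is) ⟩
        r ^ F is                                     ∎
        where
        open ≤-Reasoning
        V = List.map c (concat rest)
        V-length : length V ≡ X
        V-length = trans (List.length-map c (concat rest))
          (trans (length-concat rest (λ S∈ → lengths (proj₂ (Pick⇒∈ p) S∈))) (cong (λ z → pred z * s) (sym (Pick-length p))))

    -- The product of `arrangement-bound` over the `N * fallⁿ s t` tuples that lie within one chunk.
    code-bound : X ^ (N * (fallⁿ s t * X)) ≤ r ^ ∑ⁿ (allFin n) (λ i → ∑ⁿ Ts (Ψ i))
    code-bound = begin
      X ^ (N * (fallⁿ s t * X))
        ≡⟨ cong (X ^_) (trans (∑ⁿᵖ-∑ⁿ Ts _) (∑ⁿ-const Ts (fallⁿ s t * X))) ⟨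
      X ^ ∑ⁿᵖ Ts (λ _ _ → fallⁿ s t * X)
        ≤⟨ ^-∑ⁿᵖ Ts member ⟩
      r ^ ∑ⁿᵖ Ts (λ T _ → ∑ⁿ (allFin n) (λ i → Ψ i T))
        ≡⟨ cong (r ^_) (trans (∑ⁿᵖ-∑ⁿ Ts _) (∑ⁿ-swap Ts (allFin n) _)) ⟩
      r ^ ∑ⁿ (allFin n) (λ i → ∑ⁿ Ts (Ψ i)) ∎
      where
      open ≤-Reasoning
      member : ∀ {T rest} → Pick Ts T rest → X ^ (fallⁿ s t * X) ≤ r ^ ∑ⁿ (allFin n) (λ i → Ψ i T)
      member {T} {rest} p = begin
        X ^ (fallⁿ s t * X)
          ≡⟨ cong (λ z → X ^ (fallⁿ z t * X)) (lengths (proj₁ (Pick⇒∈ p))) ⟨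
        X ^ (fallⁿ (length T) t * X)
          ≡⟨ cong (X ^_) (∑ᵃ-const t T X) ⟨
        X ^ ∑ᵃ t T (λ _ → X)
          ≤⟨ ^-∑ᵃ t T (arrangement-bound p) ⟩
        r ^ ∑ᵃ t T F
          ≡⟨ cong (r ^_) (∑ⁿ-∑ᵃ (allFin n) t T _) ⟩
        r ^ ∑ⁿ (allFin n) (λ i → ∑ᵃ t T (λ is → ∑ⁿ (R is i) (count (letter c i) C)))
          ≤⟨ ^-monoʳ-≤ r (∑ⁿ-mono (allFin n) (λ {i} _ →
               arrangements-bound (letter c i) T C t T (allFin b) (λ _ → ≤-refl))) ⟩
        r ^ ∑ⁿ (allFin n) (λ i → Ψ i T) ∎

-- Chunks

support : {A : Set} → (A → ℕ) → List A → ℕ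
support x l = ∑ⁿ l (λ a → x a ⊓ 1)

module _ {A : Set} where

  ∑ⁿ-Pick : ∀ {l r} {a : A} f → Pick l a r → ∑ⁿ l f ≡ f a + ∑ⁿ r f
  ∑ⁿ-Pick f here = refl
  ∑ⁿ-Pick {a = a} f (there {c = c} {r = r} p) = trans (cong (f c +_) (∑ⁿ-Pick f p)) (lem (f c) (f a) (∑ⁿ r f))
    where
    lem : ∀ u v w → u + (v + w) ≡ v + (u + w)
    lem = solve-∀

  ∑ⁿ-↭ : ∀ {k l : List A} f → k ↭ l → ∑ⁿ k f ≡ ∑ⁿ l f
  ∑ⁿ-↭ f ↭.refl         = refl
  ∑ⁿ-↭ f (↭.prep a p)   = cong (f a +_) (∑ⁿ-↭ f p)
  ∑ⁿ-↭ f (↭.swap a c p) = trans (cong (λ z → f a + (f c + z)) (∑ⁿ-↭ f p)) (lem (f a) (f c) _)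
    where
    lem : ∀ u v w → u + (v + w) ≡ v + (u + w)
    lem = solve-∀
  ∑ⁿ-↭ f (↭.trans p q)  = trans (∑ⁿ-↭ f p) (∑ⁿ-↭ f q)

  ∑ⁿ-mono-< : ∀ {l : List A} {a f g} → (∀ c → f c ≤ g c) → a ∈ l → f a < g a → ∑ⁿ l f < ∑ⁿ l g
  ∑ⁿ-mono-< {_ ∷ l} f≤g (here refl) fa<ga = +-mono-<-≤ fa<ga (∑ⁿ-mono l (λ _ → f≤g _))
  ∑ⁿ-mono-< {c ∷ l} f≤g (there a∈l) fa<ga = +-mono-≤-< (f≤g c) (∑ⁿ-mono-< f≤g a∈l fa<ga)

  length-↭-++ : ∀ {L : List A} L₁ {L₀} → L ↭ L₁ ++ L₀ → length L ≡ length L₁ + length L₀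
  length-↭-++ L₁ p = trans (↭-length p) (List.length-++ L₁)

  -- Each nonzero factor `x a` uses up one letter of the support, which is exhausted before `t` of
  -- them are chosen. This is why the first `ℓ` coordinates contribute nothing.
  rainbow-vanishes : ∀ (x y : A → ℕ) t l → support x l < t → rainbowⁿ x y t l ≡ 0
  rainbow-vanishes x y (suc t) l (s≤s supp≤t) = trans (∑ⁿᵖ-cong l term) (∑ⁿᵖ-0 l)
    where
    term : ∀ {a r} → Pick l a r → x a * rainbowⁿ x y t r ≡ 0
    term {a} {r} p with x a in eq
    ... | zero  = refl
    ... | suc k = trans (cong (suc k *_) (rainbow-vanishes x y t r smaller)) (*-zeroʳ (suc k))
      where
      smaller : support x r < t
      smaller = ≤-trans (≤-reflexive (sym (trans (∑ⁿ-Pick (λ a → x a ⊓ 1) p)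
        (cong (_+ support x r) (trans (cong (_⊓ 1) eq) (cong suc (⊓-zeroʳ k))))))) supp≤t

  -- Otherwise `z * x a` is at least `suc m` for each of the `z` occurring letters, and summation
  -- gives `z * m ≥ z * suc m`.
  light : ∀ (x : A → ℕ) l → 1 ≤ support x l → ∃ λ a → a ∈ l × 1 ≤ x a × support x l * x a ≤ ∑ⁿ l x
  light x l 1≤z with any? (λ a → (1 ≤? x a) ×-dec (z * x a ≤? m)) l
    where
    z = support x l
    m = ∑ⁿ l x
  ... | yes w = find w
  ... | no ¬w = ⊥-elim (n≮n (z * m) (begin-strict
    z * m                           <⟨ m<n+m (z * m) 1≤z ⟩
    z + z * m                       ≡⟨ *-suc z m ⟨
    z * suc m                       ≡⟨ *-comm z (suc m) ⟩
    suc m * z                       ≡⟨ ∑ⁿ-* l (suc m) _ ⟨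
    ∑ⁿ l (λ a → suc m * (x a ⊓ 1))  ≤⟨ ∑ⁿ-mono l heavy ⟩
    ∑ⁿ l (λ a → z * x a)            ≡⟨ ∑ⁿ-* l z x ⟩
    z * m                           ∎))
    where
    open ≤-Reasoning
    z = support x l
    m = ∑ⁿ l x
    heavy : ∀ {a} → a ∈ l → suc m * (x a ⊓ 1) ≤ z * x a
    heavy {a} a∈l with 1 ≤? x a
    ... | no ¬p  = ≤-trans (≤-reflexive (trans (cong (λ q → suc m * (q ⊓ 1)) (n<1⇒n≡0 (≰⇒> ¬p))) (*-zeroʳ (suc m)))) z≤n
    ... | yes p  = ≤-trans (*-monoʳ-≤ (suc m) (m⊓n≤n (x a) 1)) (≤-trans (≤-reflexive (*-identityʳ (suc m)))
                     (≰⇒> (λ q → ¬w (lose a∈l (p , q)))))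

module _ {b : ℕ} {I : Set} where

  drop-letter : ∀ (h : I → Fin b) a L →
    ∃₂ λ L₁ L₀ → L ↭ L₁ ++ L₀ × count h L₁ a ≡ 0 × length L₀ ≡ count h L a
  drop-letter h a []      = [] , [] , ↭-refl , refl , refl
  drop-letter h a (i ∷ L) with drop-letter h a L | a Fin.≟ h i in eq
  ... | L₁ , L₀ , p , z , len | yes _ = L₁ , i ∷ L₀ , ↭-trans (↭-prep i p) (↭-sym (shift i L₁ L₀)) , z , cong suc len
  ... | L₁ , L₀ , p , z , len | no _  = i ∷ L₁ , L₀ , ↭-prep i p ,
    trans (cong (λ d → ⟦ d ⟧ + count h L₁ a) eq) z , len

  count-↭ : ∀ (h : I → Fin b) {L} L₁ {L₀} → L ↭ L₁ ++ L₀ → ∀ a → count h L₁ a ≤ count h L a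
  count-↭ h L₁ {L₀} p a = ≤-trans (m≤m+n (count h L₁ a) (count h L₀ a))
    (≤-reflexive (sym (trans (∑ⁿ-↭ _ p) (count-++ h L₁ L₀ a))))

  letters : (I → Fin b) → List I → ℕ
  letters h L = support (count h L) (allFin b)

  letters-↭ : ∀ (h : I → Fin b) {L} L₁ {L₀} → L ↭ L₁ ++ L₀ → letters h L₁ ≤ letters h L
  letters-↭ h L₁ p = ∑ⁿ-mono (allFin b) (λ {a} _ → ⊓-monoˡ-≤ 1 (count-↭ h L₁ p a))

  -- Discarding the rarest of z letters keeps at least the fraction (z - 1) / z of the words.
  thin : ∀ (h : I → Fin b) w .⦃ _ : NonZero w ⦄ d L → letters h L ≤ w + d →
    ∃₂ λ L₁ L₀ → L ↭ L₁ ++ L₀ × letters h L₁ ≤ w × w * length L ≤ (w + d) * length L₁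
  thin h w zero    L few = L , [] , ↭-reflexive (sym (List.++-identityʳ L)) , ≤-trans few (≤-reflexive (+-identityʳ w)) ,
    ≤-reflexive (cong (_* length L) (sym (+-identityʳ w)))
  thin h w (suc d) L few with letters h L ≤? w + d
  ... | yes fewer with thin h w d L fewer
  ...   | L₁ , L₀ , p , ok , size = L₁ , L₀ , p , ok ,
          ≤-trans size (*-monoˡ-≤ (length L₁) (+-monoʳ-≤ w (n≤1+n d)))
  thin h w@(suc _) (suc d) L few | no more with light (count h L) (allFin b) (≤-trans (s≤s z≤n) (≰⇒> more))
  ... | a , a∈ , 1≤a , rare with drop-letter h a L
  ... | L₁ , L₀ , p , absent , len with thin h w d L₁ fewer
    where
    fewer : letters h L₁ ≤ w + d
    fewer = s≤s⁻¹ (≤-trans (∑ⁿ-mono-< (λ c → ⊓-monoˡ-≤ 1 (count-↭ h L₁ p c)) a∈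
      (subst (λ z → z ⊓ 1 < count h L a ⊓ 1) (sym absent) (⊓-monoˡ-≤ 1 1≤a))) (≤-trans few (≤-reflexive (+-suc w d))))
  ... | L₂ , R , q , ok , size = L₂ , R ++ L₀ ,
    ↭-trans p (↭-trans (++⁺ʳ L₀ q) (↭-reflexive (List.++-assoc L₂ R L₀))) , ok ,
    -- The kept fractions telescope: `(w + d) / (w + suc d)` from this letter and `w / (w + d)` from
    -- the recursive call.
    *-cancelˡ-≤ (w + d) (begin
      (w + d) * (w * length L)                 ≡⟨ e₁ w d (length L) ⟩
      w * ((w + d) * length L)                 ≤⟨ *-monoʳ-≤ w kept ⟩
      w * ((w + suc d) * length L₁)            ≡⟨ e₂ w (w + suc d) (length L₁) ⟩
      (w + suc d) * (w * length L₁)            ≤⟨ *-monoʳ-≤ (w + suc d) size ⟩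
      (w + suc d) * ((w + d) * length L₂)      ≡⟨ e₂ (w + suc d) (w + d) (length L₂) ⟩
      (w + d) * ((w + suc d) * length L₂)      ∎)
    where
    open ≤-Reasoning
    e₁ : ∀ w d l → (w + d) * (w * l) ≡ w * ((w + d) * l)
    e₁ = solve-∀
    e₂ : ∀ u v l → u * (v * l) ≡ v * (u * l)
    e₂ = solve-∀
    e₃ : ∀ w d l → (w + d) * l + l ≡ (w + (1 + d)) * l
    e₃ = solve-∀
    z≡ : letters h L ≡ w + suc d
    z≡ = ≤-antisym few (≤-trans (≤-reflexive (+-suc w d)) (≰⇒> more))
    kept : (w + d) * length L ≤ (w + suc d) * length L₁
    kept = +-cancelʳ-≤ (length L) _ _ (begin
      (w + d) * length L + length L                        ≡⟨ e₃ w d (length L) ⟩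
      (w + suc d) * length L                               ≡⟨ cong ((w + suc d) *_) (trans (length-↭-++ L₁ p) (cong (length L₁ +_) len)) ⟩
      (w + suc d) * (length L₁ + count h L a)              ≡⟨ *-distribˡ-+ (w + suc d) (length L₁) _ ⟩
      (w + suc d) * length L₁ + (w + suc d) * count h L a  ≤⟨ +-monoʳ-≤ _ (subst₂ (λ z m → z * count h L a ≤ m) z≡ (∑-count h L) rare) ⟩
      (w + suc d) * length L₁ + length L                   ∎)

  letters≤b : ∀ (h : I → Fin b) L → letters h L ≤ b
  letters≤b h L = ≤-trans (∑ⁿ-mono (allFin b) (λ {a} _ → m⊓n≤n (count h L a) 1)) (≤-reflexive
    (trans (∑ⁿ-const (allFin b) 1) (trans (*-identityʳ _) (List.length-tabulate (id {A = Fin b})))))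

  module _ {n : ℕ} (h : Fin n → I → Fin b) (w : ℕ) .⦃ _ : NonZero w ⦄ (w≤b : w ≤ b) where

    thin-all : ∀ J L → ∃₂ λ L₁ L₀ → L ↭ L₁ ++ L₀ × (∀ {i} → i ∈ J → letters (h i) L₁ ≤ w) ×
      w ^ length J * length L ≤ b ^ length J * length L₁
    thin-all []      L = L , [] , ↭-reflexive (sym (List.++-identityʳ L)) , (λ ()) , ≤-refl
    thin-all (i ∷ J) L with thin-all J L
    ... | L₁ , L₀ , p , ok , size with thin (h i) w (b ∸ w) L₁ (≤-trans (letters≤b (h i) L₁) (≤-reflexive (sym (m+[n∸m]≡n w≤b))))
    ... | L₂ , R , q , ok₂ , size₂ = L₂ , R ++ L₀ ,
      ↭-trans p (↭-trans (++⁺ʳ L₀ q) (↭-reflexive (List.++-assoc L₂ R L₀))) ,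
      (λ { (here refl) → ok₂ ; (there {x = _} i∈J) → ≤-trans (letters-↭ (h _) L₂ q) (ok i∈J) }) ,
      (begin
        w * w ^ length J * length L          ≡⟨ *-assoc w (w ^ length J) (length L) ⟩
        w * (w ^ length J * length L)        ≤⟨ *-monoʳ-≤ w size ⟩
        w * (b ^ length J * length L₁)       ≡⟨ e₂ w (b ^ length J) (length L₁) ⟩
        b ^ length J * (w * length L₁)       ≤⟨ *-monoʳ-≤ (b ^ length J) (subst (λ z → w * length L₁ ≤ z * length L₂) (m+[n∸m]≡n w≤b) size₂) ⟩
        b ^ length J * (b * length L₂)       ≡⟨ e₃ (b ^ length J) b (length L₂) ⟩
        b * b ^ length J * length L₂         ∎)
      where
      open ≤-Reasoning
      e₂ : ∀ u v l → u * (v * l) ≡ v * (u * l)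
      e₂ = solve-∀
      e₃ : ∀ u v l → u * (v * l) ≡ v * u * l
      e₃ = solve-∀

    private
      b^≢0 : ∀ m → NonZero (b ^ m)
      b^≢0 m = m^n≢0 b m ⦃ >-nonZero (≤-trans (>-nonZero⁻¹ w) w≤b) ⦄

      enough : ∀ m s {L L₁} → s * b ^ m ≤ w ^ m * L → w ^ m * L ≤ b ^ m * L₁ → s ≤ L₁
      enough m s big size = *-cancelˡ-≤ (b ^ m) ⦃ b^≢0 m ⦄
        (≤-trans (≤-reflexive (*-comm (b ^ m) s)) (≤-trans big size))

    -- Greedy: while `L` is so long that `thin-all` must leave `s` words, `s` of these become a
    -- chunk and all other words, also those discarded by `thin-all`, return to the pool. The pool
    -- shrinks by `s` each time, so its length serves as fuel.
    chunks : ∀ J s .⦃ _ : NonZero s ⦄ fuel L → length L ≤ fuel → ∃₂ λ Ts rest → L ↭ concat Ts ++ rest ×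
      (∀ {T} → T ∈ Ts → length T ≡ s × (∀ {i} → i ∈ J → letters (h i) T ≤ w)) ×
      w ^ length J * length rest < s * b ^ length J
    chunks J s fuel L L≤ with w ^ length J * length L <? s * b ^ length J
    ... | yes small = [] , L , ↭-refl , (λ ()) , small
    chunks J s@(suc _) zero [] L≤ | no big = ⊥-elim (big (subst (_< s * b ^ length J) (sym (*-zeroʳ (w ^ length J)))
      (>-nonZero⁻¹ (s * b ^ length J) ⦃ m*n≢0 s (b ^ length J) ⦃ _ ⦄ ⦃ b^≢0 (length J) ⦄ ⦄)))
    chunks J s@(suc s′) (suc fuel) L L≤ | no big with thin-all J L
    ... | L₁ , L₀ , p , ok , size with chunks J s fuel (drop s L₁ ++ L₀) shorter
      where
      shorter : length (drop s L₁ ++ L₀) ≤ fuel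
      shorter = s≤s⁻¹ (begin-strict
        length (drop s L₁ ++ L₀)                       ≡⟨ List.length-++ (drop s L₁) ⟩
        length (drop s L₁) + length L₀                 ≡⟨ cong (_+ length L₀) (List.length-drop s L₁) ⟩
        (length L₁ ∸ s) + length L₀                    <⟨ +-monoˡ-< (length L₀) (∸-monoʳ-< {length L₁} {s} {0} (s≤s z≤n) (enough (length J) s (≮⇒≥ big) size)) ⟩
        length L₁ + length L₀                          ≡⟨ length-↭-++ L₁ p ⟨
        length L                                       ≤⟨ L≤ ⟩
        suc fuel                                       ∎)
        where
        open ≤-Reasoning
    ... | Ts , rest , q , good , small = take s L₁ ∷ Ts , rest ,
      ↭-trans p (↭-trans (↭-reflexive (trans (cong (_++ L₀) (sym (List.take++drop≡id s L₁))) (List.++-assoc (take s L₁) _ _)))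
        (↭-trans (++⁺ˡ (take s L₁) q) (↭-reflexive (sym (List.++-assoc (take s L₁) _ _))))) ,
      (λ { (here refl) → taken , (λ i∈J → ≤-trans (letters-↭ (h _) (take s L₁) (↭-reflexive (sym (List.take++drop≡id s L₁)))) (ok i∈J))
         ; (there T∈) → good T∈ }) , small
      where
      taken : length (take s L₁) ≡ s
      taken = trans (List.length-take s L₁) (m≤n⇒m⊓n≡m (enough (length J) s (≮⇒≥ big) size))

-- Asymptotics

^-cancelˡ-≤ : ∀ e .⦃ _ : NonZero e ⦄ x a y c → x ^ (e * a) ≤ y ^ (e * c) → x ^ a ≤ y ^ c
^-cancelˡ-≤ e x a y c h = ≮⇒≥ λ y^c<x^a → <⇒≱ (^-monoˡ-< e y^c<x^a) (subst₂ _≤_ (split x a) (split y c) h)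
  where
  split : ∀ x a → x ^ (e * a) ≡ (x ^ a) ^ e
  split x a = trans (cong (x ^_) (*-comm e a)) (sym (^-*-assoc x a e))

n≤2^n : ∀ n → n ≤ 2 ^ n
n≤2^n zero    = z≤n
n≤2^n (suc n) = ≤-trans (+-mono-≤ (m^n>0 2 n) (n≤2^n n)) (≤-reflexive (cong (2 ^ n +_) (sym (+-identityʳ (2 ^ n)))))

^≤fallⁿ : ∀ u t → u ^ t ≤ fallⁿ (u + t) t
^≤fallⁿ u zero    = ≤-refl
^≤fallⁿ u (suc t) = subst (λ z → u * u ^ t ≤ fallⁿ z (suc t)) (sym (+-suc u t))
  (*-mono-≤ (≤-trans (m≤m+n u t) (n≤1+n (u + t))) (^≤fallⁿ u t))

-- `fallⁿ s t` is at least `(s - t)^t`, which by `bernoulli` is at least `s^t - t² s^(t-1)`. The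
-- relative loss `t² / s` is `1 / (g + 1)`; this dictates the size of the chunks.
fallⁿ-lower : ∀ g k → let t = suc k; s = suc g * (t * t) in g * s ^ t ≤ suc g * fallⁿ s t
fallⁿ-lower g k = ≤-trans (+-cancelʳ-≤ (y * y ^ k) _ _ (begin
    g * (y * y ^ k) + y * y ^ k                ≡⟨ +-comm (g * (y * y ^ k)) _ ⟩
    suc g * (y * y ^ k)                        ≤⟨ *-monoʳ-≤ (suc g) power ⟩
    suc g * (u ^ t + t * t * y ^ k)            ≡⟨ e₁ (suc g) (u ^ t) t (y ^ k) ⟩
    suc g * u ^ t + suc g * (t * t) * y ^ k    ∎))
  (*-monoʳ-≤ (suc g) (subst (λ z → u ^ t ≤ fallⁿ z t) u+t≡y (^≤fallⁿ u t)))
  where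
  open ≤-Reasoning
  t = suc k
  y = suc g * (t * t)
  u = y ∸ t
  t≤y : t ≤ y
  t≤y = ≤-trans (m≤m*n t t) (m≤m+n (t * t) (g * (t * t)))
  u+t≡y : u + t ≡ y
  u+t≡y = m∸n+n≡m t≤y
  e₁ : ∀ h v t z → h * (v + t * t * z) ≡ h * v + h * (t * t) * z
  e₁ = solve-∀
  e₂ : ∀ k u t z → (u + t) * z + k * ((u + t) * z) ≡ (1 + k) * (u * z) + (1 + k) * t * z
  e₂ = solve-∀
  e₃ : ∀ a b c → a + b + c ≡ a + c + b
  e₃ = solve-∀
  power : y * y ^ k ≤ u ^ t + t * t * y ^ k
  power = +-cancelʳ-≤ (k * (y * y ^ k)) _ _ (begin
    y * y ^ k + k * (y * y ^ k)                     ≡⟨ cong (λ z → z * y ^ k + k * (z * y ^ k)) u+t≡y ⟨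
    (u + t) * y ^ k + k * ((u + t) * y ^ k)         ≡⟨ e₂ k u t (y ^ k) ⟩
    t * (u * y ^ k) + t * t * y ^ k                 ≤⟨ +-monoˡ-≤ (t * t * y ^ k) (bernoulli k u y) ⟩
    u ^ t + k * y ^ t + t * t * y ^ k               ≡⟨ e₃ (u ^ t) (k * y ^ t) (t * t * y ^ k) ⟩
    u ^ t + t * t * y ^ k + k * (y * y ^ k)         ∎)

∑ⁿ-++ : ∀ {A : Set} (k l : List A) f → ∑ⁿ (k ++ l) f ≡ ∑ⁿ k f + ∑ⁿ l f
∑ⁿ-++ []      l f = refl
∑ⁿ-++ (a ∷ k) l f = trans (cong (f a +_) (∑ⁿ-++ k l f)) (sym (+-assoc (f a) _ _))

search : ∀ {P : ℕ → Set} → (∀ i → Dec (P i)) → P 0 → ∀ n → P n ⊎ ∃ λ i → i ≤ n × P i × ¬ P (suc i)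
search P? P0 zero    = inj₁ P0
search P? P0 (suc n) with search P? P0 n
... | inj₂ (i , i≤n , yes-i , no-i) = inj₂ (i , m≤n⇒m≤1+n i≤n , yes-i , no-i)
... | inj₁ Pn with P? (suc n)
...   | yes Psn = inj₁ Psn
...   | no ¬Psn = inj₂ (n , n≤1+n n , Pn , ¬Psn)

-- The parameters stand for b, w = t - 1, r = b - t, P = bᵗ⁺¹ and F = b (b - 1) ⋯ (b - t); A and G are chosen so
-- that G / A is the claimed rate, and f, h with f / h → 1 absorb the losses that vanish in the limit.
module Asymptotics (b w r P F p q D B D′ B′ : ℕ) .⦃ _ : NonZero w ⦄ .⦃ _ : NonZero q ⦄
  (log-b/w : b ^ D ≤ w ^ D * 2 ^ B) (log-r : r ^ D′ ≤ 2 ^ B′)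
  (1≤A : 1 ≤ D * B′ * F + P * D′ * B) (rate : q * (B′ * B * F) ≤ p * (D * B′ * F + P * D′ * B))
  (m f h s : ℕ) (f≡1+2pm : f ≡ 1 + 2 * (p * m)) (h≡2+f : h ≡ 2 + f) where

  private
    A G λ₀ E : ℕ
    A  = D * B′ * F + P * D′ * B
    G  = B′ * B * F
    λ₀ = 2 * s
    E  = f * P * D′

    f≢0 : NonZero f
    f≢0 = subst NonZero (sym f≡1+2pm) _

    h≢0 : NonZero h
    h≢0 = subst NonZero (sym h≡2+f) _

  K : ℕ
  K = h * B′ * F * (D * λ₀ + B) + B * (2 * E)

  -- The hypothesis says that the code is too small for a prefix of `suc ℓ` coordinates. The crude
  -- bound `2 * s ≤ 2 ^ λ₀` only affects the constant `K`.
  log-prefix : ∀ {M} ℓ → M * w ^ suc ℓ ≤ 2 * s * b ^ suc ℓ → M ^ D ≤ 2 ^ (D * λ₀ + B * suc ℓ)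
  log-prefix {M} ℓ short = *-cancelʳ-≤ (M ^ D) (2 ^ (D * λ₀ + B * suc ℓ)) ((w ^ D) ^ suc ℓ)
    ⦃ m^n≢0 (w ^ D) (suc ℓ) ⦃ m^n≢0 w D ⦄ ⦄ (begin
    M ^ D * (w ^ D) ^ suc ℓ                              ≡⟨ cong (M ^ D *_) (^-swap w D (suc ℓ)) ⟩
    M ^ D * (w ^ suc ℓ) ^ D                              ≡⟨ ^-distribʳ-* D M (w ^ suc ℓ) ⟨
    (M * w ^ suc ℓ) ^ D                                  ≤⟨ ^-monoˡ-≤ D short ⟩
    (2 * s * b ^ suc ℓ) ^ D                              ≡⟨ ^-distribʳ-* D (2 * s) (b ^ suc ℓ) ⟩
    (2 * s) ^ D * (b ^ suc ℓ) ^ D                        ≡⟨ cong ((2 * s) ^ D *_) (^-swap b (suc ℓ) D) ⟩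
    (2 * s) ^ D * (b ^ D) ^ suc ℓ                        ≤⟨ *-mono-≤ (^-monoˡ-≤ D (n≤2^n λ₀)) (^-monoˡ-≤ (suc ℓ) log-b/w) ⟩
    (2 ^ λ₀) ^ D * (w ^ D * 2 ^ B) ^ suc ℓ               ≡⟨ cong₂ _*_ (trans (^-*-assoc 2 λ₀ D) (cong (2 ^_) (*-comm λ₀ D)))
                                                              (trans (^-distribʳ-* (suc ℓ) (w ^ D) (2 ^ B)) (cong ((w ^ D) ^ suc ℓ *_) (^-*-assoc 2 B (suc ℓ)))) ⟩
    2 ^ (D * λ₀) * ((w ^ D) ^ suc ℓ * 2 ^ (B * suc ℓ))   ≡⟨ e₁ (2 ^ (D * λ₀)) ((w ^ D) ^ suc ℓ) (2 ^ (B * suc ℓ)) ⟩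
    2 ^ (D * λ₀) * 2 ^ (B * suc ℓ) * (w ^ D) ^ suc ℓ     ≡⟨ cong (_* (w ^ D) ^ suc ℓ) (^-distribˡ-+-* 2 (D * λ₀) (B * suc ℓ)) ⟨
    2 ^ (D * λ₀ + B * suc ℓ) * (w ^ D) ^ suc ℓ           ∎)
    where
    open ≤-Reasoning
    ^-swap : ∀ x u v → (x ^ u) ^ v ≡ (x ^ v) ^ u
    ^-swap x u v = trans (^-*-assoc x u v) (trans (cong (x ^_) (*-comm u v)) (sym (^-*-assoc x v u)))
    e₁ : ∀ x y z → x * (y * z) ≡ x * z * y
    e₁ = solve-∀

  log-suffix : ∀ {M X} d → M ≤ 4 * X → X ^ (f * P) ≤ r ^ (h * (d * F)) →
    M ^ E ≤ 2 ^ (2 * E + h * B′ * F * d)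
  log-suffix {M} {X} d M≤4X bound = begin
    M ^ E                                                  ≤⟨ ^-monoˡ-≤ E M≤4X ⟩
    (4 * X) ^ E                                            ≡⟨ ^-distribʳ-* E 4 X ⟩
    4 ^ E * X ^ E                                          ≡⟨ cong₂ _*_ (^-*-assoc 2 2 E) (sym (^-*-assoc X (f * P) D′)) ⟩
    2 ^ (2 * E) * (X ^ (f * P)) ^ D′               ≤⟨ *-monoʳ-≤ (2 ^ (2 * E)) (^-monoˡ-≤ D′ bound) ⟩
    2 ^ (2 * E) * (r ^ (h * (d * F))) ^ D′         ≡⟨ cong (2 ^ (2 * E) *_) (trans (^-*-assoc r (h * (d * F)) D′)
                                                                (trans (cong (r ^_) (*-comm (h * (d * F)) D′)) (sym (^-*-assoc r D′ (h * (d * F)))))) ⟩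
    2 ^ (2 * E) * (r ^ D′) ^ (h * (d * F))         ≤⟨ *-monoʳ-≤ (2 ^ (2 * E)) (^-monoˡ-≤ (h * (d * F)) log-r) ⟩
    2 ^ (2 * E) * (2 ^ B′) ^ (h * (d * F))         ≡⟨ cong (2 ^ (2 * E) *_) (^-*-assoc 2 B′ (h * (d * F))) ⟩
    2 ^ (2 * E) * 2 ^ (B′ * (h * (d * F)))         ≡⟨ cong (λ z → 2 ^ (2 * E) * 2 ^ z) (e₁ B′ h d F) ⟩
    2 ^ (2 * E) * 2 ^ (h * B′ * F * d)             ≡⟨ ^-distribˡ-+-* 2 (2 * E) (h * B′ * F * d) ⟨
    2 ^ (2 * E + h * B′ * F * d)                   ∎
    where
    open ≤-Reasoning
    e₁ : ∀ B h d F → B * (h * (d * F)) ≡ h * B * F * d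
    e₁ = solve-∀

  -- With the exponents `u` and `B` for the two bounds, `ℓ` and `d` get the same coefficient
  -- `B * u`, so only `ℓ + d` survives. `K` collects what does not grow with it.
  combine : ∀ {M} .⦃ _ : NonZero M ⦄ ℓ d → M ^ D ≤ 2 ^ (D * λ₀ + B * suc ℓ) →
    M ^ E ≤ 2 ^ (2 * E + h * B′ * F * d) → M ^ (f * A) ≤ 2 ^ (K + h * G * (ℓ + d))
  combine {M} ℓ d pre suf = begin
    M ^ (f * A)
      ≤⟨ ^-monoʳ-≤ M fA≤ ⟩
    M ^ (D * u + E * B)
      ≡⟨ trans (^-distribˡ-+-* M (D * u) (E * B)) (cong₂ _*_ (sym (^-*-assoc M D u)) (sym (^-*-assoc M E B))) ⟩
    (M ^ D) ^ u * (M ^ E) ^ B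
      ≤⟨ *-mono-≤ (^-monoˡ-≤ u pre) (^-monoˡ-≤ B suf) ⟩
    (2 ^ (D * λ₀ + B * suc ℓ)) ^ u * (2 ^ (2 * E + u * d)) ^ B
      ≡⟨ trans (cong₂ _*_ (^-*-assoc 2 (D * λ₀ + B * suc ℓ) u) (^-*-assoc 2 (2 * E + u * d) B))
           (sym (^-distribˡ-+-* 2 ((D * λ₀ + B * suc ℓ) * u) ((2 * E + u * d) * B))) ⟩
    2 ^ ((D * λ₀ + B * suc ℓ) * u + (2 * E + u * d) * B)
      ≡⟨ cong (2 ^_) (e₂ (D * λ₀) B ℓ u (2 * E) d) ⟩
    2 ^ (K + B * u * (ℓ + d))
      ≡⟨ cong (λ z → 2 ^ (K + z)) (e₃ B h B′ F (ℓ + d)) ⟩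
    2 ^ (K + h * G * (ℓ + d)) ∎
    where
    open ≤-Reasoning
    u = h * B′ * F
    e₁ : ∀ f D B′ F P D′ B → f * (D * B′ * F + P * D′ * B) + 2 * (D * B′ * F) ≡ D * ((2 + f) * B′ * F) + f * P * D′ * B
    e₁ = solve-∀
    fA≤ : f * A ≤ D * u + E * B
    fA≤ = ≤-trans (m≤m+n (f * A) (2 * (D * B′ * F))) (≤-reflexive (trans (e₁ f D B′ F P D′ B)
      (cong (λ z → D * (z * B′ * F) + E * B) (sym h≡2+f))))
    e₂ : ∀ L B ℓ u E d → (L + B * (1 + ℓ)) * u + (E + u * d) * B ≡ u * (L + B) + B * E + B * u * (ℓ + d)
    e₂ = solve-∀
    e₃ : ∀ B h B′ F n → B * (h * B′ * F) * n ≡ h * (B′ * B * F) * n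
    e₃ = solve-∀

  conclude : ∀ {M} n → K * (q * m) ≤ n → M ^ (f * A) ≤ 2 ^ (K + h * G * n) → M ^ (q * m) ≤ 2 ^ ((p * m + q) * n)
  conclude {M} n n-large bound = ^-cancelˡ-≤ (f * A) ⦃ m*n≢0 f A ⦃ f≢0 ⦄ ⦃ >-nonZero 1≤A ⦄ ⦄ M (q * m) 2 ((p * m + q) * n) (begin
    M ^ (f * A * (q * m))                ≡⟨ ^-*-assoc M (f * A) (q * m) ⟨
    (M ^ (f * A)) ^ (q * m)              ≤⟨ ^-monoˡ-≤ (q * m) bound ⟩
    (2 ^ (K + h * G * n)) ^ (q * m)      ≡⟨ ^-*-assoc 2 (K + h * G * n) (q * m) ⟩
    2 ^ ((K + h * G * n) * (q * m))      ≤⟨ ^-monoʳ-≤ 2 exponent ⟩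
    2 ^ (f * A * ((p * m + q) * n))      ∎)
    where
    open ≤-Reasoning
    e₁ : ∀ K h G n q m → (K + h * G * n) * (q * m) ≡ K * (q * m) + h * m * n * (q * G)
    e₁ = solve-∀
    e₂ : ∀ n A f p m → n * A * 1 + (2 + f) * m * n * (p * A) ≡ n * A * (1 + 2 * (p * m)) + f * m * n * (p * A)
    e₂ = solve-∀
    e₃ : ∀ n p m A f q → n * A * (f * q) + f * m * n * (p * A) ≡ f * A * ((p * m + q) * n)
    e₃ = solve-∀
    -- Using `h` in place of `f` costs `2 * m * n * (p * A)`, which is `n * A * (f - 1)` by the
    -- choice of `f`. The constant part costs at most `n`, so both fit into the room `f * A * q * n`
    -- that the allowance `1 / m` in the rate provides.
    exponent : (K + h * G * n) * (q * m) ≤ f * A * ((p * m + q) * n)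
    exponent = begin
      (K + h * G * n) * (q * m)                        ≡⟨ e₁ K h G n q m ⟩
      K * (q * m) + h * m * n * (q * G)                ≤⟨ +-mono-≤ n-large (*-monoʳ-≤ (h * m * n) rate) ⟩
      n + h * m * n * (p * A)                          ≤⟨ +-monoˡ-≤ (h * m * n * (p * A)) (≤-trans (m≤m*n n A ⦃ >-nonZero 1≤A ⦄) (≤-reflexive (sym (*-identityʳ (n * A))))) ⟩
      n * A * 1 + h * m * n * (p * A)                  ≡⟨ cong (λ z → n * A * 1 + z * m * n * (p * A)) h≡2+f ⟩
      n * A * 1 + (2 + f) * m * n * (p * A)            ≡⟨ e₂ n A f p m ⟩
      n * A * (1 + 2 * (p * m)) + f * m * n * (p * A)  ≡⟨ cong (λ z → n * A * z + f * m * n * (p * A)) f≡1+2pm ⟨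
      n * A * f + f * m * n * (p * A)                  ≤⟨ +-monoˡ-≤ (f * m * n * (p * A)) (*-monoʳ-≤ (n * A) (m≤m*n f q)) ⟩
      n * A * (f * q) + f * m * n * (p * A)            ≡⟨ e₃ n p m A f q ⟩
      f * A * ((p * m + q) * n)                        ∎

  asymptotic-bound : ∀ {M X} .⦃ _ : NonZero M ⦄ n ℓ → ℓ ≤ n → K * (q * m) ≤ n →
    M * w ^ suc ℓ ≤ 2 * s * b ^ suc ℓ → M ≤ 4 * X → X ^ (f * P) ≤ r ^ (h * ((n ∸ ℓ) * F)) →
    M ^ (q * m) ≤ 2 ^ ((p * m + q) * n)
  asymptotic-bound {M} n ℓ ℓ≤n n-large short M≤4X bound = conclude n n-large
    (subst (λ z → M ^ (f * A) ≤ 2 ^ (K + h * G * z)) (m+[n∸m]≡n ℓ≤n)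
      (combine ℓ (n ∸ ℓ) (log-prefix ℓ short) (log-suffix (n ∸ ℓ) M≤4X bound)))

  M₀ : ℕ
  M₀ = 4 * (h * s)

  rate-bound : .⦃ _ : NonZero P ⦄ .⦃ _ : NonZero s ⦄ → ∀ n M → K * (q * m) + M₀ ^ (q * m) ≤ n →
    (∀ ℓ → ℓ ≤ n → 2 * s * b ^ ℓ ≤ M * w ^ ℓ → M₀ ≤ M → ∃ λ X → M ≤ 4 * X × X ^ (f * P) ≤ r ^ (h * ((n ∸ ℓ) * F))) →
    M ^ (q * m) ≤ 2 ^ ((p * m + q) * n)
  rate-bound n M n-large size-bound with M₀ ≤? M
  ... | no M₀≰M = begin
    M ^ (q * m)              ≤⟨ ^-monoˡ-≤ (q * m) (<⇒≤ (≰⇒> M₀≰M)) ⟩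
    M₀ ^ (q * m)             ≤⟨ n≤2^n (M₀ ^ (q * m)) ⟩
    2 ^ (M₀ ^ (q * m))       ≤⟨ ^-monoʳ-≤ 2 (≤-trans (≤-trans (m≤n+m (M₀ ^ (q * m)) (K * (q * m))) n-large)
                                  (m≤n*m n (p * m + q) ⦃ >-nonZero (≤-trans (>-nonZero⁻¹ q) (m≤n+m q (p * m))) ⦄)) ⟩
    2 ^ ((p * m + q) * n)    ∎
    where open ≤-Reasoning
  ... | yes M₀≤M with search (λ ℓ → 2 * s * b ^ ℓ ≤? M * w ^ ℓ) (*-monoˡ-≤ 1 (≤-trans 2s≤M₀ M₀≤M)) n
    where
    2s≤M₀ : 2 * s ≤ M₀
    2s≤M₀ = *-mono-≤ {2} {4} (s≤s (s≤s z≤n)) (m≤n*m s h ⦃ h≢0 ⦄)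
  ...   | inj₂ (ℓ , ℓ≤n , Pℓ , ¬Psℓ) = let X , M≤4X , bound = size-bound ℓ ℓ≤n Pℓ M₀≤M in
    asymptotic-bound ⦃ >-nonZero (≤-trans (>-nonZero⁻¹ M₀ ⦃ m*n≢0 4 (h * s) ⦃ _ ⦄ ⦃ m*n≢0 h s ⦃ h≢0 ⦄ ⦄ ⦄) M₀≤M) ⦄ n ℓ ℓ≤n
      (≤-trans (m≤m+n (K * (q * m)) (M₀ ^ (q * m))) n-large) (<⇒≤ (≰⇒> ¬Psℓ)) M≤4X bound
  -- If the size sufficed for `ℓ = n`, no coordinate would be left to contribute: the bound would
  -- read `X ^ (f * P) ≤ 1`, although `X > 1`.
  ...   | inj₁ Pn = let X , M≤4X , bound = size-bound n ≤-refl Pn M₀≤M in ⊥-elim (<⇒≱ (1<X X M≤4X) (begin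
    X                                ≡⟨ *-identityʳ X ⟨
    X ^ 1                            ≤⟨ ^-monoʳ-≤ X ⦃ >-nonZero (<⇒≤ (1<X X M≤4X)) ⦄ (>-nonZero⁻¹ (f * P) ⦃ m*n≢0 f P ⦃ f≢0 ⦄ ⦄) ⟩
    X ^ (f * P)                      ≤⟨ bound ⟩
    r ^ (h * ((n ∸ n) * F))          ≡⟨ cong (λ z → r ^ (h * (z * F))) (n∸n≡0 n) ⟩
    r ^ (h * 0)                      ≡⟨ cong (r ^_) (*-zeroʳ h) ⟩
    1                                ∎))
    where
    open ≤-Reasoning
    1<X : ∀ X → M ≤ 4 * X → 1 < X
    1<X X M≤4X = ≤-trans (*-mono-≤ {2} {h} {1} {s} (≤-trans (m≤m+n 2 f) (≤-reflexive (sym h≡2+f))) (>-nonZero⁻¹ s))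
      (*-cancelˡ-≤ 4 (≤-trans M₀≤M M≤4X))

-- The bound for one pair of parameters

module _ (n₀ j : ℕ) (j<n₀ : j < n₀) (bal : Balanced n₀ j) where

  private
    b t w r : ℕ
    b = 2 + n₀
    t = 2 + j
    w = suc j
    r = n₀ ∸ j

    r+t≡b : r + t ≡ b
    r+t≡b = trans (+-suc r (suc j)) (cong suc (trans (+-suc r j) (cong suc (m∸n+n≡m (<⇒≤ j<n₀)))))

    r≢0 : NonZero r
    r≢0 = >-nonZero (m<n⇒0<n∸m j<n₀)

    bff : ℕ
    bff = fallⁿ b (suc t)

  module _ (f : ℕ) where

    private
      g h s : ℕ
      g = suc f
      h = suc g
      s = h * (t * t)

    module _ {n M : ℕ} (c : Fin M → Vec (Fin b) n) (code : IsHashCode b (2 + t) n M c) (ℓ : ℕ) (ℓ≤n : ℓ ≤ n)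
      (prefix : 2 * s * b ^ ℓ ≤ M * w ^ ℓ) (large : 4 * (h * s) ≤ M) where

      private
        J J′ : List (Fin n)
        J  = take ℓ (allFin n)
        J′ = drop ℓ (allFin n)

        J-length : length J ≡ ℓ
        J-length = trans (List.length-take ℓ (allFin n))
          (m≤n⇒m⊓n≡m (≤-trans ℓ≤n (≤-reflexive (sym (List.length-tabulate (id {A = Fin n}))))))

        J′-length : length J′ ≡ n ∸ ℓ
        J′-length = trans (List.length-drop ℓ (allFin n)) (cong (_∸ ℓ) (List.length-tabulate (id {A = Fin n})))

      -- `prefix` keeps the words outside the chunks below `M / 2`; with `large` this gives more
      -- than `2 * h` chunks, enough for the loss of one chunk to be absorbed.
      size-bound : ∃ λ X → M ≤ 4 * X × X ^ (f * b ^ suc t) ≤ r ^ (h * ((n ∸ ℓ) * bff))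
      size-bound with chunks (letter c) w (≤-trans (<⇒≤ (s≤s j<n₀)) (n≤1+n (suc n₀))) J s M (allFin M)
                        (≤-reflexive (List.length-tabulate (id {A = Fin M})))
      ... | Ts , rest , perm , good , small = X , M≤4X , final
        where
        open ≤-Reasoning
        instance
          _ : NonZero r
          _ = r≢0
        N X : ℕ
        N = length Ts
        X = pred N * s
        lengths : ∀ {T} → T ∈ Ts → length T ≡ s
        lengths T∈ = proj₁ (good T∈)
        unique : Unique (concat Ts)
        unique = proj₁ (Unique-++⁻ (concat Ts) (Unique-resp-↭ perm (allFin⁺ M)))
        M≡ : M ≡ N * s + length rest
        M≡ = trans (sym (List.length-tabulate (id {A = Fin M}))) (trans (length-↭-++ (concat Ts) perm)
          (cong (_+ length rest) (length-concat Ts lengths)))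
        2rest<M : 2 * length rest < M
        2rest<M = *-cancelˡ-< (w ^ ℓ) (2 * length rest) M (begin-strict
          w ^ ℓ * (2 * length rest)    ≡⟨ e₁ (w ^ ℓ) (length rest) ⟩
          2 * (w ^ ℓ * length rest)    <⟨ *-monoʳ-< 2 (subst (λ z → w ^ z * length rest < s * b ^ z) J-length small) ⟩
          2 * (s * b ^ ℓ)              ≡⟨ *-assoc 2 s (b ^ ℓ) ⟨
          2 * s * b ^ ℓ                ≤⟨ prefix ⟩
          M * w ^ ℓ                    ≡⟨ *-comm M (w ^ ℓ) ⟩
          w ^ ℓ * M                    ∎)
          where
          e₁ : ∀ u v → u * (2 * v) ≡ 2 * (u * v)
          e₁ = solve-∀
        M<2Ns : M < 2 * (N * s)
        M<2Ns = +-cancelʳ-< M _ _ (begin-strict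
          M + M                               ≡⟨ cong (M +_) (sym (+-identityʳ M)) ⟩
          2 * M                               ≡⟨ cong (2 *_) M≡ ⟩
          2 * (N * s + length rest)           ≡⟨ *-distribˡ-+ 2 (N * s) (length rest) ⟩
          2 * (N * s) + 2 * length rest       <⟨ +-monoʳ-< (2 * (N * s)) 2rest<M ⟩
          2 * (N * s) + M                     ∎)
        2h<N : 2 * h < N
        2h<N = *-cancelʳ-< s (2 * h) N (*-cancelˡ-< 2 _ _ (begin-strict
          2 * (2 * h * s)   ≡⟨ e₁ h s ⟩
          4 * (h * s)       ≤⟨ large ⟩
          M                 <⟨ M<2Ns ⟩
          2 * (N * s)       ∎))
          where
          e₁ : ∀ h s → 2 * (2 * h * s) ≡ 4 * (h * s)
          e₁ = solve-∀
        1≤N : 1 ≤ N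
        1≤N = ≤-trans (s≤s z≤n) 2h<N
        1+predN : suc (pred N) ≡ N
        1+predN = suc-pred N ⦃ >-nonZero 1≤N ⦄
        2h≤predN : 2 * h ≤ pred N
        2h≤predN = s≤s⁻¹ (≤-trans 2h<N (≤-reflexive (sym 1+predN)))
        M≤4X : M ≤ 4 * X
        M≤4X = begin
          M                                ≤⟨ <⇒≤ M<2Ns ⟩
          2 * (N * s)                      ≡⟨ cong (λ z → 2 * (z * s)) 1+predN ⟨
          2 * (suc (pred N) * s)           ≤⟨ *-monoʳ-≤ 2 (*-monoˡ-≤ s (+-monoˡ-≤ (pred N) (≤-trans (s≤s z≤n) 2h≤predN))) ⟩
          2 * ((pred N + pred N) * s)      ≡⟨ e₁ (pred N) s ⟩
          4 * X                            ∎
          where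
          e₁ : ∀ p s → 2 * ((p + p) * s) ≡ 4 * (p * s)
          e₁ = solve-∀
        X≢0 : NonZero X
        X≢0 = m*n≢0 (pred N) s ⦃ >-nonZero (≤-trans (s≤s z≤n) 2h≤predN) ⦄
        B = b ^ suc t
        Ψ′ = Ψ {b} {t} {n} {M} {r} r+t≡b c code Ts s lengths unique
        per-coordinate : ∀ i → B * ∑ⁿ Ts (Ψ′ i) ≤ N * (N * (bff * s ^ suc t))
        per-coordinate i = subst₂ _≤_ (cong₂ (λ z y → z ^ suc t * y) b≡ (∑ⁿ-cong Ts (λ T → rainbowⁿ-cong (count (letter c i) T) (λ a → sym (count-concat (letter c i) Ts a)) t (allFin b))))
          (cong (λ z → N * (N * (fallⁿ z (suc t) * s ^ suc t))) b≡)
          (rainbowⁿ-bound (count (letter c i)) Ts (allFin b) s n₀ j (>-nonZero⁻¹ s) 1≤N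
            (λ {T} T∈ → trans (∑-count (letter c i) T) (lengths T∈)) b≡ j<n₀ bal)
          where
          b≡ : length (allFin b) ≡ b
          b≡ = List.length-tabulate (id {A = Fin b})
          rainbowⁿ-cong : ∀ x {y y′ : Fin b → ℕ} → (∀ a → y a ≡ y′ a) → ∀ t l → rainbowⁿ x y t l ≡ rainbowⁿ x y′ t l
          rainbowⁿ-cong x eq zero    l = ∑ⁿ-cong l eq
          rainbowⁿ-cong x eq (suc t) l = ∑ⁿᵖ-cong l (λ {a} {q} _ → cong (x a *_) (rainbowⁿ-cong x eq t q))
        Ψ-sum : B * ∑ⁿ (allFin n) (λ i → ∑ⁿ Ts (Ψ′ i)) ≤ (n ∸ ℓ) * (N * (N * (bff * s ^ suc t)))
        Ψ-sum = begin
          B * ∑ⁿ (allFin n) Φ                                ≡⟨ cong (λ z → B * ∑ⁿ z Φ) (List.take++drop≡id ℓ (allFin n)) ⟨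
          B * ∑ⁿ (J ++ J′) Φ                                 ≡⟨ cong (B *_) (∑ⁿ-++ J J′ Φ) ⟩
          B * (∑ⁿ J Φ + ∑ⁿ J′ Φ)                             ≤⟨ *-monoʳ-≤ B (+-monoˡ-≤ (∑ⁿ J′ Φ) vanishing) ⟩
          B * ∑ⁿ J′ Φ                                        ≡⟨ ∑ⁿ-* J′ B Φ ⟨
          ∑ⁿ J′ (λ i → B * Φ i)                              ≤⟨ ∑ⁿ-mono J′ (λ {i} _ → per-coordinate i) ⟩
          ∑ⁿ J′ (λ _ → N * (N * (bff * s ^ suc t)))          ≡⟨ ∑ⁿ-const J′ _ ⟩
          length J′ * (N * (N * (bff * s ^ suc t)))          ≡⟨ cong (_* (N * (N * (bff * s ^ suc t)))) J′-length ⟩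
          (n ∸ ℓ) * (N * (N * (bff * s ^ suc t)))            ∎
          where
          Φ : Fin n → ℕ
          Φ i = ∑ⁿ Ts (Ψ′ i)
          vanishing : ∑ⁿ J Φ ≤ 0
          vanishing = ≤-trans (∑ⁿ-mono J (λ {i} i∈J → ≤-trans (∑ⁿ-mono Ts (λ {T} T∈ →
              ≤-reflexive (rainbow-vanishes (count (letter c i) T) (count (letter c i) (concat Ts)) t (allFin b) (s≤s (proj₂ (good T∈) i∈J)))))
              (≤-reflexive (∑ⁿ-0 Ts)))) (≤-reflexive (∑ⁿ-0 J))
        step₁ : X ^ (N * s * (pred N * fallⁿ s t * B)) ≤ r ^ (N * s * ((n ∸ ℓ) * (N * (bff * s ^ t))))
        step₁ = begin
          X ^ (N * s * (pred N * fallⁿ s t * B))              ≡⟨ cong (X ^_) (e₁ N s (pred N) (fallⁿ s t) B) ⟩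
          X ^ (N * (fallⁿ s t * X) * B)                       ≡⟨ ^-*-assoc X (N * (fallⁿ s t * X)) B ⟨
          (X ^ (N * (fallⁿ s t * X))) ^ B                     ≤⟨ ^-monoˡ-≤ B (code-bound r+t≡b c code Ts s lengths unique) ⟩
          (r ^ ∑ⁿ (allFin n) (λ i → ∑ⁿ Ts (Ψ′ i))) ^ B        ≡⟨ ^-*-assoc r (∑ⁿ (allFin n) (λ i → ∑ⁿ Ts (Ψ′ i))) B ⟩
          r ^ (∑ⁿ (allFin n) (λ i → ∑ⁿ Ts (Ψ′ i)) * B)        ≤⟨ ^-monoʳ-≤ r (≤-trans (≤-reflexive (*-comm _ B)) Ψ-sum) ⟩
          r ^ ((n ∸ ℓ) * (N * (N * (bff * s ^ suc t))))       ≡⟨ cong (r ^_) (e₂ (n ∸ ℓ) N bff s (s ^ t)) ⟩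
          r ^ (N * s * ((n ∸ ℓ) * (N * (bff * s ^ t))))       ∎
          where
          e₁ : ∀ N s p F B → N * s * (p * F * B) ≡ N * (F * (p * s)) * B
          e₁ = solve-∀
          e₂ : ∀ d N F s u → d * (N * (N * (F * (s * u)))) ≡ N * s * (d * (N * (F * u)))
          e₂ = solve-∀
        step₂ : X ^ (pred N * fallⁿ s t * B) ≤ r ^ ((n ∸ ℓ) * (N * (bff * s ^ t)))
        step₂ = ^-cancelˡ-≤ (N * s) ⦃ m*n≢0 N s ⦃ >-nonZero 1≤N ⦄ ⦄
          X (pred N * fallⁿ s t * B) r ((n ∸ ℓ) * (N * (bff * s ^ t))) step₁
        gN≤ : g * N ≤ h * pred N
        gN≤ = begin
          g * N                    ≡⟨ cong (g *_) 1+predN ⟨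
          g * suc (pred N)         ≡⟨ *-suc g (pred N) ⟩
          g + g * pred N           ≤⟨ +-monoˡ-≤ (g * pred N) (≤-trans (≤-trans (n≤1+n g) (m≤m+n h (h + 0))) 2h≤predN) ⟩
          pred N + g * pred N      ∎
        -- Two losses of at most a factor `g / h` occur, in `pred N` against `N` and in `fallⁿ s t`
        -- against `s ^ t`. Together they cost no more than `f / h`, because `f * h` is `g * g - 1`.
        final : X ^ (f * B) ≤ r ^ (h * ((n ∸ ℓ) * bff))
        final = ^-cancelˡ-≤ (h * (N * s ^ t)) ⦃ m*n≢0 h (N * s ^ t) ⦃ _ ⦄ ⦃ m*n≢0 N (s ^ t) ⦃ >-nonZero 1≤N ⦄ ⦃ m^n≢0 s t ⦄ ⦄ ⦄
          X (f * B) r (h * ((n ∸ ℓ) * bff)) (begin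
          X ^ (h * (N * s ^ t) * (f * B))
            ≤⟨ ^-monoʳ-≤ X ⦃ X≢0 ⦄ (begin
               h * (N * s ^ t) * (f * B)                   ≡⟨ e₁ f N (s ^ t) B ⟩
               (f * (2 + f)) * (N * s ^ t * B)             ≤⟨ *-monoˡ-≤ (N * s ^ t * B) (≤-trans (n≤1+n (f * (2 + f))) (≤-reflexive (e₂ f))) ⟩
               (g * g) * (N * s ^ t * B)                   ≡⟨ e₃ g N (s ^ t) B ⟩
               (g * N) * (g * s ^ t) * B                   ≤⟨ *-monoˡ-≤ B (*-mono-≤ gN≤ (fallⁿ-lower g (suc j))) ⟩
               (h * pred N) * (h * fallⁿ s t) * B          ≡⟨ e₄ h (pred N) (fallⁿ s t) B ⟩
               pred N * fallⁿ s t * B * (h * h)            ∎) ⟩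
          X ^ (pred N * fallⁿ s t * B * (h * h))
            ≡⟨ ^-*-assoc X (pred N * fallⁿ s t * B) (h * h) ⟨
          (X ^ (pred N * fallⁿ s t * B)) ^ (h * h)
            ≤⟨ ^-monoˡ-≤ (h * h) step₂ ⟩
          (r ^ ((n ∸ ℓ) * (N * (bff * s ^ t)))) ^ (h * h)
            ≡⟨ ^-*-assoc r ((n ∸ ℓ) * (N * (bff * s ^ t))) (h * h) ⟩
          r ^ ((n ∸ ℓ) * (N * (bff * s ^ t)) * (h * h))
            ≡⟨ cong (r ^_) (e₅ (n ∸ ℓ) N bff (s ^ t) h) ⟩
          r ^ (h * (N * s ^ t) * (h * ((n ∸ ℓ) * bff))) ∎)
          where
          e₁ : ∀ f N u B → (2 + f) * (N * u) * (f * B) ≡ (f * (2 + f)) * (N * u * B)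
          e₁ = solve-∀
          e₂ : ∀ f → 1 + f * (2 + f) ≡ (1 + f) * (1 + f)
          e₂ = solve-∀
          e₃ : ∀ g N u B → (g * g) * (N * u * B) ≡ (g * N) * (g * u) * B
          e₃ = solve-∀
          e₄ : ∀ h p F B → (h * p) * (h * F) * B ≡ p * F * B * (h * h)
          e₄ = solve-∀
          e₅ : ∀ d N F u h → d * (N * (F * u)) * (h * h) ≡ h * (N * u) * (h * (d * F))
          e₅ = solve-∀

  module _ (p q : ℕ) .⦃ _ : NonZero q ⦄ (D B D′ B′ : ℕ)
    (log-b/w : b ^ D ≤ w ^ D * 2 ^ B) (log-r : r ^ D′ ≤ 2 ^ B′)
    (1≤A : 1 ≤ D * B′ * bff + b ^ suc t * D′ * B)
    (rate : q * (B′ * B * bff) ≤ p * (D * B′ * bff + b ^ suc t * D′ * B)) where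

    rateAtMost : RateAtMost b (2 + t) p q
    rateAtMost m _ = K * (q * m) + M₀ ^ (q * m) ,
      λ n n-large M c code → rate-bound ⦃ m^n≢0 b (suc t) ⦄ n M n-large (size-bound f c code)
      where
      f h s : ℕ
      f = 1 + 2 * (p * m)
      h = 2 + f
      s = h * (t * t)
      open Asymptotics b w r (b ^ suc t) bff p q D B D′ B′ log-b/w log-r 1≤A rate m f h s refl refl

-- Numerical certificates for the table

private
  balanced? : ∀ n j → Dec (Balanced n j)
  balanced? n j = _ ℤ.≤? _

module _ (n j p q : ℕ) .⦃ _ : NonZero q ⦄ (D B D′ B′ : ℕ) where

  private
    b = 2 + n
    t = 2 + j
    F = fallⁿ b (suc t)
    A = D * B′ * F + b ^ suc t * D′ * B

  -- B / D and B′ / D′ bound log₂ (b / (t - 1)) and log₂ (b - t) from above.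
  Certificate : Set
  Certificate = j < n × Balanced n j × b ^ D ≤ suc j ^ D * 2 ^ B × (n ∸ j) ^ D′ ≤ 2 ^ B′ ×
    1 ≤ A × q * (B′ * B * F) ≤ p * A

  certificate? : Dec Certificate
  certificate? = j <? n ×-dec balanced? n j ×-dec _ ≤? _ ×-dec _ ≤? _ ×-dec _ ≤? _ ×-dec _ ≤? _

  certified : True certificate? → RateAtMost (2 + n) (4 + j) p q
  certified ok with toWitness ok
  ... | j<n , bal , log-b/w , log-r , 1≤A , rate = rateAtMost n j j<n bal p q D B D′ B′ log-b/w log-r 1≤A rate

RowBound : ℕ × ℕ × ℕ → Set
RowBound (b , k , p) = RateAtMost b k p 100000

-- A row starts with `b - 2` and `k - 4`. Its last four numbers `D B D′ B′` give fractions `B / D`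
-- and `B′ / D′` so close above the two logarithms that the resulting rate stays within the listed
-- number; evaluation of `certificate?` confirms this.
table-bounds : All RowBound table
table-bounds =
  certified 3 1 16894 100000 3 4 1 1 _ ∷
  certified 4 1 34512 100000 17 27 29 46 _ ∷
  certified 4 2 8475 100000 1 1 1 1 _ ∷
  certified 5 2 19897 100000 373 456 253 401 _ ∷
  certified 6 2 31799 100000 53 75 1 2 _ ∷
  certified 7 2 43237 100000 200 317 205 476 _ ∷
  certified 8 2 53909 100000 384 667 253 654 _ ∷
  certified 9 2 63766 100000 239 448 244 685 _ ∷
  certified 10 2 72848 100000 1 2 1 3 _ ∷
  certified 11 2 81227 100000 381 806 153 485 _ ∷
  certified 12 2 88978 100000 580 1289 351 1166 _ ∷
  certified 5 3 4090 100000 6 5 1 1 _ ∷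
  certified 6 3 10865 100000 1 1 200 317 _ ∷
  certified 7 3 19054 100000 153 179 1 2 _ ∷
  certified 8 3 27741 100000 205 271 205 476 _ ∷
  certified 9 3 36424 100000 37 54 253 654 _ ∷
  certified 10 3 44850 100000 253 401 135 379 _ ∷
  certified 11 3 52902 100000 197 335 1 3 _ ∷
  certified 12 3 60538 100000 244 441 153 485 _ ∷
  certified 6 4 1889 100000 1 1 1 1 _ ∷
  certified 7 4 5616 100000 33 28 41 65 _ ∷
  certified 8 4 10791 100000 1 1 1 2 _ ∷
  certified 9 4 16878 100000 109 124 59 137 _ ∷
  certified 10 4 23451 100000 19 24 200 517 _ ∷
  certified 11 4 30214 100000 140 193 135 379 _ ∷
  certified 12 4 36974 100000 103 153 1 3 _ ∷
  certified 8 5 2773 100000 4 3 29 46 _ ∷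
  certified 9 5 5796 100000 8 7 1 2 _ ∷
  certified 10 5 9730 100000 1 1 59 137 _ ∷
  certified 11 5 14332 100000 147 164 147 380 _ ∷
  certified 12 5 19382 100000 265 324 135 379 _ ∷
  certified 9 6 1321 100000 3 2 17 27 _ ∷
  certified 10 6 2978 100000 9 7 1 2 _ ∷
  certified 11 6 5342 100000 47 42 59 137 _ ∷
  certified 12 6 8332 100000 1 1 306 791 _ ∷
  certified 11 7 1476 100000 7 5 1 2 _ ∷
  certified 12 7 2815 100000 135 109 31 72 _ ∷
  certified 12 8 712 100000 3 2 1 2 _ ∷
  certified 13 9 335 100000 1 1 1 2 _ ∷
  []

theorem1 : ∀ {b k p : ℕ} → (b , k , p) ∈ table → RateAtMost b k p 100000
theorem1 row∈table = All.lookup table-bounds row∈table
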